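{- Let $V$ be a real inner-product space of finite dimension $d\ge1$, let $U$ be an abelian group with a translation-invariant ultrametric, let $\Lambda\subset V\times U$ be a closed additive subgroup, and let $X=(V\times U)/\Lambda$ carry the quotient metric induced by the maximum product metric. Suppose that the effective real dimension satisfies $m_\Lambda\in\{1,2\}$. Then for every $\alpha\in X$, with strict best-return denominators $q_1<q_2<\cdots$, $$q_{n+2^{m_\Lambda}+1}>q_n+q_{n+1}$$ for every $n\ge1$ for which the left-hand side is defined. Moreover, in both effective dimensions the index $2^{m_\Lambda}+1$ cannot be replaced by $2^{m_\Lambda}$, even if the conclusion is weakened to a non-strict inequality: for each $m\in\{1,2\}$ there exist a real inner-product space $V$ of finite dimension at least $1$, an abelian group $U$ with a translation-invariant ultrametric, and a closed additive subgroup $\Lambda\subset V\times U$ with $m_\Lambda=m$, together with an element $\alpha\in X=(V\times U)/\Lambda$ (where $X$ carries the quotient metric induced by the maximum product metric) and an index $n\ge1$, such that the strict best-return denominators of $\alpha$ have $q_{n+2^{m}}$ defined and $q_{n+2^{m}}<q_n+q_{n+1}$.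
   Context: Metric setting. Write the ultrametric on $U$ as $d_U(u,w)=|u-w|_U$, so $|u+w|_U\le\max\{|u|_U,|w|_U\}$. On $V\times U$ put $|(v,u)|=\max\{\|v\|_V,|u|_U\}$, where $\|\cdot\|_V$ is the norm induced by the inner product; "closed" refers to the induced metric topology. On $X=(V\times U)/\Lambda$ put $\|a+\Lambda\|_X=\inf_{\lambda\in\Lambda}|a-\lambda|$ and $d_X(x,y)=\|x-y\|_X$. The infimum need not be attained. Best returns. For positive integers $q$ put $\rho(q)=d_X(q\alpha,0)$. The strict best-return denominators of $\alpha$ are $q_1=1$ and $q_{n+1}=\min\{q>q_n:\rho(q)<\rho(q_n)\}$ as long as such $q$ exists; the sequence may terminate, and a zero return (if any) is retained as its final term. Effective real dimension. $W=\{v\in V:(tv,0)\in\Lambda\text{ for every }t\in\mathbb R\}$; $\pi:V\to W^\perp$ is orthogonal projection; $E_\Lambda=\operatorname{span}_{\mathbb R}\{\pi(v):(v,u)\in\Lambda\}$; $m_\Lambda=\dim E_\Lambda$. -}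

module Defs where

open import Algebra.Bundles using (CommutativeRing; AbelianGroup)
import Algebra.Construct.DirectProduct as DirectProduct
import Algebra.Construct.NaturalChoice.Max as Max
open import Algebra.Definitions.RawMonoid using () renaming (_×_ to multiple)
open import Algebra.Module.Bundles using (Module)
import Algebra.Properties.AbelianGroup as AbelianGroupProperties
import Algebra.Properties.CommutativeSemigroup as CommutativeSemigroupProperties
import Algebra.Properties.Monoid.Sum as Sum
open import Data.Fin.Base using (Fin)
open import Data.Nat.Base as ℕ using (ℕ; suc)
open import Data.Product.Base using (_×_; _,_; ∃; ∃-syntax; proj₁)
open import Data.Vec.Functional using (Vector)
open import Function.Metric.Definitions using (TranslationInvariant)
open import Function.Metric.Structures using (IsGeneralMetric)
open import Level using (0ℓ)
import Relation.Binary.Construct.NonStrictToStrict as NonStrictToStrict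
open import Relation.Binary.Bundles using (TotalOrder)
open import Relation.Binary.Core using (Rel)
open import Relation.Binary.Structures using (IsTotalOrder)
import Relation.Binary.Reasoning.Setoid as SetoidReasoning
open import Relation.Nullary.Negation using (¬_)
open import Relation.Unary using (Pred; _∈_) renaming (U to Everything)

-- The library has no real numbers.  ℝ enters as an arbitrary Dedekind-complete
-- ordered field; classically there is exactly one up to isomorphism.

record CompleteOrderedField : Set₁ where
  field
    commutativeRing : CommutativeRing 0ℓ 0ℓ

  open CommutativeRing commutativeRing public

  infix 4 _≤_
  field
    _≤_          : Rel Carrier 0ℓ
    isTotalOrder : IsTotalOrder _≈_ _≤_
    0≉1          : ¬ (0# ≈ 1#)
    *-inverse    : ∀ x → ¬ (x ≈ 0#) → ∃[ y ] x * y ≈ 1#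
    +-monoʳ-≤    : ∀ z {x y} → x ≤ y → z + x ≤ z + y
    *-nonNeg     : ∀ {x y} → 0# ≤ x → 0# ≤ y → 0# ≤ x * y

  IsLowerBound : Pred Carrier 0ℓ → Pred Carrier 0ℓ
  IsLowerBound P m = ∀ x → x ∈ P → m ≤ x

  IsInfimum : Pred Carrier 0ℓ → Pred Carrier 0ℓ
  IsInfimum P m = IsLowerBound P m × (∀ l → IsLowerBound P l → l ≤ m)

  field
    complete : ∀ P → ∃ P → ∃ (IsLowerBound P) → ∃ (IsInfimum P)

  inf : ∀ P → ∃ P → ∃ (IsLowerBound P) → Carrier
  inf P nonempty bounded = proj₁ (complete P nonempty bounded)

  totalOrder : TotalOrder 0ℓ 0ℓ 0ℓ
  totalOrder = record { isTotalOrder = isTotalOrder }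

  open Max totalOrder public using (_⊔_; x≤x⊔y)
  open NonStrictToStrict _≈_ _≤_ public using (_<_)
  open IsTotalOrder isTotalOrder public using () renaming (trans to ≤-trans)

record InnerProductSpace (ℝ : CompleteOrderedField) : Set₁ where
  private module ℝ = CompleteOrderedField ℝ
  field
    vectorSpace : Module ℝ.commutativeRing 0ℓ 0ℓ

  open Module vectorSpace public

  field
    ⟨_,_⟩        : Carrierᴹ → Carrierᴹ → ℝ.Carrier
    ⟨,⟩-cong     : ∀ {v v′ w w′} → v ≈ᴹ v′ → w ≈ᴹ w′ → ⟨ v , w ⟩ ℝ.≈ ⟨ v′ , w′ ⟩
    ⟨,⟩-sym      : ∀ v w → ⟨ v , w ⟩ ℝ.≈ ⟨ w , v ⟩
    ⟨,⟩-+        : ∀ v v′ w → ⟨ v +ᴹ v′ , w ⟩ ℝ.≈ ⟨ v , w ⟩ ℝ.+ ⟨ v′ , w ⟩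
    ⟨,⟩-*        : ∀ t v w → ⟨ t *ₗ v , w ⟩ ℝ.≈ t ℝ.* ⟨ v , w ⟩
    ⟨,⟩-nonNeg   : ∀ v → ℝ.0# ℝ.≤ ⟨ v , v ⟩
    ⟨,⟩-definite : ∀ v → ⟨ v , v ⟩ ℝ.≈ ℝ.0# → v ≈ᴹ 0ᴹ

  -- The norm is the nonnegative square root of ⟨ v , v ⟩; these fields
  -- determine it up to _≈_, so it is not additional structure.
  field
    ‖_‖       : Carrierᴹ → ℝ.Carrier
    ‖‖-nonNeg : ∀ v → ℝ.0# ℝ.≤ ‖ v ‖
    ‖‖-square : ∀ v → ‖ v ‖ ℝ.* ‖ v ‖ ℝ.≈ ⟨ v , v ⟩

  linearCombination : ∀ {n} → Vector ℝ.Carrier n → Vector Carrierᴹ n → Carrierᴹ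
  linearCombination c b = Sum.sum +ᴹ-monoid (λ i → c i *ₗ b i)

  Span : Pred Carrierᴹ 0ℓ → Pred Carrierᴹ 0ℓ
  Span P v = ∃[ n ] ∃[ c ] ∃[ b ]
    (∀ (i : Fin n) → b i ∈ P) × v ≈ᴹ linearCombination c b

  record IsBasisOf (S : Pred Carrierᴹ 0ℓ) {n : ℕ} (b : Vector Carrierᴹ n) : Set where
    field
      members     : ∀ i → b i ∈ S
      independent : ∀ c → linearCombination c b ≈ᴹ 0ᴹ → ∀ i → c i ℝ.≈ ℝ.0#
      spanning    : ∀ v → v ∈ S → ∃[ c ] v ≈ᴹ linearCombination c b

  HasDimension : Pred Carrierᴹ 0ℓ → ℕ → Set
  HasDimension S n = ∃[ b ] IsBasisOf S {n} b

  OrthogonalComplement : Pred Carrierᴹ 0ℓ → Pred Carrierᴹ 0ℓ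
  OrthogonalComplement S v = ∀ w → w ∈ S → ⟨ v , w ⟩ ℝ.≈ ℝ.0#

  -- p is the orthogonal projection of v onto the complement of the subspace S.
  IsProjectionOntoComplement : Pred Carrierᴹ 0ℓ → Carrierᴹ → Carrierᴹ → Set
  IsProjectionOntoComplement S v p =
    p ∈ OrthogonalComplement S × (v +ᴹ (-ᴹ p)) ∈ S

DimensionOf : ∀ {ℝ} → InnerProductSpace ℝ → ℕ → Set
DimensionOf V = HasDimension Everything
  where open InnerProductSpace V

record UltrametricGroup (ℝ : CompleteOrderedField) : Set₁ where
  private module ℝ = CompleteOrderedField ℝ
  field
    abelianGroup : AbelianGroup 0ℓ 0ℓ

  open AbelianGroup abelianGroup public

  field
    dist                 : Carrier → Carrier → ℝ.Carrier
    isUltrametric        : IsGeneralMetric _≈_ ℝ._≈_ ℝ._≤_ ℝ.0# ℝ._⊔_ dist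
    translationInvariant : TranslationInvariant ℝ._≈_ _∙_ dist

  ∣_∣ : Carrier → ℝ.Carrier
  ∣ u ∣ = dist u ε

module _ {ℝ : CompleteOrderedField}
         (V : InnerProductSpace ℝ) (U : UltrametricGroup ℝ) where

  private
    module ℝ = CompleteOrderedField ℝ
    module V = InnerProductSpace V
    module U = UltrametricGroup U

  productGroup : AbelianGroup 0ℓ 0ℓ
  productGroup = DirectProduct.abelianGroup V.+ᴹ-abelianGroup U.abelianGroup

  private module G = AbelianGroup productGroup

  productNorm : G.Carrier → ℝ.Carrier
  productNorm (v , u) = V.‖ v ‖ ℝ.⊔ U.∣ u ∣

  productNorm-nonNeg : ∀ a → ℝ.0# ℝ.≤ productNorm a
  productNorm-nonNeg (v , u) =
    ℝ.≤-trans (V.‖‖-nonNeg v) (ℝ.x≤x⊔y V.‖ v ‖ U.∣ u ∣)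

  record ClosedSubgroup : Set₁ where
    field
      Member      : Pred G.Carrier 0ℓ
      respects    : ∀ {a b} → a G.≈ b → a ∈ Member → b ∈ Member
      ε-closed    : G.ε ∈ Member
      ∙-closed    : ∀ {a b} → a ∈ Member → b ∈ Member → (a G.∙ b) ∈ Member
      ⁻¹-closed   : ∀ {a} → a ∈ Member → (a G.⁻¹) ∈ Member
      topologicallyClosed :
        ∀ a → (∀ δ → ℝ.0# ℝ.< δ →
                 ∃[ l ] l ∈ Member × productNorm (a G.- l) ℝ.< δ) →
        a ∈ Member

module _ {ℝ : CompleteOrderedField}
         {V : InnerProductSpace ℝ} {U : UltrametricGroup ℝ}
         (Λ : ClosedSubgroup V U) where

  private
    module ℝ = CompleteOrderedField ℝ
    module V = InnerProductSpace V
    module U = UltrametricGroup U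
    module G = AbelianGroup (productGroup V U)
    module Λ = ClosedSubgroup Λ
    open AbelianGroupProperties (productGroup V U)
      using (⁻¹-∙-comm; ⁻¹-anti-homo‿-; x≈y⇒x∙y⁻¹≈ε)
    open CommutativeSemigroupProperties G.commutativeSemigroup using (interchange)
    open SetoidReasoning G.setoid

    _≈Λ_ : Rel G.Carrier 0ℓ
    a ≈Λ b = (a G.- b) ∈ Λ.Member

    ≈⇒≈Λ : ∀ {a b} → a G.≈ b → a ≈Λ b
    ≈⇒≈Λ a≈b = Λ.respects (G.sym (x≈y⇒x∙y⁻¹≈ε a≈b)) Λ.ε-closed

    ≈Λ-sym : ∀ {a b} → a ≈Λ b → b ≈Λ a
    ≈Λ-sym {a} {b} p = Λ.respects (⁻¹-anti-homo‿- a b) (Λ.⁻¹-closed p)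

    ≈Λ-trans : ∀ {a b c} → a ≈Λ b → b ≈Λ c → a ≈Λ c
    ≈Λ-trans {a} {b} {c} p q = Λ.respects eq (Λ.∙-closed p q)
      where
      eq : (a G.- b) G.∙ (b G.- c) G.≈ a G.- c
      eq = begin
        (a G.- b) G.∙ (b G.- c)                ≈⟨ G.assoc a (b G.⁻¹) (b G.- c) ⟩
        a G.∙ (b G.⁻¹ G.∙ (b G.- c))           ≈⟨ G.∙-congˡ (G.assoc (b G.⁻¹) b (c G.⁻¹)) ⟨
        a G.∙ ((b G.⁻¹ G.∙ b) G.∙ c G.⁻¹)      ≈⟨ G.∙-congˡ (G.∙-congʳ (G.inverseˡ b)) ⟩
        a G.∙ (G.ε G.∙ c G.⁻¹)                 ≈⟨ G.∙-congˡ (G.identityˡ (c G.⁻¹)) ⟩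
        a G.- c                                ∎

    ≈Λ-∙-cong : ∀ {a b c d} → a ≈Λ b → c ≈Λ d → (a G.∙ c) ≈Λ (b G.∙ d)
    ≈Λ-∙-cong {a} {b} {c} {d} p q = Λ.respects eq (Λ.∙-closed p q)
      where
      eq : (a G.- b) G.∙ (c G.- d) G.≈ (a G.∙ c) G.- (b G.∙ d)
      eq = begin
        (a G.- b) G.∙ (c G.- d)                ≈⟨ interchange a (b G.⁻¹) c (d G.⁻¹) ⟩
        (a G.∙ c) G.∙ (b G.⁻¹ G.∙ d G.⁻¹)      ≈⟨ G.∙-congˡ (⁻¹-∙-comm b d) ⟩
        (a G.∙ c) G.- (b G.∙ d)                ∎

    ≈Λ-⁻¹-cong : ∀ {a b} → a ≈Λ b → (a G.⁻¹) ≈Λ (b G.⁻¹)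
    ≈Λ-⁻¹-cong {a} {b} p =
      Λ.respects (G.sym (⁻¹-∙-comm a (b G.⁻¹))) (Λ.⁻¹-closed p)

  -- Elements are represented by pairs, identified when they differ by Λ.
  Quotient : AbelianGroup 0ℓ 0ℓ
  Quotient = record
    { Carrier = G.Carrier
    ; _≈_     = _≈Λ_
    ; _∙_     = G._∙_
    ; ε       = G.ε
    ; _⁻¹     = G._⁻¹
    ; isAbelianGroup = record
      { isGroup = record
        { isMonoid = record
          { isSemigroup = record
            { isMagma = record
              { isEquivalence = record
                { refl = ≈⇒≈Λ G.refl ; sym = ≈Λ-sym ; trans = ≈Λ-trans }
              ; ∙-cong = ≈Λ-∙-cong
              }
            ; assoc = λ a b c → ≈⇒≈Λ (G.assoc a b c)
            }
          ; identity = (λ a → ≈⇒≈Λ (G.identityˡ a)) , (λ a → ≈⇒≈Λ (G.identityʳ a))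
          }
        ; inverse = (λ a → ≈⇒≈Λ (G.inverseˡ a)) , (λ a → ≈⇒≈Λ (G.inverseʳ a))
        ; ⁻¹-cong = ≈Λ-⁻¹-cong
        }
      ; comm = λ a b → ≈⇒≈Λ (G.comm a b)
      }
    }

  private module X = AbelianGroup Quotient

  DistancesToΛ : X.Carrier → Pred ℝ.Carrier 0ℓ
  DistancesToΛ a r = ∃[ l ] l ∈ Λ.Member × r ℝ.≈ productNorm V U (a G.- l)

  quotientNorm : X.Carrier → ℝ.Carrier
  quotientNorm a = ℝ.inf (DistancesToΛ a)
    (productNorm V U (a G.- G.ε) , G.ε , Λ.ε-closed , ℝ.refl)
    (ℝ.0# , λ { r (l , _ , r≈) →
      IsTotalOrder.≤-respʳ-≈ ℝ.isTotalOrder (ℝ.sym r≈)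
        (productNorm-nonNeg V U (a G.- l)) })

  quotientDist : X.Carrier → X.Carrier → ℝ.Carrier
  quotientDist x y = quotientNorm (x X.- y)

  ρ : X.Carrier → ℕ → ℝ.Carrier
  ρ α q = quotientDist (multiple X.rawMonoid q α) X.ε

  IsLeast : Pred ℕ 0ℓ → ℕ → Set
  IsLeast P q = q ∈ P × (∀ r → r ∈ P → q ℕ.≤ r)

  -- BestReturn α n q: the n-th strict best-return denominator of α (counted
  -- from n = 1) is defined and equals q.
  data BestReturn (α : X.Carrier) : ℕ → ℕ → Set where
    first : BestReturn α 1 1
    next  : ∀ {n q q′} → BestReturn α n q →
            IsLeast (λ r → q ℕ.< r × ρ α r ℝ.< ρ α q) q′ →
            BestReturn α (suc n) q′

  LineSpace : Pred V.Carrierᴹ 0ℓ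
  LineSpace v = ∀ t → (t V.*ₗ v , U.ε) ∈ Λ.Member

  EffectiveSpace : Pred V.Carrierᴹ 0ℓ
  EffectiveSpace = V.Span λ p →
    ∃[ v ] ∃[ u ] (v , u) ∈ Λ.Member × V.IsProjectionOntoComplement LineSpace v p

  EffectiveDimension : ℕ → Set
  EffectiveDimension = V.HasDimension EffectiveSpace

{-# OPTIONS --safe #-}
module Submission where

-- Suppose q″ ≤ q + q′ and let R = ρ(q).  The returns from q′ to q″ have
-- representatives of norm < R, while a multiple kα with 0 < k < q′ has norm ≥ R;
-- so the differences of these representatives have norm ≥ R, and as their
-- ultrametric part is < R, their real part is ≥ R.  After projection to the
-- effective space and a correction of R for the part of α orthogonal to it, one
-- gets 2^m + 1 vectors of norm < R at mutual distances ≥ R.  This is impossible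
-- on a line.  In the plane the five vectors are cyclically ordered, and for
-- consecutive s, t, p, q, r the vectors z = s + p - t, z - q and z - r are all
-- shorter than R.  If t is the highest return, then the height of z (the
-- corresponding combination of return times) lies in (0 , 2q′); as z is short, it
-- even lies in [q′ , 2q′); as z - q and z - r are short, it agrees with the heights
-- of both q and r, which are distinct.
--
-- For sharpness, take a rational point of a plane lattice together with a
-- nontrivial component in ℤ/2, whose norm is tuned so that the return q is odd
-- and the subsequent ones are even; the parameters were found by a search.

open import Defs
open import Algebra.Bundles using (AbelianGroup)
import Algebra.Construct.NaturalChoice.Max as Max
open import Algebra.Definitions.RawMonoid using () renaming (_×_ to multiple)
import Algebra.Module.Construct.DirectProduct as ModuleProduct
import Algebra.Module.Construct.TensorUnit as TensorUnit
import Algebra.Properties.AbelianGroup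
import Algebra.Properties.CommutativeSemigroup
import Algebra.Properties.Monoid.Mult
import Algebra.Properties.Ring
import Algebra.Properties.Semiring.Mult
import Algebra.Solver.Ring
open import Algebra.Solver.Ring.AlmostCommutativeRing
  using (fromCommutativeRing; _-Raw-AlmostCommutative⟶_)
open import Axiom.ExcludedMiddle using (ExcludedMiddle)
open import Data.Empty using (⊥; ⊥-elim)
open import Data.Fin.Base using (Fin; zero; suc; toℕ)
open import Data.Fin.Patterns
open import Data.Fin.Properties using (toℕ-injective; toℕ<n)
open import Data.Integer.Base as ℤ using (ℤ; +_; -[1+_]; +-*-rawRing)
import Data.Integer.Properties as ℤₚ
import Data.Integer.Tactic.RingSolver as ℤ-Solver
open import Data.List.Base using ([]; _∷_)
open import Data.List.Relation.Unary.All using ([]; _∷_)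
open import Data.List.Relation.Unary.AllPairs using ([]; _∷_)
open import Data.List.Relation.Unary.Unique.Propositional using (Unique)
open import Data.Maybe.Base using (Maybe; just; nothing)
open import Data.Nat.Base as ℕ using (ℕ; zero; suc; NonZero)
import Data.Nat.DivMod as ℕ
import Data.Nat.Properties as ℕₚ
open import Data.Parity.Base as ℙ using (Parity; 0ℙ; 1ℙ)
import Data.Parity.Properties as ℙₚ
open import Data.Product.Base using (_×_; _,_; proj₁; proj₂; ∃-syntax; Σ-syntax)
import Data.Sign.Base as Sign
open import Data.Sum.Base using (_⊎_; inj₁; inj₂)
open import Data.Vec.Functional using (Vector; head; tail)
open import Function.Base using (_∘_)
open import Function.Metric.Structures using (IsGeneralMetric)
open import Level using (0ℓ)
import Relation.Binary.Construct.NonStrictToStrict as NonStrictToStrict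
open import Relation.Binary.Definitions using (tri<; tri≈; tri>)
open import Relation.Binary.PropositionalEquality as ≡ using (_≡_; _≢_; ≢-sym)
import Relation.Binary.Reasoning.Setoid
open import Relation.Binary.Structures using (IsTotalOrder)
open import Relation.Nullary using (¬_; yes; no; Dec)
open import Relation.Nullary.Decidable using (from-yes; _→-dec_; _×-dec_)
open import Relation.Unary using (Pred; _∈_) renaming (U to Everything)

-- Ordered fields

-- The correction of R: modulo the line space, a representative of kα splits orthogonally into its
-- coordinates in the effective space and k f, where f depends on α alone; its squared length is N +
-- k²|f|². Put T = R² - q′²|f|². A return at k ≥ q′ with norm below R has N < T, while for 0 < k <
-- q′ the bound N + k²|f|² ≥ R² gives N ≥ T, so one threshold serves both the lengths and the
-- distances. Components in the line space are cut off first: they lengthen a representative without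
-- changing its class. Since the infimum need not be attained, representatives are chosen below a
-- strict bound; hence lengths are always strict and distances non-strict inequalities. Angles are
-- avoided in the plane: orientation is the sign of a determinant, lengths enter squared, and
-- inequalities are certified by polynomial identities. Behind these is the fact that two vectors
-- shorter than R at distance at least R enclose more than 60 degrees, so neither closed side of the
-- line through one of the vectors holds three others. This forces the cyclic order of five.

module OrderedField (em : ExcludedMiddle 0ℓ) (ℝ : CompleteOrderedField) where

  open CompleteOrderedField ℝ public hiding (zero)
  open IsTotalOrder isTotalOrder public using (isPartialOrder)
    renaming (reflexive to ≤-reflexive; refl to ≤-refl; antisym to ≤-antisym;
              total to ≤-total; ≤-respʳ-≈ to ≤-respʳ; ≤-respˡ-≈ to ≤-respˡ)
  open Algebra.Properties.Ring ring public
    using (-‿distribˡ-*; -‿distribʳ-*; -0#≈0#; -‿involutive; -‿+-comm)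
  open Algebra.Properties.Semiring.Mult semiring public
    using () renaming (_×_ to infixr 8 _·_; ×-homo-+ to ·-homo-+; ×1-homo-* to ·1-homo-*)

  open Max totalOrder public using (⊔-sel; ⊔-cong; x≤y⊔x; x≤y⇒x⊔y≈y; x≤y⇒y⊔x≈y)

  module ≈-Reasoning = Relation.Binary.Reasoning.Setoid setoid
  private module S = NonStrictToStrict _≈_ _≤_

  -- Equality in the field is not computable, so the ring solver gets integer coefficients through
  -- this map. As `ι (+ 1)` unfolds to `1# + 0#`, identities that mention `1#` itself pass it to the
  -- solver as a variable.
  ι : ℤ → Carrier
  ι (+ n)    = n · 1#
  ι -[1+ n ] = - (suc n · 1#)

  private
    cancel-1 : ∀ a b → a - b ≈ (1# + a) - (1# + b)
    cancel-1 a b = begin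
      a - b                          ≈⟨ +-identityˡ _ ⟨
      0# + (a - b)                   ≈⟨ +-congʳ (-‿inverseʳ 1#) ⟨
      (1# - 1#) + (a - b)            ≈⟨ +-assoc _ _ _ ⟩
      1# + (- 1# + (a - b))          ≈⟨ +-congˡ (+-assoc _ _ _) ⟨
      1# + ((- 1# + a) - b)          ≈⟨ +-congˡ (+-congʳ (+-comm _ _)) ⟩
      1# + ((a - 1#) - b)            ≈⟨ +-congˡ (+-assoc _ _ _) ⟩
      1# + (a + (- 1# - b))          ≈⟨ +-assoc _ _ _ ⟨
      (1# + a) + (- 1# - b)          ≈⟨ +-congˡ (-‿+-comm _ _) ⟩
      (1# + a) - (1# + b)            ∎
      where open ≈-Reasoning

    ι-⊖ : ∀ m n → ι (m ℤ.⊖ n) ≈ m · 1# - n · 1#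
    ι-⊖ m zero = sym (trans (+-congˡ -0#≈0#) (+-identityʳ _))
    ι-⊖ zero (suc n) = sym (+-identityˡ _)
    ι-⊖ (suc m) (suc n) = trans (reflexive (≡.cong ι (ℤₚ.[1+m]⊖[1+n]≡m⊖n m n)))
      (trans (ι-⊖ m n) (cancel-1 _ _))

    ι-neg◃ : ∀ n → ι (Sign.- ℤ.◃ n) ≈ - (n · 1#)
    ι-neg◃ zero    = sym -0#≈0#
    ι-neg◃ (suc n) = refl

  ι-+ : ∀ i j → ι (i ℤ.+ j) ≈ ι i + ι j
  ι-+ (+ m)    (+ n)    = ·-homo-+ 1# m n
  ι-+ (+ m)    -[1+ n ] = ι-⊖ m (suc n)
  ι-+ -[1+ m ] (+ n)    = trans (ι-⊖ n (suc m)) (+-comm _ _)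
  ι-+ -[1+ m ] -[1+ n ] = trans (-‿cong (trans
    (reflexive (≡.cong (λ k → suc k · 1#) (≡.sym (ℕₚ.+-suc m n))))
    (·-homo-+ 1# (suc m) (suc n)))) (sym (-‿+-comm _ _))

  ι-* : ∀ i j → ι (i ℤ.* j) ≈ ι i * ι j
  ι-* (+ m) (+ n) = trans (reflexive (≡.cong ι (ℤₚ.+◃n≡+n (m ℕ.* n)))) (·1-homo-* m n)
  ι-* (+ m) -[1+ n ] = trans (ι-neg◃ (m ℕ.* suc n))
    (trans (-‿cong (·1-homo-* m (suc n))) (-‿distribʳ-* _ _))
  ι-* -[1+ m ] (+ n) = trans (ι-neg◃ (suc m ℕ.* n))
    (trans (-‿cong (·1-homo-* (suc m) n)) (-‿distribˡ-* _ _))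
  ι-* -[1+ m ] -[1+ n ] = trans (reflexive (≡.cong ι (ℤₚ.+◃n≡+n (suc m ℕ.* suc n))))
    (trans (·1-homo-* (suc m) (suc n)) (trans (sym (-‿involutive _))
    (trans (-‿cong (-‿distribʳ-* _ _)) (-‿distribˡ-* _ _))))

  ι-neg : ∀ i → ι (ℤ.- i) ≈ - ι i
  ι-neg (+ zero)  = sym -0#≈0#
  ι-neg (+ suc n) = refl
  ι-neg -[1+ n ]  = sym (-‿involutive _)

  ι-homomorphism : +-*-rawRing -Raw-AlmostCommutative⟶ fromCommutativeRing commutativeRing
  ι-homomorphism = record
    { ⟦_⟧ = ι ; +-homo = ι-+ ; *-homo = ι-* ; -‿homo = ι-neg
    ; 0-homo = refl ; 1-homo = +-identityʳ 1# }

  private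
    ι-≟ : ∀ i j → Maybe (ι i ≈ ι j)
    ι-≟ i j with i ℤₚ.≟ j
    ... | yes i≡j = just (reflexive (≡.cong ι i≡j))
    ... | no  _   = nothing

  module Solver = Algebra.Solver.Ring +-*-rawRing (fromCommutativeRing commutativeRing)
    ι-homomorphism ι-≟
  open Solver public using (solve; _:=_; _:+_; _:*_; _:-_; :-_; con; Polynomial)

  <⇒≤ : ∀ {x y} → x < y → x ≤ y
  <⇒≤ = proj₁

  <-≤-trans : ∀ {x y z} → x < y → y ≤ z → x < z
  <-≤-trans = S.<-≤-trans sym ≤-trans ≤-antisym ≤-respʳ

  ≤-<-trans : ∀ {x y z} → x ≤ y → y < z → x < z
  ≤-<-trans = S.≤-<-trans ≤-trans ≤-antisym ≤-respˡ

  <-trans : ∀ {x y z} → x < y → y < z → x < z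
  <-trans p q = <-≤-trans p (<⇒≤ q)

  <-respʳ : ∀ {x y z} → x ≈ y → z < x → z < y
  <-respʳ p q = <-≤-trans q (≤-reflexive p)

  <-respˡ : ∀ {x y z} → x ≈ y → x < z → y < z
  <-respˡ p q = ≤-<-trans (≤-reflexive (sym p)) q

  ≤⇒≯ : ∀ {x y} → x ≤ y → ¬ (y < x)
  ≤⇒≯ x≤y (y≤x , y≉x) = y≉x (≤-antisym y≤x x≤y)

  <-irrefl : ∀ {x} → ¬ (x < x)
  <-irrefl = ≤⇒≯ ≤-refl

  ≤-or-> : ∀ x y → x ≤ y ⊎ y < x
  ≤-or-> x y with em {x ≤ y}
  ... | yes x≤y = inj₁ x≤y
  ... | no  x≰y = inj₂ (S.≰⇒> sym ≤-reflexive ≤-total x≰y)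

  ≮⇒≥ : ∀ {x y} → ¬ (x < y) → y ≤ x
  ≮⇒≥ {x} {y} x≮y with ≤-or-> y x
  ... | inj₁ y≤x = y≤x
  ... | inj₂ x<y = ⊥-elim (x≮y x<y)

  -- Inequalities are proved by writing the difference of the two sides as a
  -- visibly nonnegative (or positive) expression.

  ≤⇒0≤ : ∀ {x y} → x ≤ y → 0# ≤ y - x
  ≤⇒0≤ {x} {y} x≤y = ≤-respˡ (solve 1 (λ x → :- x :+ x := con (+ 0)) refl x)
    (≤-respʳ (+-comm (- x) y) (+-monoʳ-≤ (- x) x≤y))

  0≤⇒≤ : ∀ {x y} → 0# ≤ y - x → x ≤ y
  0≤⇒≤ {x} {y} p = ≤-respˡ (+-identityʳ x)
    (≤-respʳ (solve 2 (λ x y → x :+ (y :- x) := y) refl x y) (+-monoʳ-≤ x p))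

  <⇒0< : ∀ {x y} → x < y → 0# < y - x
  <⇒0< {x} {y} (x≤y , x≉y) = ≤⇒0≤ x≤y , λ 0≈y-x → x≉y (begin
    x              ≈⟨ +-identityʳ x ⟨
    x + 0#         ≈⟨ +-congˡ 0≈y-x ⟩
    x + (y - x)    ≈⟨ solve 2 (λ x y → x :+ (y :- x) := y) refl x y ⟩
    y              ∎)
    where open ≈-Reasoning

  0<⇒< : ∀ {x y} → 0# < y - x → x < y
  0<⇒< {x} {y} (0≤y-x , 0≉y-x) = 0≤⇒≤ 0≤y-x , λ x≈y →
    0≉y-x (trans (sym (-‿inverseʳ y)) (+-congˡ (-‿cong (sym x≈y))))

  infixl 6 _+≤_ _+<_ _+≤<_
  infixl 7 _*≤_ _*<_

  _+≤_ : ∀ {x y} → 0# ≤ x → 0# ≤ y → 0# ≤ x + y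
  _+≤_ {x} p q = ≤-trans p (≤-respˡ (+-identityʳ x) (+-monoʳ-≤ x q))

  _+<_ : ∀ {x y} → 0# < x → 0# ≤ y → 0# < x + y
  _+<_ {x} p q = <-≤-trans p (≤-respˡ (+-identityʳ x) (+-monoʳ-≤ x q))

  _+≤<_ : ∀ {x y} → 0# ≤ x → 0# < y → 0# < x + y
  p +≤< q = <-respʳ (+-comm _ _) (q +< p)

  _*≤_ : ∀ {x y} → 0# ≤ x → 0# ≤ y → 0# ≤ x * y
  _*≤_ = *-nonNeg

  no-zero-divisor : ∀ {x y} → ¬ (x ≈ 0#) → x * y ≈ 0# → y ≈ 0#
  no-zero-divisor {x} {y} x≉0 xy≈0 with *-inverse x x≉0
  ... | x⁻¹ , xx⁻¹≈1 = begin
    y                ≈⟨ *-identityʳ y ⟨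
    y * 1#           ≈⟨ *-congˡ xx⁻¹≈1 ⟨
    y * (x * x⁻¹)    ≈⟨ solve 3 (λ x y z → y :* (x :* z) := x :* y :* z) refl x y x⁻¹ ⟩
    x * y * x⁻¹      ≈⟨ *-congʳ xy≈0 ⟩
    0# * x⁻¹         ≈⟨ zeroˡ x⁻¹ ⟩
    0#               ∎
    where open ≈-Reasoning

  _*<_ : ∀ {x y} → 0# < x → 0# < y → 0# < x * y
  (0≤x , 0≉x) *< (0≤y , 0≉y) = 0≤x *≤ 0≤y , λ 0≈xy →
    0≉y (sym (no-zero-divisor (λ x≈0 → 0≉x (sym x≈0)) (sym 0≈xy)))

  0≤-neg : ∀ {x} → x ≤ 0# → 0# ≤ - x
  0≤-neg p = ≤-respʳ (+-identityˡ _) (≤⇒0≤ p)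

  *-cancel-0≤ : ∀ {x y} → 0# < x → 0# ≤ x * y → 0# ≤ y
  *-cancel-0≤ {x} {y} 0<x 0≤xy with ≤-or-> 0# y
  ... | inj₁ 0≤y = 0≤y
  ... | inj₂ y<0 = ⊥-elim (≤⇒≯ 0≤xy (0<⇒< (<-respʳ
    (solve 2 (λ x y → x :* (con (+ 0) :- y) := con (+ 0) :- x :* y) refl x y)
    (0<x *< <⇒0< y<0))))

  *-cancel-0< : ∀ {x y} → 0# < x → 0# < x * y → 0# < y
  *-cancel-0< {x} {y} 0<x (0≤xy , 0≉xy) =
    *-cancel-0≤ 0<x 0≤xy , λ 0≈y → 0≉xy (sym (trans (*-congˡ (sym 0≈y)) (zeroʳ x)))

  0≤x² : ∀ x → 0# ≤ x * x
  0≤x² x with ≤-total 0# x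
  ... | inj₁ 0≤x = 0≤x *≤ 0≤x
  ... | inj₂ x≤0 = ≤-respʳ (solve 1 (λ x → (:- x) :* (:- x) := x :* x) refl x)
    (0≤-neg x≤0 *≤ 0≤-neg x≤0)

  x²≤0⇒x≈0 : ∀ {x} → x * x ≤ 0# → x ≈ 0#
  x²≤0⇒x≈0 {x} p with em {x ≈ 0#}
  ... | yes x≈0 = x≈0
  ... | no  x≉0 = no-zero-divisor x≉0 (≤-antisym p (0≤x² x))

  0<1 : 0# < 1#
  0<1 = ≤-respʳ (*-identityˡ 1#) (0≤x² 1#) , 0≉1

  ²-mono-≤ : ∀ {x y} → 0# ≤ x → x ≤ y → x * x ≤ y * y
  ²-mono-≤ {x} {y} 0≤x x≤y = 0≤⇒≤ (≤-respʳ
    (solve 2 (λ x y → (y :- x) :* (y :+ x) := y :* y :- x :* x) refl x y)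
    (≤⇒0≤ x≤y *≤ (≤-trans 0≤x x≤y +≤ 0≤x)))

  ²-mono-< : ∀ {x y} → 0# ≤ x → x < y → x * x < y * y
  ²-mono-< {x} {y} 0≤x x<y = 0<⇒< (<-respʳ
    (solve 2 (λ x y → (y :- x) :* (y :+ x) := y :* y :- x :* x) refl x y)
    (<⇒0< x<y *< (≤-<-trans 0≤x x<y +< 0≤x)))

  ²-cancel-≤ : ∀ {x y} → 0# ≤ y → x * x ≤ y * y → x ≤ y
  ²-cancel-≤ 0≤y x²≤y² = ≮⇒≥ λ y<x → ≤⇒≯ x²≤y² (²-mono-< 0≤y y<x)

  ²-cancel-< : ∀ {x y} → 0# ≤ x → 0# ≤ y → x * x < y * y → x < y
  ²-cancel-< {x} {y} 0≤x 0≤y x²<y² with ≤-or-> y x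
  ... | inj₂ x<y = x<y
  ... | inj₁ y≤x = ⊥-elim (≤⇒≯ (²-mono-≤ 0≤y y≤x) x²<y²)

  ²-injective : ∀ {x y} → 0# ≤ x → 0# ≤ y → x * x ≈ y * y → x ≈ y
  ²-injective 0≤x 0≤y x²≈y² = ≤-antisym (²-cancel-≤ 0≤y (≤-reflexive x²≈y²))
    (²-cancel-≤ 0≤x (≤-reflexive (sym x²≈y²)))

  0≤n·1 : ∀ n → 0# ≤ n · 1#
  0≤n·1 zero    = ≤-refl
  0≤n·1 (suc n) = <⇒≤ 0<1 +≤ 0≤n·1 n

  ·1-mono-≤ : ∀ {m n} → m ℕ.≤ n → m · 1# ≤ n · 1#
  ·1-mono-≤ {n = n} ℕ.z≤n = 0≤n·1 n
  ·1-mono-≤ (ℕ.s≤s m≤n)   = +-monoʳ-≤ 1# (·1-mono-≤ m≤n)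

  ·1-mono-< : ∀ {m n} → m ℕ.< n → m · 1# < n · 1#
  ·1-mono-< {m} m<n = <-≤-trans
    (0<⇒< (<-respʳ (solve 2 (λ o x → o := (o :+ x) :- x) refl 1# (m · 1#)) 0<1))
    (·1-mono-≤ m<n)

  ·1-nonZero : ∀ n → 1# ≤ suc n · 1#
  ·1-nonZero n = ≤-respˡ (+-identityʳ 1#) (+-monoʳ-≤ 1# (0≤n·1 n))

  ι-square : ∀ i → ι i * ι i ≈ (ℤ.∣ i ∣ ℕ.* ℤ.∣ i ∣) · 1#
  ι-square (+ n)    = sym (·1-homo-* n n)
  ι-square -[1+ n ] = trans (solve 1 (λ x → :- x :* :- x := x :* x) refl (suc n · 1#))
    (sym (·1-homo-* (suc n) (suc n)))

  -- Discreteness of the integers, stated for squares so that no absolute value on the field is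
  -- needed.
  ι²<1⇒≡0 : ∀ i → ι i * ι i < 1# → i ≡ + 0
  ι²<1⇒≡0 (+ zero)  _ = ≡.refl
  ι²<1⇒≡0 (+ suc n) p = ⊥-elim (≤⇒≯ (≤-respʳ (sym (ι-square (+ suc n))) (·1-nonZero (n ℕ.+ n ℕ.* suc n))) p)
  ι²<1⇒≡0 -[1+ n ]  p = ⊥-elim (≤⇒≯ (≤-respʳ (sym (ι-square -[1+ n ])) (·1-nonZero (n ℕ.+ n ℕ.* suc n))) p)

  ι-injective : ∀ {i j} → ι i ≈ ι j → i ≡ j
  ι-injective {i} {j} p = ℤₚ.i-j≡0⇒i≡j i j (ι²<1⇒≡0 (i ℤ.- j) (<-respˡ (sym (trans (*-congʳ eq) (zeroˡ _))) 0<1))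
    where
    eq : ι (i ℤ.- j) ≈ 0#
    eq = trans (ι-+ i (ℤ.- j)) (trans (+-cong p (ι-neg j)) (-‿inverseʳ (ι j)))

  inverse-pos : ∀ {x} → 0# < x → ∃[ y ] 0# < y × x * y ≈ 1#
  inverse-pos {x} 0<x with *-inverse x (λ x≈0 → proj₂ 0<x (sym x≈0))
  ... | y , xy≈1 = y , *-cancel-0< 0<x (<-respʳ (sym xy≈1) 0<1) , xy≈1

  -- Square roots from completeness

  private
    -- The root is the infimum of the nonnegative numbers whose square is at least `a`. If its
    -- square missed `a` on either side, an explicit shift would give a larger lower bound or a
    -- smaller member.
    sqrt : ∀ a → 0# ≤ a → ∃[ s ] 0# ≤ s × s * s ≈ a
    sqrt a 0≤a = s , 0≤s , s²≈a
      where
      P : Carrier → Set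
      P x = 0# ≤ x × a ≤ x * x
      1+a∈P : P (1# + a)
      1+a∈P = (<⇒≤ 0<1 +≤ 0≤a) , 0≤⇒≤ (≤-respʳ
        (solve 2 (λ o a → o :* o :+ ((o :+ o) :* a :- a) :+ a :* a := (o :+ a) :* (o :+ a) :- a) refl 1# a)
        ((0≤x² 1# +≤ ≤-respʳ (trans (solve 2 (λ o a → o :* a := (o :+ o) :* a :- o :* a) refl 1# a)
            (+-congˡ (-‿cong (*-identityˡ a)))) (<⇒≤ 0<1 *≤ 0≤a)) +≤ 0≤x² a))
      infimum = complete P (_ , 1+a∈P) (0# , λ _ → proj₁)
      s = proj₁ infimum
      lower = proj₁ (proj₂ infimum)
      greatest = proj₂ (proj₂ infimum)
      0≤s : 0# ≤ s
      0≤s = greatest 0# (λ _ → proj₁)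
      s²≮a : ¬ (s * s < a)
      s²≮a s²<a = ≤⇒≯ (greatest (s + ε) below) (0<⇒< (<-respʳ
        (solve 2 (λ s e → e := (s :+ e) :- s) refl s ε) 0<ε))
        where
        D = a - s * s
        0<D = <⇒0< s²<a
        -- The shift is ε = D / (1 + 2s + D). The summand D ensures ε ≤ 1, whence (s + ε)² ≤ s² +
        -- (2s + 1) ε ≤ a.
        Q = 1# + (s + s) + D
        0<Q : 0# < Q
        0<Q = 0<1 +< (0≤s +≤ 0≤s) +< <⇒≤ 0<D
        i = proj₁ (inverse-pos 0<Q)
        0<i = proj₁ (proj₂ (inverse-pos 0<Q))
        Qi≈1 = proj₂ (proj₂ (inverse-pos 0<Q))
        ε = D * i
        0<ε = 0<D *< 0<i
        εQ≈D : Q * ε ≈ D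
        εQ≈D = trans (solve 3 (λ Q D i → Q :* (D :* i) := D :* (Q :* i)) refl Q D i)
          (trans (*-congˡ Qi≈1) (*-identityʳ D))
        ε≤1 : 0# ≤ 1# - ε
        ε≤1 = *-cancel-0≤ 0<Q (≤-respʳ
          (trans (solve 3 (λ o s D → o :+ (s :+ s) := (o :+ (s :+ s) :+ D) :- D) refl 1# s D)
            (trans (+-cong (sym (*-identityʳ Q)) (-‿cong (sym εQ≈D)))
              (solve 3 (λ Q o e → Q :* o :- Q :* e := Q :* (o :- e)) refl Q 1# ε)))
          (<⇒≤ 0<1 +≤ (0≤s +≤ 0≤s)))
        below : IsLowerBound P (s + ε)
        below x (0≤x , a≤x²) = ²-cancel-≤ 0≤x (≤-trans (0≤⇒≤ (≤-respʳ
          (trans (solve 4 (λ o s D e → e :* D :+ e :* (o :- e) := (o :+ (s :+ s) :+ D) :* e :- (s :+ s :+ e) :* e)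
              refl 1# s D ε)
            (trans (+-congʳ εQ≈D) (solve 3 (λ s e a → a :- s :* s :- (s :+ s :+ e) :* e := a :- (s :+ e) :* (s :+ e)) refl s ε a)))
          ((<⇒≤ 0<ε *≤ <⇒≤ 0<D) +≤ (<⇒≤ 0<ε *≤ ε≤1)))) a≤x²)
      a≮s² : ¬ (a < s * s)
      a≮s² a<s² = ≤⇒≯ (lower (s - ε) (0≤s-ε , 0≤⇒≤ (≤-respʳ
          (trans (sym (+-identityʳ _)) (trans (+-congˡ (sym (trans (+-congˡ (-‿cong 2sε≈D)) (-‿inverseʳ D))))
            (solve 3 (λ s e a → e :* e :+ ((s :* s :- a) :- (s :+ s) :* e) := (s :- e) :* (s :- e) :- a) refl s ε a)))
          (0≤x² ε))))
        (0<⇒< (<-respʳ (solve 2 (λ s e → e := s :- (s :- e)) refl s ε) 0<ε))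
        where
        0<s : 0# < s
        0<s = 0≤s , λ 0≈s → ≤⇒≯ 0≤a (<-respʳ (trans (*-congʳ (sym 0≈s)) (zeroˡ s)) a<s²)
        D = s * s - a
        0<D = <⇒0< a<s²
        0<2s : 0# < s + s
        0<2s = 0<s +< 0≤s
        i = proj₁ (inverse-pos 0<2s)
        0<i = proj₁ (proj₂ (inverse-pos 0<2s))
        -- A Newton step, ε = (s² - a) / 2s, for which (s - ε)² = a + ε² ≥ a.
        ε = D * i
        0<ε = 0<D *< 0<i
        2sε≈D : (s + s) * ε ≈ D
        2sε≈D = trans (solve 3 (λ Q D i → Q :* (D :* i) := D :* (Q :* i)) refl (s + s) D i)
          (trans (*-congˡ (proj₂ (proj₂ (inverse-pos 0<2s)))) (*-identityʳ D))
        0≤s-ε : 0# ≤ s - ε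
        0≤s-ε = *-cancel-0≤ 0<2s (≤-respʳ
          (trans (solve 2 (λ s a → s :* s :+ a := (s :+ s) :* s :- (s :* s :- a)) refl s a)
            (trans (+-congˡ (-‿cong (sym 2sε≈D)))
              (solve 2 (λ s e → (s :+ s) :* s :- (s :+ s) :* e := (s :+ s) :* (s :- e)) refl s ε)))
          (0≤x² s +≤ 0≤a))
      s²≈a : s * s ≈ a
      s²≈a = ≤-antisym (≮⇒≥ a≮s²) (≮⇒≥ s²≮a)

  abstract
    √ : ∀ a → 0# ≤ a → Carrier
    √ a 0≤a = proj₁ (sqrt a 0≤a)

    0≤√ : ∀ {a} (0≤a : 0# ≤ a) → 0# ≤ √ a 0≤a
    0≤√ 0≤a = proj₁ (proj₂ (sqrt _ 0≤a))

    √-square : ∀ {a} (0≤a : 0# ≤ a) → √ a 0≤a * √ a 0≤a ≈ a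
    √-square 0≤a = proj₂ (proj₂ (sqrt _ 0≤a))

  √-mono-≤ : ∀ {a b} (0≤a : 0# ≤ a) (0≤b : 0# ≤ b) → a ≤ b → √ a 0≤a ≤ √ b 0≤b
  √-mono-≤ 0≤a 0≤b a≤b = ²-cancel-≤ (0≤√ 0≤b)
    (≤-respˡ (sym (√-square 0≤a)) (≤-respʳ (sym (√-square 0≤b)) a≤b))

  √-mono-< : ∀ {a b} (0≤a : 0# ≤ a) (0≤b : 0# ≤ b) → a < b → √ a 0≤a < √ b 0≤b
  √-mono-< 0≤a 0≤b a<b = ²-cancel-< (0≤√ 0≤a) (0≤√ 0≤b)
    (<-respˡ (sym (√-square 0≤a)) (<-respʳ (sym (√-square 0≤b)) a<b))

  ⊔-lub-< : ∀ {x y z} → x < z → y < z → x ⊔ y < z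
  ⊔-lub-< {x} {y} x<z y<z with ⊔-sel x y
  ... | inj₁ p = <-respˡ (sym p) x<z
  ... | inj₂ p = <-respˡ (sym p) y<z

  ≤-⊔-< : ∀ {x y z} → z ≤ x ⊔ y → y < z → z ≤ x
  ≤-⊔-< {x} {y} z≤ y<z with ⊔-sel x y
  ... | inj₁ p = ≤-respʳ p z≤
  ... | inj₂ p = ⊥-elim (≤⇒≯ (≤-respʳ p z≤) y<z)

-- Plane geometry

module Plane (em : ExcludedMiddle 0ℓ) (ℝ : CompleteOrderedField) where

  open OrderedField em ℝ

  ℝ² : Set
  ℝ² = Carrier × Carrier

  infixl 6 _⊕_ _⊖_
  infix 8 _∙_ _⨯_

  _⊕_ _⊖_ : ℝ² → ℝ² → ℝ²
  (a₁ , a₂) ⊕ (b₁ , b₂) = (a₁ + b₁) , (a₂ + b₂)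
  (a₁ , a₂) ⊖ (b₁ , b₂) = (a₁ - b₁) , (a₂ - b₂)

  -- `_⨯_` is the determinant of two plane vectors; `0# < a ⨯ b` means that b lies counterclockwise
  -- of a by less than a half turn.
  _∙_ _⨯_ : ℝ² → ℝ² → Carrier
  (a₁ , a₂) ∙ (b₁ , b₂) = a₁ * b₁ + a₂ * b₂
  (a₁ , a₂) ⨯ (b₁ , b₂) = a₁ * b₂ - a₂ * b₁

  N : ℝ² → Carrier
  N a = a ∙ a

  private
    Poly² : ℕ → Set
    Poly² n = Polynomial n × Polynomial n

    infixl 6 _⊕ₚ_ _⊖ₚ_
    infix 9 _∙ₚ_ _⨯ₚ_

    _⊕ₚ_ _⊖ₚ_ : ∀ {n} → Poly² n → Poly² n → Poly² n
    (a₁ , a₂) ⊕ₚ (b₁ , b₂) = (a₁ :+ b₁) , (a₂ :+ b₂)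
    (a₁ , a₂) ⊖ₚ (b₁ , b₂) = (a₁ :- b₁) , (a₂ :- b₂)

    _∙ₚ_ _⨯ₚ_ : ∀ {n} → Poly² n → Poly² n → Polynomial n
    (a₁ , a₂) ∙ₚ (b₁ , b₂) = a₁ :* b₁ :+ a₂ :* b₂
    (a₁ , a₂) ⨯ₚ (b₁ , b₂) = a₁ :* b₂ :- a₂ :* b₁

    Nₚ : ∀ {n} → Poly² n → Polynomial n
    Nₚ a = a ∙ₚ a

  ⨯-anti : ∀ a b → b ⨯ a ≈ - (a ⨯ b)
  ⨯-anti (a₁ , a₂) (b₁ , b₂) = solve 4 (λ a₁ a₂ b₁ b₂ →
    let a = a₁ , a₂ ; b = b₁ , b₂ in b ⨯ₚ a := :- (a ⨯ₚ b)) refl a₁ a₂ b₁ b₂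

  ⨯-≤0 : ∀ {a b} → a ⨯ b ≤ 0# → 0# ≤ b ⨯ a
  ⨯-≤0 {a} {b} p = ≤-respʳ (sym (⨯-anti a b)) (0≤-neg p)

  ⨯-<0 : ∀ {a b} → a ⨯ b < 0# → 0# < b ⨯ a
  ⨯-<0 {a} {b} p = <-respʳ (trans (+-identityˡ _) (sym (⨯-anti a b))) (<⇒0< p)

  ⨯-0≤ : ∀ {a b} → 0# ≤ b ⨯ a → a ⨯ b ≤ 0#
  ⨯-0≤ {a} {b} p = 0≤⇒≤ (≤-respʳ (trans (⨯-anti a b) (sym (+-identityˡ _))) p)

  0≤N : ∀ a → 0# ≤ N a
  0≤N (a₁ , a₂) = 0≤x² a₁ +≤ 0≤x² a₂

  N-⊖ : ∀ a b → N (a ⊖ b) ≈ N a + N b - (a ∙ b + a ∙ b)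
  N-⊖ (a₁ , a₂) (b₁ , b₂) = solve 4 (λ a₁ a₂ b₁ b₂ →
    let a = a₁ , a₂ ; b = b₁ , b₂ in
    Nₚ (a ⊖ₚ b) := Nₚ a :+ Nₚ b :- (a ∙ₚ b :+ a ∙ₚ b)) refl a₁ a₂ b₁ b₂

  N-⊖-comm : ∀ a b → N (a ⊖ b) ≈ N (b ⊖ a)
  N-⊖-comm (a₁ , a₂) (b₁ , b₂) = solve 4 (λ a₁ a₂ b₁ b₂ →
    let a = a₁ , a₂ ; b = b₁ , b₂ in
    Nₚ (a ⊖ₚ b) := Nₚ (b ⊖ₚ a)) refl a₁ a₂ b₁ b₂

  lagrange : ∀ a b → N a * N b ≈ (a ∙ b) * (a ∙ b) + (a ⨯ b) * (a ⨯ b)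
  lagrange (a₁ , a₂) (b₁ , b₂) = solve 4 (λ a₁ a₂ b₁ b₂ →
    let a = a₁ , a₂ ; b = b₁ , b₂ in
    Nₚ a :* Nₚ b := (a ∙ₚ b) :* (a ∙ₚ b) :+ (a ⨯ₚ b) :* (a ⨯ₚ b)) refl a₁ a₂ b₁ b₂

  -- This relation takes the place of additivity of angles: from the signs of some determinants it
  -- yields the sign of another.
  plücker : ∀ a b c d → (a ⨯ c) * (b ⨯ d) ≈ (a ⨯ b) * (c ⨯ d) + (a ⨯ d) * (b ⨯ c)
  plücker (a₁ , a₂) (b₁ , b₂) (c₁ , c₂) (d₁ , d₂) =
    solve 8 (λ a₁ a₂ b₁ b₂ c₁ c₂ d₁ d₂ →
    let a = a₁ , a₂ ; b = b₁ , b₂ ; c = c₁ , c₂ ; d = d₁ , d₂ in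
    (a ⨯ₚ c) :* (b ⨯ₚ d) := (a ⨯ₚ b) :* (c ⨯ₚ d) :+ (a ⨯ₚ d) :* (b ⨯ₚ c))
    refl a₁ a₂ b₁ b₂ c₁ c₂ d₁ d₂

  N-⨯ : ∀ a b c → N a * (b ⨯ c) ≈ (a ∙ b) * (a ⨯ c) - (a ⨯ b) * (a ∙ c)
  N-⨯ (a₁ , a₂) (b₁ , b₂) (c₁ , c₂) = solve 6 (λ a₁ a₂ b₁ b₂ c₁ c₂ →
    let a = a₁ , a₂ ; b = b₁ , b₂ ; c = c₁ , c₂ in
    Nₚ a :* (b ⨯ₚ c) := (a ∙ₚ b) :* (a ⨯ₚ c) :- (a ⨯ₚ b) :* (a ∙ₚ c))
    refl a₁ a₂ b₁ b₂ c₁ c₂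

  N-∙ : ∀ a b c → N a * (b ∙ c) ≈ (a ∙ b) * (a ∙ c) + (a ⨯ b) * (a ⨯ c)
  N-∙ (a₁ , a₂) (b₁ , b₂) (c₁ , c₂) = solve 6 (λ a₁ a₂ b₁ b₂ c₁ c₂ →
    let a = a₁ , a₂ ; b = b₁ , b₂ ; c = c₁ , c₂ in
    Nₚ a :* (b ∙ₚ c) := (a ∙ₚ b) :* (a ∙ₚ c) :+ (a ⨯ₚ b) :* (a ⨯ₚ c))
    refl a₁ a₂ b₁ b₂ c₁ c₂

  -- Reflection in the diagonal keeps lengths and reverses orientation, so every oriented statement
  -- also yields its mirror image.
  swap : ℝ² → ℝ²
  swap (a₁ , a₂) = a₂ , a₁

  N-swap : ∀ a → N a ≈ N (swap a)
  N-swap a = +-comm _ _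

  ⨯-swap : ∀ a b → a ⨯ b ≈ swap b ⨯ swap a
  ⨯-swap (a₁ , a₂) (b₁ , b₂) = +-cong (*-comm _ _) (-‿cong (*-comm _ _))

  -- `T` is a squared radius. Its positivity is not assumed; it follows as soon as some vector is
  -- short.
  module Radius (T : Carrier) where

    Short : ℝ² → Set
    Short a = N a < T

    Far : ℝ² → ℝ² → Set
    Far a b = T ≤ N (a ⊖ b)

    far-sym : ∀ {a b} → Far a b → Far b a
    far-sym {a} {b} = ≤-respʳ (N-⊖-comm a b)

    short-swap : ∀ {a} → Short a → Short (swap a)
    short-swap {a} = <-respˡ (N-swap a)

    far-swap : ∀ {a b} → Far a b → Far (swap a) (swap b)
    far-swap {a} {b} = ≤-respʳ (N-swap (a ⊖ b))

    short⇒0<T : ∀ {a} → Short a → 0# < T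
    short⇒0<T {a} = ≤-<-trans (0≤N a)

    -- In |a|² + |b|² - 2 a·b ≥ T the term |b|² < T cannot account for all of T.
    far⇒2∙<N : ∀ {a b} → Short b → Far a b → 0# < N a - (a ∙ b + a ∙ b)
    far⇒2∙<N {a} {b} sb ab = <-respʳ (trans (+-congˡ (+-congʳ (N-⊖ a b)))
      (solve 4 (λ T A B D → T :- B :+ (A :+ B :- D :- T) := A :- D) refl
        T (N a) (N b) (a ∙ b + a ∙ b)))
      (<⇒0< sb +< ≤⇒0≤ ab)

    far⇒2∙<N′ : ∀ {a b} → Short a → Far a b → 0# < N b - (a ∙ b + a ∙ b)
    far⇒2∙<N′ {a} {b} sa ab = <-respʳ (+-congˡ (-‿cong (+-cong (∙-comm b a) (∙-comm b a))))
      (far⇒2∙<N sa (far-sym {a} {b} ab))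
      where
      ∙-comm : ∀ a b → a ∙ b ≈ b ∙ a
      ∙-comm a b = +-cong (*-comm _ _) (*-comm _ _)

    -- If b were 0, the distance from a to b would be the length of a, which is too small.
    0<N : ∀ {a b} → Short a → Far a b → 0# < N b
    0<N {a} {b} sa ab with ≤-or-> (N b) 0#
    ... | inj₂ p = p
    ... | inj₁ Nb≤0 = <-respʳ (trans (+-congˡ (-‿cong (trans (+-cong a∙b≈0 a∙b≈0) (+-identityˡ 0#))))
                        (trans (+-congˡ -0#≈0#) (+-identityʳ _))) (far⇒2∙<N′ sa ab)
      where
      a∙b≈0 : a ∙ b ≈ 0#
      a∙b≈0 = x²≤0⇒x≈0 (0≤⇒≤ (≤-respʳ
        (trans (+-congˡ (*-congˡ (+-identityˡ _)))
        (trans (+-congˡ (sym (-‿distribʳ-* _ _)))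
        (trans (+-congˡ (-‿cong (lagrange a b)))
        (solve 2 (λ d c → c :* c :+ :- (d :* d :+ c :* c) := con (+ 0) :- d :* d) refl
          (a ∙ b) (a ⨯ b)))))
        (0≤x² (a ⨯ b) +≤ (0≤N a *≤ ≤⇒0≤ Nb≤0))))

    -- If a·b ≥ 0, then |a|² and |b|² both exceed 2 a·b, so |a|²|b|² > 4 (a·b)²; but for parallel
    -- vectors |a|²|b|² = (a·b)².
    parallel⇒opposite : ∀ {a b} → Short a → Short b → Far a b → a ⨯ b ≈ 0# → a ∙ b < 0#
    parallel⇒opposite {a} {b} sa sb ab a⨯b≈0 with ≤-or-> 0# (a ∙ b)
    ... | inj₂ p = p
    ... | inj₁ 0≤d = ⊥-elim (≤⇒≯ (0≤N a *≤ 0≤N b) (0<⇒< (<-respʳ eq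
      (far⇒2∙<N sb ab *< 0<N sa ab
        +< ((0≤d +≤ 0≤d) *≤ <⇒≤ (far⇒2∙<N′ sa ab))
        +< ((0≤N a *≤ 0≤N b) +≤ (0≤N a *≤ 0≤N b))))))
      where
      open ≈-Reasoning
      d = a ∙ b
      eq : (N a - (d + d)) * N b + (d + d) * (N b - (d + d)) + (N a * N b + N a * N b)
           ≈ 0# - N a * N b
      eq = begin
        _ ≈⟨ solve 3 (λ A B d → (A :- (d :+ d)) :* B :+ (d :+ d) :* (B :- (d :+ d))
                       :+ (A :* B :+ A :* B)
                   := con (+ 4) :* (A :* B :- d :* d) :- A :* B) refl (N a) (N b) d ⟩
        _ ≈⟨ +-congʳ (*-congˡ (+-congʳ (lagrange a b))) ⟩
        _ ≈⟨ solve 3 (λ c d P → con (+ 4) :* (d :* d :+ c :* c :- d :* d) :- P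
                   := con (+ 4) :* c :* c :- P) refl (a ⨯ b) d (N a * N b) ⟩
        _ ≈⟨ +-congʳ (trans (*-congˡ a⨯b≈0) (zeroʳ _)) ⟩
        0# - N a * N b ∎

    -- If b = x a + y c with x ≤ 1, then |b|² > 2 a·b and |b|² > 2 b·c force
    -- x + y > 2, and c - b is a combination of -a and -b of total weight at
    -- most 1, hence short.
    between : ∀ {a b c} → Short a → Short b → Short c → Far a b → Far b c →
              0# ≤ a ⨯ b → 0# ≤ b ⨯ c → 0# < a ⨯ c → a ⨯ c < b ⨯ c
    between {a} {b} {c} sa sb sc ab bc 0≤Y 0≤X 0<Z with ≤-or-> (b ⨯ c) (a ⨯ c)
    ... | inj₂ p = p
    ... | inj₁ X≤Z = ⊥-elim (<-irrefl (<-respʳ eq₀ positive))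
      where
      X = b ⨯ c
      Y = a ⨯ b
      Z = a ⨯ c
      p = N b - (a ∙ b + a ∙ b)
      r = N b - (b ∙ c + b ∙ c)
      0<p = far⇒2∙<N′ sa ab
      0<r = far⇒2∙<N sc bc
      0<Nb = 0<N sa ab
      eq₁ : X * p + Y * r ≈ N b * (X + Y - (Z + Z))
      eq₁ = solve 6 (λ a₁ a₂ b₁ b₂ c₁ c₂ →
        let a = a₁ , a₂ ; b = b₁ , b₂ ; c = c₁ , c₂
            X = b ⨯ₚ c ; Y = a ⨯ₚ b ; Z = a ⨯ₚ c in
        X :* (Nₚ b :- (a ∙ₚ b :+ a ∙ₚ b)) :+ Y :* (Nₚ b :- (b ∙ₚ c :+ b ∙ₚ c))
        := Nₚ b :* (X :+ Y :- (Z :+ Z))) refl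
        (proj₁ a) (proj₂ a) (proj₁ b) (proj₂ b) (proj₁ c) (proj₂ c)
      0≤W : 0# ≤ X + Y - (Z + Z)
      0≤W = *-cancel-0≤ 0<Nb (≤-respʳ eq₁ ((0≤X *≤ <⇒≤ 0<p) +≤ (0≤Y *≤ <⇒≤ 0<r)))
      0<Y : 0# < Y
      0<Y = <-respʳ (solve 3 (λ X Y Z → Z :+ (X :+ Y :- (Z :+ Z)) :+ (Z :- X) := Y) refl X Y Z)
        (0<Z +< 0≤W +< ≤⇒0≤ X≤Z)
      0<W : 0# < X + Y - (Z + Z)
      0<W = *-cancel-0< 0<Nb (<-respʳ eq₁ ((0≤X *≤ <⇒≤ 0<p) +≤< (0<Y *< 0<r)))
      α = Y - Z
      0<α : 0# < α
      0<α = <-respʳ (solve 3 (λ X Y Z → X :+ Y :- (Z :+ Z) :+ (Z :- X) := Y :- Z) refl X Y Z)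
        (0<W +< ≤⇒0≤ X≤Z)
      S = α + X
      0<S : 0# < S
      0<S = 0<α +< 0≤X
      -- Here c - b = -(α b + X a) / Y, and the mixed term of |α b + X a|² is traded for |a - b|²,
      -- as in the formula for a weighted variance.
      eq₂ : Y * Y * N (b ⊖ c) ≈ S * (α * N b + X * N a) - α * X * N (a ⊖ b)
      eq₂ = solve 6 (λ a₁ a₂ b₁ b₂ c₁ c₂ →
        let a = a₁ , a₂ ; b = b₁ , b₂ ; c = c₁ , c₂
            X = b ⨯ₚ c ; Y = a ⨯ₚ b ; Z = a ⨯ₚ c ; α = Y :- Z in
        Y :* Y :* Nₚ (b ⊖ₚ c) :=
        (α :+ X) :* (α :* Nₚ b :+ X :* Nₚ a) :- α :* X :* Nₚ (a ⊖ₚ b)) refl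
        (proj₁ a) (proj₂ a) (proj₁ b) (proj₂ b) (proj₁ c) (proj₂ c)
      positive : 0# < S * (α * (T - N b) + X * (T - N a)) + (Y - S) * (Y + S) * T
                    + α * X * N (a ⊖ b) + Y * Y * (N (b ⊖ c) - T)
      positive = 0<S *< (0<α *< <⇒0< sb +< (0≤X *≤ <⇒≤ (<⇒0< sa)))
        +< (0≤Y-S *≤ <⇒≤ (0<Y +< <⇒≤ 0<S) *≤ <⇒≤ (short⇒0<T {a} sa))
        +< (<⇒≤ 0<α *≤ 0≤X *≤ 0≤N (a ⊖ b))
        +< (<⇒≤ 0<Y *≤ <⇒≤ 0<Y *≤ ≤⇒0≤ bc)
        where
        0≤Y-S : 0# ≤ Y - S
        0≤Y-S = ≤-respʳ (solve 3 (λ X Y Z → Z :- X := Y :- (Y :- Z :+ X)) refl X Y Z) (≤⇒0≤ X≤Z)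
      eq₀ : S * (α * (T - N b) + X * (T - N a)) + (Y - S) * (Y + S) * T
              + α * X * N (a ⊖ b) + Y * Y * (N (b ⊖ c) - T) ≈ 0#
      eq₀ = trans
        (solve 8 (λ α X Y T A B D E → let S = α :+ X in
          S :* (α :* (T :- B) :+ X :* (T :- A)) :+ (Y :- S) :* (Y :+ S) :* T
            :+ α :* X :* D :+ Y :* Y :* (E :- T)
          := Y :* Y :* E :- (S :* (α :* B :+ X :* A) :- α :* X :* D)) refl
          α X Y T (N a) (N b) (N (a ⊖ b)) (N (b ⊖ c)))
        (trans (+-congʳ eq₂) (-‿inverseʳ _))

    between′ : ∀ {a b c} → Short a → Short b → Short c → Far a b → Far b c →
               0# ≤ a ⨯ b → 0# ≤ b ⨯ c → 0# < a ⨯ c → a ⨯ c < a ⨯ b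
    between′ {a} {b} {c} sa sb sc ab bc 0≤Y 0≤X 0<Z =
      <-respˡ (sym (⨯-swap a c)) (<-respʳ (sym (⨯-swap a b))
        (between (short-swap {c} sc) (short-swap {b} sb) (short-swap {a} sa)
          (far-swap {c} {b} (far-sym {b} {c} bc)) (far-swap {b} {a} (far-sym {a} {b} ab))
          (≤-respʳ (⨯-swap b c) 0≤X) (≤-respʳ (⨯-swap a b) 0≤Y) (<-respʳ (⨯-swap a c) 0<Z)))

    -- Write b = x a + y c, where x, y > 1 by `between` and `between′`. Then |a|² > 2 a·b gives y (2
    -- a·c) < -x |a|², and symmetrically for c. If x ≥ y, this yields 2 a·c < -|a|², so |a + c|² <
    -- |c|² < T; if y ≥ x, exchange a and c.
    sum-short : ∀ {a b c} → Short a → Short b → Short c → Far a b → Far b c →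
                0# < a ⨯ b → 0# < b ⨯ c → 0# < a ⨯ c → Short (a ⊕ c)
    sum-short {a} {b} {c} sa sb sc ab bc 0<Y 0<X 0<Z = 0<⇒< (<-respʳ (sym N-sum) bound)
      where
      X = b ⨯ c
      Y = a ⨯ b
      Z = a ⨯ c
      e = a ∙ c + a ∙ c
      N-sum : T - N (a ⊕ c) ≈ T - N a - N c - e
      N-sum = solve 5 (λ T a₁ a₂ c₁ c₂ →
        let a = a₁ , a₂ ; c = c₁ , c₂ in
        T :- Nₚ (a ⊕ₚ c) := T :- Nₚ a :- Nₚ c :- (a ∙ₚ c :+ a ∙ₚ c)) refl
        T (proj₁ a) (proj₂ a) (proj₁ c) (proj₂ c)
      eqa : Z * (N a - (a ∙ b + a ∙ b)) + (X - Z) * N a ≈ - (X * N a) - Y * e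
      eqa = solve 6 (λ a₁ a₂ b₁ b₂ c₁ c₂ →
        let a = a₁ , a₂ ; b = b₁ , b₂ ; c = c₁ , c₂
            X = b ⨯ₚ c ; Y = a ⨯ₚ b ; Z = a ⨯ₚ c in
        Z :* (Nₚ a :- (a ∙ₚ b :+ a ∙ₚ b)) :+ (X :- Z) :* Nₚ a
        := :- (X :* Nₚ a) :- Y :* (a ∙ₚ c :+ a ∙ₚ c)) refl
        (proj₁ a) (proj₂ a) (proj₁ b) (proj₂ b) (proj₁ c) (proj₂ c)
      eqc : Z * (N c - (b ∙ c + b ∙ c)) + (Y - Z) * N c ≈ - (Y * N c) - X * e
      eqc = solve 6 (λ a₁ a₂ b₁ b₂ c₁ c₂ →
        let a = a₁ , a₂ ; b = b₁ , b₂ ; c = c₁ , c₂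
            X = b ⨯ₚ c ; Y = a ⨯ₚ b ; Z = a ⨯ₚ c in
        Z :* (Nₚ c :- (b ∙ₚ c :+ b ∙ₚ c)) :+ (Y :- Z) :* Nₚ c
        := :- (Y :* Nₚ c) :- X :* (a ∙ₚ c :+ a ∙ₚ c)) refl
        (proj₁ a) (proj₂ a) (proj₁ b) (proj₂ b) (proj₁ c) (proj₂ c)
      0<X-Z = <⇒0< (between sa sb sc ab bc (<⇒≤ 0<Y) (<⇒≤ 0<X) 0<Z)
      0<Y-Z = <⇒0< (between′ sa sb sc ab bc (<⇒≤ 0<Y) (<⇒≤ 0<X) 0<Z)
      pa : 0# < - (X * N a) - Y * e
      pa = <-respʳ eqa (0<Z *< far⇒2∙<N sb ab +< (<⇒≤ 0<X-Z *≤ 0≤N a))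
      pc : 0# < - (Y * N c) - X * e
      pc = <-respʳ eqc (0<Z *< far⇒2∙<N′ sb bc +< (<⇒≤ 0<Y-Z *≤ 0≤N c))
      bound : 0# < T - N a - N c - e
      bound with ≤-total Y X
      ... | inj₁ Y≤X = *-cancel-0< 0<Y (<-respʳ
        (solve 6 (λ X Y T A C e → :- (X :* A) :- Y :* e :+ (X :- Y) :* A :+ Y :* (T :- C)
          := Y :* (T :- A :- C :- e)) refl X Y T (N a) (N c) e)
        (pa +< (≤⇒0≤ Y≤X *≤ 0≤N a) +< (<⇒≤ 0<Y *≤ <⇒≤ (<⇒0< sc))))
      ... | inj₂ X≤Y = *-cancel-0< 0<X (<-respʳ
        (solve 6 (λ X Y T A C e → :- (Y :* C) :- X :* e :+ (Y :- X) :* C :+ X :* (T :- A)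
          := X :* (T :- A :- C :- e)) refl X Y T (N a) (N c) e)
        (pc +< (≤⇒0≤ X≤Y *≤ 0≤N c) +< (<⇒≤ 0<X *≤ <⇒≤ (<⇒0< sa))))

    -- Write q = φ w₁ + ε w₂.  If φ + ε ≤ 1 then q lies in the triangle with
    -- vertices 0, w₁, w₂, all within the radius of h; otherwise q lies beyond
    -- the segment w₁w₂, but is itself short.
    cap : ∀ {w₁ w₂ h q} → T ≤ N w₁ → T ≤ N w₂ → Short (h ⊖ w₁) → Short (h ⊖ w₂) →
          Short h → Short q → 0# < w₁ ⨯ w₂ → 0# ≤ q ⨯ w₂ → 0# ≤ w₁ ⨯ q → Short (h ⊖ q)
    cap {w₁} {w₂} {h} {q} Tw₁ Tw₂ hw₁ hw₂ sh sq 0<D 0≤φ 0≤ε = 0<⇒< (*-cancel-0< 0<D bound)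
      where
      D = w₁ ⨯ w₂
      φ = q ⨯ w₂
      ε = w₁ ⨯ q
      σ = φ + ε
      0≤T = <⇒≤ (short⇒0<T {q} sq)
      0≤h₁ = <⇒≤ (<⇒0< hw₁)
      0≤h₂ = <⇒≤ (<⇒0< hw₂)
      -- As |h - q|² - |q|² is affine in q, it is the average of its values at w₁, w₂ and 0 with
      -- weights φ/D, ε/D and 1 - σ/D; the last weight may be negative.
      eq : φ * (T - N (h ⊖ w₁)) + ε * (T - N (h ⊖ w₂))
           + ((D - σ) * (T - N h) + (φ * N w₁ + ε * N w₂ - D * N q)) ≈ D * (T - N (h ⊖ q))
      eq = solve 9 (λ T a₁ a₂ b₁ b₂ h₁ h₂ q₁ q₂ →
        let w₁ = a₁ , a₂ ; w₂ = b₁ , b₂ ; h = h₁ , h₂ ; q = q₁ , q₂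
            D = w₁ ⨯ₚ w₂ ; φ = q ⨯ₚ w₂ ; ε = w₁ ⨯ₚ q in
        φ :* (T :- Nₚ (h ⊖ₚ w₁)) :+ ε :* (T :- Nₚ (h ⊖ₚ w₂))
        :+ ((D :- (φ :+ ε)) :* (T :- Nₚ h) :+ (φ :* Nₚ w₁ :+ ε :* Nₚ w₂ :- D :* Nₚ q))
        := D :* (T :- Nₚ (h ⊖ₚ q))) refl
        T (proj₁ w₁) (proj₂ w₁) (proj₁ w₂) (proj₂ w₂) (proj₁ h) (proj₂ h) (proj₁ q) (proj₂ q)
      jensen : φ * ε * N (w₁ ⊖ w₂) + (D - σ) * (φ * N w₁ + ε * N w₂)
               ≈ D * (φ * N w₁ + ε * N w₂ - D * N q)
      jensen = solve 6 (λ a₁ a₂ b₁ b₂ q₁ q₂ →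
        let w₁ = a₁ , a₂ ; w₂ = b₁ , b₂ ; q = q₁ , q₂
            D = w₁ ⨯ₚ w₂ ; φ = q ⨯ₚ w₂ ; ε = w₁ ⨯ₚ q in
        φ :* ε :* Nₚ (w₁ ⊖ₚ w₂) :+ (D :- (φ :+ ε)) :* (φ :* Nₚ w₁ :+ ε :* Nₚ w₂)
        := D :* (φ :* Nₚ w₁ :+ ε :* Nₚ w₂ :- D :* Nₚ q)) refl
        (proj₁ w₁) (proj₂ w₁) (proj₁ w₂) (proj₂ w₂) (proj₁ q) (proj₂ q)
      rest : 0# < (D - σ) * (T - N h) + (φ * N w₁ + ε * N w₂ - D * N q)
      rest with ≤-or-> D σ
      ... | inj₁ D≤σ = <-respʳ
        (solve 8 (λ D φ ε T H A B Q →
          D :* (T :- Q) :+ (φ :+ ε :- D) :* H :+ φ :* (A :- T) :+ ε :* (B :- T)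
          := (D :- (φ :+ ε)) :* (T :- H) :+ (φ :* A :+ ε :* B :- D :* Q)) refl
          D φ ε T (N h) (N w₁) (N w₂) (N q))
        (0<D *< <⇒0< sq +< (≤⇒0≤ D≤σ *≤ 0≤N h) +< (0≤φ *≤ ≤⇒0≤ Tw₁) +< (0≤ε *≤ ≤⇒0≤ Tw₂))
      ... | inj₂ σ<D = <⇒0< σ<D *< <⇒0< sh +< *-cancel-0≤ 0<D (≤-respʳ jensen
        ((0≤φ *≤ 0≤ε *≤ 0≤N (w₁ ⊖ w₂)) +≤
         (<⇒≤ (<⇒0< σ<D) *≤ ((0≤φ *≤ 0≤N w₁) +≤ (0≤ε *≤ 0≤N w₂)))))
      bound : 0# < D * (T - N (h ⊖ q))
      bound = <-respʳ eq (((0≤φ *≤ 0≤h₁) +≤ (0≤ε *≤ 0≤h₂)) +≤< rest)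

    -- Four vectors in one closed half-plane would need three consecutive angles above 60 degrees.
    -- In determinants: `between′` gives a ⨯ c < a ⨯ b and `between` gives b ⨯ d < c ⨯ d, so the
    -- left side of the Plücker relation is smaller than the first summand on its right, although
    -- the second is nonnegative.
    no-fan-ordered : ∀ {a b c d} → Short a → Short b → Short c → Short d →
      Far a b → Far a c → Far b c → Far c d →
      0# ≤ a ⨯ b → 0# ≤ a ⨯ c → 0# ≤ a ⨯ d → 0# < b ⨯ c → 0# < c ⨯ d → ⊥
    no-fan-ordered {a} {b} {c} {d} sa sb sc sd ab ac bc cd 0≤ab 0≤ac 0≤ad 0<bc 0<cd =
      <-irrefl (<-≤-trans (≤-<-trans below above) (≤-reflexive (sym (plücker a b c d))))
      where
      -- If a ⨯ b were 0, b would point opposite to a, and then a ⨯ c ≥ 0 would exclude b ⨯ c > 0.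
      positive : ∀ {b c} → Short b → Far a b → 0# ≤ a ⨯ b → 0# ≤ a ⨯ c → 0# < b ⨯ c → 0# < a ⨯ b
      positive {b} {c} sb ab 0≤ab 0≤ac 0<bc = 0≤ab , λ 0≈ab →
        ≤⇒≯ (0≤-neg (<⇒≤ (parallel⇒opposite sa sb ab (sym 0≈ab))) *≤ 0≤ac)
          (0<⇒< (<-respʳ (begin
            N a * (b ⨯ c)                              ≈⟨ N-⨯ a b c ⟩
            (a ∙ b) * (a ⨯ c) - (a ⨯ b) * (a ∙ c)      ≈⟨ +-congˡ (-‿cong (trans (*-congʳ (sym 0≈ab)) (zeroˡ _))) ⟩
            (a ∙ b) * (a ⨯ c) - 0#
              ≈⟨ solve 2 (λ d y → d :* y :- con (+ 0) := con (+ 0) :- (:- d) :* y) refl (a ∙ b) (a ⨯ c) ⟩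
            0# - (- (a ∙ b)) * (a ⨯ c)                 ∎)
            (0<N sb (far-sym {a} {b} ab) *< 0<bc)))
        where open ≈-Reasoning
      0<ab = positive sb ab 0≤ab 0≤ac 0<bc
      0<ac = positive sc ac 0≤ac 0≤ad 0<cd
      0<bd : 0# < b ⨯ d
      0<bd = *-cancel-0< 0<ac (<-respʳ (sym (plücker a b c d))
        (0<ab *< 0<cd +< (0≤ad *≤ <⇒≤ 0<bc)))
      below : (a ⨯ c) * (b ⨯ d) ≤ (a ⨯ b) * (b ⨯ d)
      below = 0≤⇒≤ (≤-respʳ (solve 3 (λ x y z → (x :- y) :* z := x :* z :- y :* z) refl _ _ _)
        (≤⇒0≤ (<⇒≤ (between′ sa sb sc ab bc 0≤ab (<⇒≤ 0<bc) 0<ac)) *≤ <⇒≤ 0<bd))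
      above : (a ⨯ b) * (b ⨯ d) < (a ⨯ b) * (c ⨯ d) + (a ⨯ d) * (b ⨯ c)
      above = 0<⇒< (<-respʳ (solve 4 (λ x y z w → x :* (y :- z) :+ w := (x :* y :+ w) :- x :* z)
          refl (a ⨯ b) (c ⨯ d) (b ⨯ d) ((a ⨯ d) * (b ⨯ c)))
        (0<ab *< <⇒0< (between sb sc sd bc cd (<⇒≤ 0<bc) (<⇒≤ 0<cd) 0<bd)
          +< (0≤ad *≤ <⇒≤ 0<bc)))

    -- Parallel b and c are opposite, so on one closed side of a they must both lie on the line of
    -- a. Then both are opposite to a, which gives b·c ≥ 0, a contradiction.
    ⨯≉0 : ∀ {a b c} → Short a → Short b → Short c → Far a b → Far a c → Far b c →
      0# ≤ a ⨯ b → 0# ≤ a ⨯ c → ¬ (b ⨯ c ≈ 0#)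
    ⨯≉0 {a} {b} {c} sa sb sc ab ac bc 0≤ab 0≤ac bc≈0 =
      ≤⇒≯ (0≤N a *≤ 0≤-neg (<⇒≤ b∙c<0)) (0<⇒< (<-respʳ
        (trans (sym (N-∙ a b c)) (solve 2 (λ n d → n :* d := con (+ 0) :- n :* (:- d)) refl _ _))
        (<-respʳ (solve 2 (λ d e → (con (+ 0) :- d) :* (con (+ 0) :- e) := d :* e) refl _ _)
          (<⇒0< (parallel⇒opposite sa sb ab ab≈0) *< <⇒0< (parallel⇒opposite sa sc ac ac≈0))
         +< (0≤ab *≤ 0≤ac))))
      where
      b∙c<0 = parallel⇒opposite sb sc bc bc≈0
      0<-b∙c : 0# < - (b ∙ c)
      0<-b∙c = <-respʳ (+-identityˡ _) (<⇒0< b∙c<0)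
      opposite : N b * (a ⨯ c) + (- (b ∙ c)) * (a ⨯ b) ≈ 0#
      opposite = begin
        N b * (a ⨯ c) + (- (b ∙ c)) * (a ⨯ b)
          ≈⟨ solve 6 (λ a₁ a₂ b₁ b₂ c₁ c₂ →
             let a = a₁ , a₂ ; b = b₁ , b₂ ; c = c₁ , c₂ in
             Nₚ b :* (a ⨯ₚ c) :+ (:- (b ∙ₚ c)) :* (a ⨯ₚ b) := (a ∙ₚ b) :* (b ⨯ₚ c))
             refl (proj₁ a) (proj₂ a) (proj₁ b) (proj₂ b) (proj₁ c) (proj₂ c) ⟩
        (a ∙ b) * (b ⨯ c)   ≈⟨ trans (*-congˡ bc≈0) (zeroʳ _) ⟩
        0#                  ∎
        where open ≈-Reasoning
      ab≈0 : a ⨯ b ≈ 0#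
      ab≈0 with em {a ⨯ b ≈ 0#}
      ... | yes e = e
      ... | no  e = ⊥-elim (<-irrefl (<-respʳ opposite
        ((0≤N b *≤ 0≤ac) +≤< (0<-b∙c *< (0≤ab , λ 0≈ → e (sym 0≈))))))
      ac≈0 : a ⨯ c ≈ 0#
      ac≈0 with em {a ⨯ c ≈ 0#}
      ... | yes e = e
      ... | no  e = ⊥-elim (<-irrefl (<-respʳ opposite
        (0<N sc (far-sym {b} {c} bc) *< (0≤ac , λ 0≈ → e (sym 0≈))
          +< (<⇒≤ 0<-b∙c *≤ 0≤ab))))

    -- Orientations within a family of short, mutually distant vectors

    module Family {I : Set} (v : I → ℝ²) (short : ∀ i → Short (v i))
                  (far : ∀ {i j} → i ≢ j → Far (v i) (v j)) where

      infix 4 _⟶_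
      _⟶_ : I → I → Set
      i ⟶ j = 0# < v i ⨯ v j

      -- The orientations of b, c, d form a tournament, which always has a directed path through its
      -- three vertices. `no-fan-ordered` asks for no more than such a path, so cyclic triples need
      -- no separate treatment.
      no-fan : ∀ {a b c d} → Unique (a ∷ b ∷ c ∷ d ∷ []) →
        0# ≤ v a ⨯ v b → 0# ≤ v a ⨯ v c → 0# ≤ v a ⨯ v d → ⊥
      no-fan {a} {b} {c} {d} ((ab ∷ ac ∷ ad ∷ []) ∷ (bc ∷ bd ∷ []) ∷ (cd ∷ []) ∷ [] ∷ []) 0≤ab 0≤ac 0≤ad =
        go (compare ab ac bc 0≤ab 0≤ac) (compare ac ad cd 0≤ac 0≤ad) (compare ab ad bd 0≤ab 0≤ad)
        where
        compare : ∀ {x y} → a ≢ x → a ≢ y → x ≢ y → 0# ≤ v a ⨯ v x → 0# ≤ v a ⨯ v y →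
                  x ⟶ y ⊎ y ⟶ x
        compare {x} {y} ax ay xy 0≤ax 0≤ay with ≤-or-> (v x ⨯ v y) 0#
        ... | inj₂ x⟶y = inj₁ x⟶y
        ... | inj₁ p = inj₂ (⨯-<0 {v x} {v y} (p ,
          ⨯≉0 (short a) (short x) (short y) (far ax) (far ay) (far xy) 0≤ax 0≤ay))
        ordered : ∀ {x y z} → a ≢ x → a ≢ y → x ≢ y → y ≢ z →
          0# ≤ v a ⨯ v x → 0# ≤ v a ⨯ v y → 0# ≤ v a ⨯ v z → x ⟶ y → y ⟶ z → ⊥
        ordered ax ay xy yz = no-fan-ordered (short _) (short _) (short _) (short _)
          (far ax) (far ay) (far xy) (far yz)
        go : b ⟶ c ⊎ c ⟶ b → c ⟶ d ⊎ d ⟶ c → b ⟶ d ⊎ d ⟶ b → ⊥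
        go (inj₁ b⟶c) (inj₁ c⟶d) _ = ordered ab ac bc cd 0≤ab 0≤ac 0≤ad b⟶c c⟶d
        go (inj₁ b⟶c) (inj₂ d⟶c) (inj₁ b⟶d) =
          ordered ab ad bd (≢-sym cd) 0≤ab 0≤ad 0≤ac b⟶d d⟶c
        go (inj₁ b⟶c) (inj₂ d⟶c) (inj₂ d⟶b) =
          ordered ad ab (≢-sym bd) bc 0≤ad 0≤ab 0≤ac d⟶b b⟶c
        go (inj₂ c⟶b) _ (inj₁ b⟶d) = ordered ac ab (≢-sym bc) bd 0≤ac 0≤ab 0≤ad c⟶b b⟶d
        go (inj₂ c⟶b) (inj₁ c⟶d) (inj₂ d⟶b) =
          ordered ac ad cd (≢-sym bd) 0≤ac 0≤ad 0≤ab c⟶d d⟶b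
        go (inj₂ c⟶b) (inj₂ d⟶c) (inj₂ d⟶b) =
          ordered ad ac (≢-sym cd) (≢-sym bc) 0≤ad 0≤ac 0≤ab d⟶c c⟶b

    module Pentagon {I : Set} (v : I → ℝ²) (short : ∀ i → Short (v i))
                    (far : ∀ {i j} → i ≢ j → Far (v i) (v j)) where

      open Family v short far public
      private module Mirror = Family (λ i → swap (v i)) (λ i → short-swap {v i} (short i))
                (λ {i} {j} i≢j → far-swap {v i} {v j} (far i≢j))

      no-fan′ : ∀ {a b c d} → Unique (a ∷ b ∷ c ∷ d ∷ []) →
        v a ⨯ v b ≤ 0# → v a ⨯ v c ≤ 0# → v a ⨯ v d ≤ 0# → ⊥
      no-fan′ {a} u ab ac ad = Mirror.no-fan u (flip ab) (flip ac) (flip ad)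
        where
        flip : ∀ {x} → v a ⨯ v x ≤ 0# → 0# ≤ swap (v a) ⨯ swap (v x)
        flip {x} p = ≤-respʳ (⨯-swap (v x) (v a)) (⨯-≤0 {v a} {v x} p)

      -- Three others cannot share a closed side of a, so two on one side push the third strictly to
      -- the opposite one. This is how signs are propagated around the pentagon.
      third-out : ∀ {a b c d} → Unique (a ∷ b ∷ c ∷ d ∷ []) →
        b ⟶ a → v a ⨯ v c ≤ 0# → a ⟶ d
      third-out {a} {b} {c} {d} u b⟶a ac≤0 with ≤-or-> (v a ⨯ v d) 0#
      ... | inj₂ a⟶d = a⟶d
      ... | inj₁ ad≤0 = ⊥-elim (no-fan′ u (⨯-0≤ {v a} {v b} (<⇒≤ b⟶a)) ac≤0 ad≤0)

      third-in : ∀ {a b c d} → Unique (a ∷ b ∷ c ∷ d ∷ []) →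
        a ⟶ b → 0# ≤ v a ⨯ v c → d ⟶ a
      third-in {a} {b} {c} {d} u a⟶b 0≤ac with ≤-or-> 0# (v a ⨯ v d)
      ... | inj₂ ad<0 = ⨯-<0 {v a} {v d} ad<0
      ... | inj₁ 0≤ad = ⊥-elim (no-fan u (<⇒≤ a⟶b) 0≤ac 0≤ad)

      -- The orientations of a regular pentagon: each vertex points to the next two. All ten pairs
      -- are recorded, which makes rotation a mere renaming.
      record Cyclic (p q r s t : I) : Set where
        field
          p⟶q : p ⟶ q
          p⟶r : p ⟶ r
          q⟶r : q ⟶ r
          q⟶s : q ⟶ s
          r⟶s : r ⟶ s
          r⟶t : r ⟶ t
          s⟶t : s ⟶ t
          s⟶p : s ⟶ p
          t⟶p : t ⟶ p
          t⟶q : t ⟶ q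

      rotate : ∀ {p q r s t} → Cyclic p q r s t → Cyclic q r s t p
      rotate c = record
        { p⟶q = q⟶r ; p⟶r = q⟶s ; q⟶r = r⟶s ; q⟶s = r⟶t ; r⟶s = s⟶t
        ; r⟶t = s⟶p ; s⟶t = t⟶p ; s⟶p = t⟶q ; t⟶p = p⟶q ; t⟶q = p⟶r }
        where open Cyclic c

      CyclicAround : I → Set
      CyclicAround t = ∃[ p ] ∃[ q ] ∃[ r ] ∃[ s ] Unique (t ∷ p ∷ q ∷ r ∷ s ∷ []) × Cyclic t p q r s

      private
        finish : ∀ {t p q r s} → Unique (t ∷ p ∷ q ∷ r ∷ s ∷ []) →
          t ⟶ p → t ⟶ q → r ⟶ t → s ⟶ t → p ⟶ q → r ⟶ s → CyclicAround t
        finish {t} {p} {q} {r} {s}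
          u@((tp ∷ tq ∷ tr ∷ ts ∷ []) ∷ (pq ∷ pr ∷ ps ∷ []) ∷ (qr ∷ qs ∷ []) ∷ (rs ∷ []) ∷ [] ∷ [])
          t⟶p t⟶q r⟶t s⟶t p⟶q r⟶s = p , q , r , s , u , record
            { p⟶q = t⟶p ; p⟶r = t⟶q ; q⟶r = p⟶q ; r⟶s = q⟶r ; s⟶t = r⟶s ; s⟶p = r⟶t ; t⟶p = s⟶t
            ; q⟶s = third-in ((≢-sym tr ∷ rs ∷ ≢-sym pr ∷ []) ∷ (ts ∷ tp ∷ []) ∷ (≢-sym ps ∷ []) ∷ [] ∷ [])
                r⟶t (<⇒≤ r⟶s)
            ; r⟶t = q⟶s
            ; t⟶q = third-out ((≢-sym rs ∷ ≢-sym qs ∷ ≢-sym ps ∷ []) ∷ (≢-sym qr ∷ ≢-sym pr ∷ []) ∷ (≢-sym pq ∷ []) ∷ [] ∷ [])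
                r⟶s (⨯-0≤ {v s} {v q} (<⇒≤ q⟶s)) }
          where
          q⟶r = third-out ((≢-sym tq ∷ ≢-sym pq ∷ qr ∷ []) ∷ (tp ∷ tr ∷ []) ∷ (pr ∷ []) ∷ [] ∷ [])
            t⟶q (⨯-0≤ {v q} {v p} (<⇒≤ p⟶q))
          q⟶s = third-out ((≢-sym tq ∷ ≢-sym pq ∷ qs ∷ []) ∷ (tp ∷ ts ∷ []) ∷ (ps ∷ []) ∷ [] ∷ [])
            t⟶q (⨯-0≤ {v q} {v p} (<⇒≤ p⟶q))

        order-in : ∀ {t p q r s} → Unique (t ∷ p ∷ q ∷ r ∷ s ∷ []) →
          t ⟶ p → t ⟶ q → r ⟶ t → s ⟶ t → p ⟶ q → CyclicAround t
        order-in {t} {p} {q} {r} {s}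
          u@((tp ∷ tq ∷ tr ∷ ts ∷ []) ∷ (pq ∷ pr ∷ ps ∷ []) ∷ (qr ∷ qs ∷ []) ∷ (rs ∷ []) ∷ [] ∷ [])
          t⟶p t⟶q r⟶t s⟶t p⟶q with ≤-or-> (v r ⨯ v s) 0#
        ... | inj₂ r⟶s = finish u t⟶p t⟶q r⟶t s⟶t p⟶q r⟶s
        ... | inj₁ rs≤0 = finish
          ((tp ∷ tq ∷ ts ∷ tr ∷ []) ∷ (pq ∷ ps ∷ pr ∷ []) ∷ (qs ∷ qr ∷ []) ∷ (≢-sym rs ∷ []) ∷ [] ∷ [])
          t⟶p t⟶q s⟶t r⟶t p⟶q
          (third-out ((≢-sym ps ∷ ≢-sym qs ∷ ≢-sym rs ∷ []) ∷ (pq ∷ pr ∷ []) ∷ (qr ∷ []) ∷ [] ∷ [])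
            p⟶s (⨯-0≤ {v s} {v q} (<⇒≤ q⟶s)))
          where
          p⟶s = third-in ((≢-sym ts ∷ ≢-sym rs ∷ ≢-sym ps ∷ []) ∷ (tr ∷ tp ∷ []) ∷ (≢-sym pr ∷ []) ∷ [] ∷ [])
            s⟶t (⨯-≤0 {v r} {v s} rs≤0)
          q⟶s = third-in ((≢-sym ts ∷ ≢-sym rs ∷ ≢-sym qs ∷ []) ∷ (tr ∷ tq ∷ []) ∷ (≢-sym qr ∷ []) ∷ [] ∷ [])
            s⟶t (⨯-≤0 {v r} {v s} rs≤0)

        order-out : ∀ {t p q r s} → Unique (t ∷ p ∷ q ∷ r ∷ s ∷ []) →
          t ⟶ p → t ⟶ q → v t ⨯ v r ≤ 0# → v t ⨯ v s ≤ 0# → CyclicAround t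
        order-out {t} {p} {q} {r} {s}
          u@((tp ∷ tq ∷ tr ∷ ts ∷ []) ∷ (pq ∷ pr ∷ ps ∷ []) ∷ (qr ∷ qs ∷ []) ∷ (rs ∷ []) ∷ [] ∷ [])
          t⟶p t⟶q tr≤0 ts≤0 with ≤-or-> (v p ⨯ v q) 0#
        ... | inj₂ p⟶q = order-in u t⟶p t⟶q r⟶t s⟶t p⟶q
          where
          r⟶t = third-in ((tp ∷ tq ∷ tr ∷ []) ∷ (pq ∷ pr ∷ []) ∷ (qr ∷ []) ∷ [] ∷ []) t⟶p (<⇒≤ t⟶q)
          s⟶t = third-in ((tp ∷ tq ∷ ts ∷ []) ∷ (pq ∷ ps ∷ []) ∷ (qs ∷ []) ∷ [] ∷ []) t⟶p (<⇒≤ t⟶q)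
        ... | inj₁ pq≤0 = order-in
          ((tq ∷ tp ∷ tr ∷ ts ∷ []) ∷ (≢-sym pq ∷ qr ∷ qs ∷ []) ∷ (pr ∷ ps ∷ []) ∷ (rs ∷ []) ∷ [] ∷ [])
          t⟶q t⟶p r⟶t s⟶t
          (third-in ((pr ∷ ps ∷ pq ∷ []) ∷ (rs ∷ ≢-sym qr ∷ []) ∷ (≢-sym qs ∷ []) ∷ [] ∷ [])
            p⟶r (<⇒≤ p⟶s))
          where
          r⟶t = third-in ((tp ∷ tq ∷ tr ∷ []) ∷ (pq ∷ pr ∷ []) ∷ (qr ∷ []) ∷ [] ∷ []) t⟶p (<⇒≤ t⟶q)
          s⟶t = third-in ((tp ∷ tq ∷ ts ∷ []) ∷ (pq ∷ ps ∷ []) ∷ (qs ∷ []) ∷ [] ∷ []) t⟶p (<⇒≤ t⟶q)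
          p⟶r = third-out ((≢-sym tp ∷ pq ∷ pr ∷ []) ∷ (tq ∷ tr ∷ []) ∷ (qr ∷ []) ∷ [] ∷ []) t⟶p pq≤0
          p⟶s = third-out ((≢-sym tp ∷ pq ∷ ps ∷ []) ∷ (tq ∷ ts ∷ []) ∷ (qs ∷ []) ∷ [] ∷ []) t⟶p pq≤0

      -- Neither side of t holds three of the other four, so they split two and two; the remaining
      -- orientations then follow up to the naming within each pair.
      cyclic-order : ∀ {t i j k l} → Unique (t ∷ i ∷ j ∷ k ∷ l ∷ []) → CyclicAround t
      cyclic-order {t} {i} {j} {k} {l}
        u@((ti ∷ tj ∷ tk ∷ tl ∷ []) ∷ (ij ∷ ik ∷ il ∷ []) ∷ (jk ∷ jl ∷ []) ∷ (kl ∷ []) ∷ [] ∷ [])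
        = split (≤-or-> _ _) (≤-or-> _ _) (≤-or-> _ _) (≤-or-> _ _)
        where
        ijk = (ti ∷ tj ∷ tk ∷ []) ∷ (ij ∷ ik ∷ []) ∷ (jk ∷ []) ∷ [] ∷ []
        ijl = (ti ∷ tj ∷ tl ∷ []) ∷ (ij ∷ il ∷ []) ∷ (jl ∷ []) ∷ [] ∷ []
        ikl = (ti ∷ tk ∷ tl ∷ []) ∷ (ik ∷ il ∷ []) ∷ (kl ∷ []) ∷ [] ∷ []
        jkl = (tj ∷ tk ∷ tl ∷ []) ∷ (jk ∷ jl ∷ []) ∷ (kl ∷ []) ∷ [] ∷ []
        fan : ∀ {a b c} → Unique (t ∷ a ∷ b ∷ c ∷ []) → t ⟶ a → t ⟶ b → t ⟶ c → CyclicAround t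
        fan u a b c = ⊥-elim (no-fan u (<⇒≤ a) (<⇒≤ b) (<⇒≤ c))
        fan′ : ∀ {a b c} → Unique (t ∷ a ∷ b ∷ c ∷ []) →
          v t ⨯ v a ≤ 0# → v t ⨯ v b ≤ 0# → v t ⨯ v c ≤ 0# → CyclicAround t
        fan′ u a b c = ⊥-elim (no-fan′ u a b c)
        split : v t ⨯ v i ≤ 0# ⊎ t ⟶ i → v t ⨯ v j ≤ 0# ⊎ t ⟶ j →
                v t ⨯ v k ≤ 0# ⊎ t ⟶ k → v t ⨯ v l ≤ 0# ⊎ t ⟶ l → CyclicAround t
        split (inj₂ i) (inj₂ j) (inj₂ k) _        = fan ijk i j k
        split (inj₂ i) (inj₂ j) (inj₁ k) (inj₂ l) = fan ijl i j l
        split (inj₂ i) (inj₂ j) (inj₁ k) (inj₁ l) = order-out u i j k l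
        split (inj₂ i) (inj₁ j) (inj₂ k) (inj₂ l) = fan ikl i k l
        split (inj₂ i) (inj₁ j) (inj₂ k) (inj₁ l) = order-out
          ((ti ∷ tk ∷ tj ∷ tl ∷ []) ∷ (ik ∷ ij ∷ il ∷ []) ∷ (≢-sym jk ∷ kl ∷ []) ∷ (jl ∷ []) ∷ [] ∷ [])
          i k j l
        split (inj₂ i) (inj₁ j) (inj₁ k) (inj₂ l) = order-out
          ((ti ∷ tl ∷ tj ∷ tk ∷ []) ∷ (il ∷ ij ∷ ik ∷ []) ∷ (≢-sym jl ∷ ≢-sym kl ∷ []) ∷ (jk ∷ []) ∷ [] ∷ [])
          i l j k
        split (inj₂ i) (inj₁ j) (inj₁ k) (inj₁ l) = fan′ jkl j k l
        split (inj₁ i) (inj₂ j) (inj₂ k) (inj₂ l) = fan jkl j k l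
        split (inj₁ i) (inj₂ j) (inj₂ k) (inj₁ l) = order-out
          ((tj ∷ tk ∷ ti ∷ tl ∷ []) ∷ (jk ∷ ≢-sym ij ∷ jl ∷ []) ∷ (≢-sym ik ∷ kl ∷ []) ∷ (il ∷ []) ∷ [] ∷ [])
          j k i l
        split (inj₁ i) (inj₂ j) (inj₁ k) (inj₂ l) = order-out
          ((tj ∷ tl ∷ ti ∷ tk ∷ []) ∷ (jl ∷ ≢-sym ij ∷ jk ∷ []) ∷ (≢-sym il ∷ ≢-sym kl ∷ []) ∷ (ik ∷ []) ∷ [] ∷ [])
          j l i k
        split (inj₁ i) (inj₂ j) (inj₁ k) (inj₁ l) = fan′ ikl i k l
        split (inj₁ i) (inj₁ j) (inj₂ k) (inj₂ l) = order-out
          ((tk ∷ tl ∷ ti ∷ tj ∷ []) ∷ (kl ∷ ≢-sym ik ∷ ≢-sym jk ∷ []) ∷ (≢-sym il ∷ ≢-sym jl ∷ []) ∷ (ij ∷ []) ∷ [] ∷ [])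
          k l i j
        split (inj₁ i) (inj₁ j) (inj₂ k) (inj₁ l) = fan′ ijl i j l
        split (inj₁ i) (inj₁ j) (inj₁ k) _        = fan′ ijk i j k

      private
        ⟶⇒≢ : ∀ {i j} → i ⟶ j → i ≢ j
        ⟶⇒≢ {i} i⟶i ≡.refl = <-irrefl (<-respʳ (-‿inverseʳ′ (v i)) i⟶i)
          where
          -‿inverseʳ′ : ∀ a → a ⨯ a ≈ 0#
          -‿inverseʳ′ (a₁ , a₂) = solve 2 (λ a b → a :* b :- b :* a := con (+ 0)) refl a₁ a₂

        betweenᵢ : ∀ {a b c} → a ⟶ b → b ⟶ c → a ⟶ c → v a ⨯ v c < v b ⨯ v c
        betweenᵢ a⟶b b⟶c a⟶c = between (short _) (short _) (short _)
          (far (⟶⇒≢ a⟶b)) (far (⟶⇒≢ b⟶c)) (<⇒≤ a⟶b) (<⇒≤ b⟶c) a⟶c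

        betweenᵢ′ : ∀ {a b c} → a ⟶ b → b ⟶ c → a ⟶ c → v a ⨯ v c < v a ⨯ v b
        betweenᵢ′ a⟶b b⟶c a⟶c = between′ (short _) (short _) (short _)
          (far (⟶⇒≢ a⟶b)) (far (⟶⇒≢ b⟶c)) (<⇒≤ a⟶b) (<⇒≤ b⟶c) a⟶c

        sum-shortᵢ : ∀ {a b c} → a ⟶ b → b ⟶ c → a ⟶ c → Short (v a ⊕ v c)
        sum-shortᵢ a⟶b b⟶c a⟶c = sum-short (short _) (short _) (short _)
          (far (⟶⇒≢ a⟶b)) (far (⟶⇒≢ b⟶c)) a⟶b b⟶c a⟶c

      -- An instance of `cap` with h = p + r, w₁ = p - t, w₂ = r - s: the vectors h, h - w₁ = r + t
      -- and h - w₂ = p + s are sums of next-but-one neighbours, hence short, and q lies in the cone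
      -- of w₁ and w₂.
      corner-short : ∀ {p q r s t} → Cyclic p q r s t → Short ((v p ⊕ v r) ⊖ v q)
      corner-short {p} {q} {r} {s} {t} c = cap {w₁ = w₁} {w₂} {h} {v q}
        (far {p} {t} (≢-sym (⟶⇒≢ t⟶p))) (far {r} {s} (⟶⇒≢ r⟶s))
        (<-respˡ (solve 6 (λ p₁ p₂ r₁ r₂ t₁ t₂ → let p = p₁ , p₂ ; r = r₁ , r₂ ; t = t₁ , t₂ in
            Nₚ (r ⊕ₚ t) := Nₚ (p ⊕ₚ r ⊖ₚ (p ⊖ₚ t))) refl
            (proj₁ (v p)) (proj₂ (v p)) (proj₁ (v r)) (proj₂ (v r)) (proj₁ (v t)) (proj₂ (v t)))
          (sum-shortᵢ r⟶s s⟶t r⟶t))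
        (<-respˡ (solve 6 (λ p₁ p₂ r₁ r₂ s₁ s₂ → let p = p₁ , p₂ ; r = r₁ , r₂ ; s = s₁ , s₂ in
            Nₚ (s ⊕ₚ p) := Nₚ (p ⊕ₚ r ⊖ₚ (r ⊖ₚ s))) refl
            (proj₁ (v p)) (proj₂ (v p)) (proj₁ (v r)) (proj₂ (v r)) (proj₁ (v s)) (proj₂ (v s)))
          (sum-shortᵢ s⟶t t⟶p s⟶p))
        (sum-shortᵢ p⟶q q⟶r p⟶r) (short q)
        0<w₁w₂ (<⇒≤ 0<qw₂) (<⇒≤ 0<w₁q)
        where
        open Cyclic c
        w₁ = v p ⊖ v t
        w₂ = v r ⊖ v s
        h  = v p ⊕ v r
        ⨯-⊖ : ∀ a b c → a ⨯ b - a ⨯ c ≈ a ⨯ (b ⊖ c)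
        ⨯-⊖ (a₁ , a₂) (b₁ , b₂) (c₁ , c₂) = solve 6 (λ a₁ a₂ b₁ b₂ c₁ c₂ →
          let a = a₁ , a₂ ; b = b₁ , b₂ ; c = c₁ , c₂ in
          a ⨯ₚ b :- a ⨯ₚ c := a ⨯ₚ (b ⊖ₚ c)) refl a₁ a₂ b₁ b₂ c₁ c₂
        ⊖-⨯ : ∀ a b c → a ⨯ c - b ⨯ c ≈ (a ⊖ b) ⨯ c
        ⊖-⨯ (a₁ , a₂) (b₁ , b₂) (c₁ , c₂) = solve 6 (λ a₁ a₂ b₁ b₂ c₁ c₂ →
          let a = a₁ , a₂ ; b = b₁ , b₂ ; c = c₁ , c₂ in
          a ⨯ₚ c :- b ⨯ₚ c := (a ⊖ₚ b) ⨯ₚ c) refl a₁ a₂ b₁ b₂ c₁ c₂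
        ⨯-⊖-self : ∀ a b → b ⨯ a ≈ a ⨯ (a ⊖ b)
        ⨯-⊖-self (a₁ , a₂) (b₁ , b₂) = solve 4 (λ a₁ a₂ b₁ b₂ →
          let a = a₁ , a₂ ; b = b₁ , b₂ in b ⨯ₚ a := a ⨯ₚ (a ⊖ₚ b)) refl a₁ a₂ b₁ b₂
        ⊖-⨯-self : ∀ a b → a ⨯ b ≈ (a ⊖ b) ⨯ a
        ⊖-⨯-self (a₁ , a₂) (b₁ , b₂) = solve 4 (λ a₁ a₂ b₁ b₂ →
          let a = a₁ , a₂ ; b = b₁ , b₂ in a ⨯ₚ b := (a ⊖ₚ b) ⨯ₚ a) refl a₁ a₂ b₁ b₂
        0<qw₂ : 0# < v q ⨯ w₂
        0<qw₂ = <-respʳ (⨯-⊖ (v q) (v r) (v s)) (<⇒0< (betweenᵢ′ q⟶r r⟶s q⟶s))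
        0<w₁q : 0# < w₁ ⨯ v q
        0<w₁q = <-respʳ (⊖-⨯ (v p) (v t) (v q)) (<⇒0< (betweenᵢ t⟶p p⟶q t⟶q))
        0<pw₁ : 0# < v p ⨯ w₁
        0<pw₁ = <-respʳ (⨯-⊖-self (v p) (v t)) t⟶p
        0<w₂r : 0# < w₂ ⨯ v r
        0<w₂r = <-respʳ (⊖-⨯-self (v r) (v s)) r⟶s
        -- The Plücker relation for p, q, w₂, r makes (p ⨯ w₂)(q ⨯ r) positive; the one for p, w₁,
        -- q, w₂ then does the same for (p ⨯ q)(w₁ ⨯ w₂).
        0<pw₂ : 0# < v p ⨯ w₂
        0<pw₂ = *-cancel-0< q⟶r (<-respʳ (trans (sym (plücker (v p) (v q) w₂ (v r))) (*-comm _ _))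
          (p⟶q *< 0<w₂r +< (<⇒≤ p⟶r *≤ <⇒≤ 0<qw₂)))
        0<w₁w₂ : 0# < w₁ ⨯ w₂
        0<w₁w₂ = *-cancel-0< p⟶q (<-respʳ
          (trans (+-congˡ (*-comm _ _)) (sym (plücker (v p) w₁ (v q) w₂)))
          (0<pw₁ *< 0<qw₂ +< (<⇒≤ 0<w₁q *≤ <⇒≤ 0<pw₂)))

      -- Up to sign this is h - p for the corner h = q + s - r. `cap` applies with w₁ = s - r and w₂
      -- = q - r, since h - w₁ = q, h - w₂ = s, and p lies in the cone of w₁ and w₂.
      alternating-short : ∀ {p q r s t} → Cyclic p q r s t →
                          Short (((v p ⊕ v r) ⊖ v q) ⊖ v s)
      alternating-short {p} {q} {r} {s} {t} c = <-respˡ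
        (solve 8 (λ p₁ p₂ q₁ q₂ r₁ r₂ s₁ s₂ →
          let p = p₁ , p₂ ; q = q₁ , q₂ ; r = r₁ , r₂ ; s = s₁ , s₂ in
          Nₚ (((q ⊕ₚ s) ⊖ₚ r) ⊖ₚ p) := Nₚ (((p ⊕ₚ r) ⊖ₚ q) ⊖ₚ s)) refl
          (proj₁ (v p)) (proj₂ (v p)) (proj₁ (v q)) (proj₂ (v q))
          (proj₁ (v r)) (proj₂ (v r)) (proj₁ (v s)) (proj₂ (v s)))
        (cap {w₁ = w₁} {w₂} {h} {v p}
          (far {s} {r} (≢-sym (⟶⇒≢ r⟶s))) (far {q} {r} (⟶⇒≢ q⟶r))
          (<-respˡ (N-cancel (v q) (v s) (v r)) (short q))
          (<-respˡ (trans (N-cancel (v s) (v q) (v r)) (+-cong (cong² (+-congʳ (+-congʳ (+-comm _ _)))) (cong² (+-congʳ (+-congʳ (+-comm _ _)))))) (short s))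
          (corner-short (rotate c)) (short p) 0<w₁w₂ (<⇒≤ 0<pw₂) (<⇒≤ 0<w₁p))
        where
        open Cyclic c
        w₁ = v s ⊖ v r
        w₂ = v q ⊖ v r
        h  = (v q ⊕ v s) ⊖ v r
        cong² : ∀ {x y} → x ≈ y → x * x ≈ y * y
        cong² x≈y = *-cong x≈y x≈y
        N-cancel : ∀ a b c → N a ≈ N (((a ⊕ b) ⊖ c) ⊖ (b ⊖ c))
        N-cancel (a₁ , a₂) (b₁ , b₂) (c₁ , c₂) = solve 6 (λ a₁ a₂ b₁ b₂ c₁ c₂ →
          let a = a₁ , a₂ ; b = b₁ , b₂ ; c = c₁ , c₂ in
          Nₚ a := Nₚ (((a ⊕ₚ b) ⊖ₚ c) ⊖ₚ (b ⊖ₚ c))) refl a₁ a₂ b₁ b₂ c₁ c₂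
        0<pw₂ : 0# < v p ⨯ w₂
        0<pw₂ = <-respʳ (solve 6 (λ p₁ p₂ q₁ q₂ r₁ r₂ →
          let p = p₁ , p₂ ; q = q₁ , q₂ ; r = r₁ , r₂ in
          p ⨯ₚ q :- p ⨯ₚ r := p ⨯ₚ (q ⊖ₚ r)) refl
          (proj₁ (v p)) (proj₂ (v p)) (proj₁ (v q)) (proj₂ (v q)) (proj₁ (v r)) (proj₂ (v r)))
          (<⇒0< (betweenᵢ′ p⟶q q⟶r p⟶r))
        0<w₁p : 0# < w₁ ⨯ v p
        0<w₁p = <-respʳ (solve 6 (λ p₁ p₂ r₁ r₂ s₁ s₂ →
          let p = p₁ , p₂ ; r = r₁ , r₂ ; s = s₁ , s₂ in
          s ⨯ₚ p :+ p ⨯ₚ r := (s ⊖ₚ r) ⨯ₚ p) refl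
          (proj₁ (v p)) (proj₂ (v p)) (proj₁ (v r)) (proj₂ (v r)) (proj₁ (v s)) (proj₂ (v s)))
          (s⟶p +< <⇒≤ p⟶r)
        0<w₁w₂ : 0# < w₁ ⨯ w₂
        0<w₁w₂ = <-respʳ (solve 6 (λ q₁ q₂ r₁ r₂ s₁ s₂ →
          let q = q₁ , q₂ ; r = r₁ , r₂ ; s = s₁ , s₂ in
          q ⨯ₚ r :- q ⨯ₚ s :+ r ⨯ₚ s := (s ⊖ₚ r) ⨯ₚ (q ⊖ₚ r)) refl
          (proj₁ (v q)) (proj₂ (v q)) (proj₁ (v r)) (proj₂ (v r)) (proj₁ (v s)) (proj₂ (v s)))
          (<⇒0< (betweenᵢ′ q⟶r r⟶s q⟶s) +< <⇒≤ r⟶s)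

      -- The negative of the vector in `alternating-short` for the pentagon read from t, one vertex
      -- earlier.
      alternating-short′ : ∀ {p q r s t} → Cyclic p q r s t →
                           Short (((v p ⊕ v r) ⊖ v q) ⊖ v t)
      alternating-short′ {p} {q} {r} {s} {t} c = <-respˡ
        (solve 8 (λ p₁ p₂ q₁ q₂ r₁ r₂ t₁ t₂ →
          let p = p₁ , p₂ ; q = q₁ , q₂ ; r = r₁ , r₂ ; t = t₁ , t₂ in
          Nₚ (((t ⊕ₚ q) ⊖ₚ p) ⊖ₚ r) := Nₚ (((p ⊕ₚ r) ⊖ₚ q) ⊖ₚ t)) refl
          (proj₁ (v p)) (proj₂ (v p)) (proj₁ (v q)) (proj₂ (v q))
          (proj₁ (v r)) (proj₂ (v r)) (proj₁ (v t)) (proj₂ (v t)))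
        (alternating-short (rotate (rotate (rotate (rotate c)))))

    -- Three vectors on a line cannot be pairwise opposite: (a·b)(a·c) = |a|² (b·c) would be
    -- positive on the left and at most 0 on the right.
    no-three-parallel : ∀ {a b c} → Short a → Short b → Short c → Far a b → Far a c → Far b c →
      a ⨯ b ≈ 0# → a ⨯ c ≈ 0# → b ⨯ c ≈ 0# → ⊥
    no-three-parallel {a} {b} {c} sa sb sc ab ac bc ab≈0 ac≈0 bc≈0 =
      ≤⇒≯ (0≤N a *≤ 0≤-neg (<⇒≤ (parallel⇒opposite sb sc bc bc≈0))) (0<⇒< (<-respʳ eq
        (<⇒0< (parallel⇒opposite sa sb ab ab≈0) *< <⇒0< (parallel⇒opposite sa sc ac ac≈0))))
      where
      open ≈-Reasoning
      eq : (0# - a ∙ b) * (0# - a ∙ c) ≈ 0# - N a * (- (b ∙ c))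
      eq = begin
        (0# - a ∙ b) * (0# - a ∙ c)
          ≈⟨ solve 2 (λ d e → (con (+ 0) :- d) :* (con (+ 0) :- e) := d :* e :+ con (+ 0)) refl _ _ ⟩
        (a ∙ b) * (a ∙ c) + 0#
          ≈⟨ +-congˡ (trans (*-congʳ ab≈0) (zeroˡ _)) ⟨
        (a ∙ b) * (a ∙ c) + (a ⨯ b) * (a ⨯ c)
          ≈⟨ N-∙ a b c ⟨
        N a * (b ∙ c)
          ≈⟨ solve 2 (λ n d → n :* d := con (+ 0) :- n :* (:- d)) refl _ _ ⟩
        0# - N a * (- (b ∙ c)) ∎

-- Inner product spaces

module Space (em : ExcludedMiddle 0ℓ) {ℝ : CompleteOrderedField} (V : InnerProductSpace ℝ) where

  open OrderedField em ℝ
  open InnerProductSpace V public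

  infixl 6 _-ᴹ_
  _-ᴹ_ : Carrierᴹ → Carrierᴹ → Carrierᴹ
  x -ᴹ y = x +ᴹ (-ᴹ y)

  ⟨0,⟩ : ∀ z → ⟨ 0ᴹ , z ⟩ ≈ 0#
  ⟨0,⟩ z = trans (⟨,⟩-cong (≈ᴹ-sym (*ₗ-zeroˡ 0ᴹ)) ≈ᴹ-refl) (trans (⟨,⟩-* _ _ _) (zeroˡ _))

  ⟨-,⟩ : ∀ x z → ⟨ -ᴹ x , z ⟩ ≈ - ⟨ x , z ⟩
  ⟨-,⟩ x z = begin
    ⟨ -ᴹ x , z ⟩
      ≈⟨ solve 2 (λ a b → a := (a :+ b) :- b) refl ⟨ -ᴹ x , z ⟩ ⟨ x , z ⟩ ⟩
    (⟨ -ᴹ x , z ⟩ + ⟨ x , z ⟩) - ⟨ x , z ⟩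
      ≈⟨ +-congʳ (trans (sym (⟨,⟩-+ _ _ _)) (trans (⟨,⟩-cong (-ᴹ‿inverseˡ x) ≈ᴹ-refl) (⟨0,⟩ z))) ⟩
    0# - ⟨ x , z ⟩
      ≈⟨ +-identityˡ _ ⟩
    - ⟨ x , z ⟩ ∎
    where open ≈-Reasoning

  ⟨⟩-- : ∀ x y z → ⟨ x -ᴹ y , z ⟩ ≈ ⟨ x , z ⟩ - ⟨ y , z ⟩
  ⟨⟩-- x y z = trans (⟨,⟩-+ _ _ _) (+-congˡ (⟨-,⟩ y z))

  ⟨⟩--* : ∀ x c y z → ⟨ x -ᴹ c *ₗ y , z ⟩ ≈ ⟨ x , z ⟩ - c * ⟨ y , z ⟩
  ⟨⟩--* x c y z = trans (⟨⟩-- _ _ _) (+-congˡ (-‿cong (⟨,⟩-* _ _ _)))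

  ⟨,0⟩ : ∀ z → ⟨ z , 0ᴹ ⟩ ≈ 0#
  ⟨,0⟩ z = trans (⟨,⟩-sym _ _) (⟨0,⟩ z)

  ⟨⟩-*ʳ : ∀ c x z → ⟨ z , c *ₗ x ⟩ ≈ c * ⟨ z , x ⟩
  ⟨⟩-*ʳ c x z = trans (⟨,⟩-sym _ _) (trans (⟨,⟩-* _ _ _) (*-congˡ (⟨,⟩-sym _ _)))

  ⟨⟩--ʳ : ∀ x y z → ⟨ z , x -ᴹ y ⟩ ≈ ⟨ z , x ⟩ - ⟨ z , y ⟩
  ⟨⟩--ʳ x y z = trans (⟨,⟩-sym _ _) (trans (⟨⟩-- _ _ _) (+-cong (⟨,⟩-sym _ _) (-‿cong (⟨,⟩-sym _ _))))

  x≈y⇒x-y≈0 : ∀ {x y} → x ≈ y → x - y ≈ 0#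
  x≈y⇒x-y≈0 p = trans (+-congʳ p) (-‿inverseʳ _)

  -- Vector identities become scalar ones, which the ring solver decides.
  ⟨⟩-injective : ∀ {x y} → (∀ z → ⟨ x , z ⟩ ≈ ⟨ y , z ⟩) → x ≈ᴹ y
  ⟨⟩-injective {x} {y} p = begin
    x                       ≈⟨ +ᴹ-identityʳ x ⟨
    x +ᴹ 0ᴹ                 ≈⟨ +ᴹ-congˡ (-ᴹ‿inverseˡ y) ⟨
    x +ᴹ (-ᴹ y +ᴹ y)        ≈⟨ +ᴹ-assoc _ _ _ ⟨
    (x -ᴹ y) +ᴹ y           ≈⟨ +ᴹ-congʳ (⟨,⟩-definite _ (trans (⟨⟩-- x y _) (x≈y⇒x-y≈0 (p _)))) ⟩
    0ᴹ +ᴹ y                 ≈⟨ +ᴹ-identityˡ y ⟩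
    y                       ∎
    where open import Relation.Binary.Reasoning.Setoid ≈ᴹ-setoid

  record IsSubspace (S : Pred Carrierᴹ 0ℓ) : Set where
    field
      resp : ∀ {x y} → x ≈ᴹ y → x ∈ S → y ∈ S
      zero∈ : 0ᴹ ∈ S
      add  : ∀ {x y} → x ∈ S → y ∈ S → (x +ᴹ y) ∈ S
      scale : ∀ c {x} → x ∈ S → (c *ₗ x) ∈ S

    sub : ∀ {x y} → x ∈ S → y ∈ S → (x -ᴹ y) ∈ S
    sub {x} {y} x∈S y∈S = resp (⟨⟩-injective λ z → begin
      ⟨ x +ᴹ (- 1#) *ₗ y , z ⟩         ≈⟨ trans (⟨,⟩-+ _ _ _) (+-congˡ (⟨,⟩-* _ _ _)) ⟩
      ⟨ x , z ⟩ + (- 1#) * ⟨ y , z ⟩   ≈⟨ +-congˡ (trans (sym (-‿distribˡ-* _ _)) (-‿cong (*-identityˡ _))) ⟩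
      ⟨ x , z ⟩ - ⟨ y , z ⟩            ≈⟨ ⟨⟩-- x y z ⟨
      ⟨ x -ᴹ y , z ⟩                   ∎) (add x∈S (scale (- 1#) y∈S))
      where open ≈-Reasoning

  Projectable : Pred Carrierᴹ 0ℓ → Set
  Projectable S = ∀ v → ∃[ w ] w ∈ S × (v -ᴹ w) ∈ OrthogonalComplement S

  -- A recursive span, which exposes the coefficient of one vector at a time for elimination.
  InSpan : ∀ {n} → Vector Carrierᴹ n → Pred Carrierᴹ 0ℓ
  InSpan {zero}  b v = v ≈ᴹ 0ᴹ
  InSpan {suc n} b v = ∃[ c ] (v -ᴹ c *ₗ head b) ∈ InSpan (tail b)

  linearCombination∈InSpan : ∀ {n} (c : Vector Carrier n) b → linearCombination c b ∈ InSpan b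

  InSpan-isSubspace : ∀ {n} (b : Vector Carrierᴹ n) → IsSubspace (InSpan b)
  InSpan-isSubspace {zero} b = record
    { resp  = λ x≈y x≈0 → ≈ᴹ-trans (≈ᴹ-sym x≈y) x≈0
    ; zero∈ = ≈ᴹ-refl
    ; add   = λ p q → ≈ᴹ-trans (+ᴹ-cong p q) (+ᴹ-identityˡ 0ᴹ)
    ; scale = λ c p → ≈ᴹ-trans (*ₗ-congˡ p) (*ₗ-zeroʳ c)
    }
  InSpan-isSubspace {suc n} b = record
    { resp  = λ x≈y (c , p) → c , resp (+ᴹ-congʳ x≈y) p
    ; zero∈ = 0# , resp (⟨⟩-injective λ z → begin
        ⟨ 0ᴹ , z ⟩                     ≈⟨ ⟨0,⟩ z ⟩
        0#                             ≈⟨ solve 1 (λ x → con (+ 0) := con (+ 0) :- con (+ 0) :* x) refl _ ⟩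
        0# - 0# * ⟨ head b , z ⟩       ≈⟨ +-congʳ (⟨0,⟩ z) ⟨
        ⟨ 0ᴹ , z ⟩ - 0# * ⟨ head b , z ⟩ ≈⟨ ⟨⟩--* _ _ _ _ ⟨
        ⟨ 0ᴹ -ᴹ 0# *ₗ head b , z ⟩     ∎) zero∈
    ; add   = λ {x} {y} (c , p) (d , q) → c + d , resp (⟨⟩-injective λ z → begin
        ⟨ (x -ᴹ c *ₗ head b) +ᴹ (y -ᴹ d *ₗ head b) , z ⟩
          ≈⟨ trans (⟨,⟩-+ _ _ _) (+-cong (⟨⟩--* _ _ _ _) (⟨⟩--* _ _ _ _)) ⟩
        (⟨ x , z ⟩ - c * ⟨ head b , z ⟩) + (⟨ y , z ⟩ - d * ⟨ head b , z ⟩)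
          ≈⟨ solve 5 (λ x y c d h → (x :- c :* h) :+ (y :- d :* h) := (x :+ y) :- (c :+ d) :* h)
               refl ⟨ x , z ⟩ ⟨ y , z ⟩ c d ⟨ head b , z ⟩ ⟩
        (⟨ x , z ⟩ + ⟨ y , z ⟩) - (c + d) * ⟨ head b , z ⟩
          ≈⟨ trans (⟨⟩--* _ _ _ _) (+-congʳ (⟨,⟩-+ _ _ _)) ⟨
        ⟨ (x +ᴹ y) -ᴹ (c + d) *ₗ head b , z ⟩ ∎) (add p q)
    ; scale = λ k {x} (c , p) → k * c , resp (⟨⟩-injective λ z → begin
        ⟨ k *ₗ (x -ᴹ c *ₗ head b) , z ⟩
          ≈⟨ trans (⟨,⟩-* _ _ _) (*-congˡ (⟨⟩--* _ _ _ _)) ⟩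
        k * (⟨ x , z ⟩ - c * ⟨ head b , z ⟩)
          ≈⟨ solve 4 (λ k x c h → k :* (x :- c :* h) := k :* x :- k :* c :* h)
               refl k ⟨ x , z ⟩ c ⟨ head b , z ⟩ ⟩
        k * ⟨ x , z ⟩ - k * c * ⟨ head b , z ⟩
          ≈⟨ trans (⟨⟩--* _ _ _ _) (+-congʳ (⟨,⟩-* _ _ _)) ⟨
        ⟨ k *ₗ x -ᴹ (k * c) *ₗ head b , z ⟩ ∎) (scale k p)
    }
    where
    open IsSubspace (InSpan-isSubspace (tail b))
    open ≈-Reasoning

  linearCombination∈InSpan {zero}  c b = ≈ᴹ-refl
  linearCombination∈InSpan {suc n} c b = head c , resp (⟨⟩-injective λ z → sym (begin
    ⟨ (head c *ₗ head b +ᴹ L) -ᴹ head c *ₗ head b , z ⟩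
      ≈⟨ trans (⟨⟩--* _ _ _ _) (+-congʳ (trans (⟨,⟩-+ _ _ _) (+-congʳ (⟨,⟩-* _ _ _)))) ⟩
    head c * ⟨ head b , z ⟩ + ⟨ L , z ⟩ - head c * ⟨ head b , z ⟩
      ≈⟨ solve 3 (λ c h l → c :* h :+ l :- c :* h := l) refl (head c) ⟨ head b , z ⟩ ⟨ L , z ⟩ ⟩
    ⟨ L , z ⟩ ∎)) (linearCombination∈InSpan (tail c) (tail b))
    where
    open IsSubspace (InSpan-isSubspace (tail b))
    open ≈-Reasoning
    L = linearCombination (tail c) (tail b)

  -- Induction on the spanning list, as S is a bare predicate without a basis. Either no element of
  -- S involves the head, and the tail suffices; or some s does, and S consists of S′, its part in
  -- the span of the tail, together with the multiples of s. Then one Gram-Schmidt step with g = s -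
  -- w₀ extends the projection from S′ to S.
  projectable : ∀ {n} (b : Vector Carrierᴹ n) S → IsSubspace S →
                (∀ v → v ∈ S → v ∈ InSpan b) → Projectable S
  projectable {zero} b S sub-S S⊆ v = 0ᴹ , zero∈ , λ s s∈S →
    trans (⟨,⟩-cong ≈ᴹ-refl (S⊆ s s∈S)) (⟨,0⟩ _)
    where open IsSubspace sub-S
  projectable {suc n} b S sub-S S⊆ with em {∃[ s ] s ∈ S × ∃[ c ] ¬ (c ≈ 0#) × (s -ᴹ c *ₗ head b) ∈ InSpan (tail b)}
  ... | no none = projectable (tail b) S sub-S contained
    where
    open IsSubspace (InSpan-isSubspace (tail b))
    contained : ∀ v → v ∈ S → v ∈ InSpan (tail b)
    contained v v∈S with S⊆ v v∈S
    ... | c , p with em {c ≈ 0#}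
    ... | no  c≉0 = ⊥-elim (none (v , v∈S , c , c≉0 , p))
    ... | yes c≈0 = resp (⟨⟩-injective λ z → trans (⟨⟩--* _ _ _ _)
        (trans (+-congˡ (-‿cong (trans (*-congʳ c≈0) (zeroˡ _))))
        (solve 1 (λ x → x :- con (+ 0) := x) refl _))) p
  ... | yes (s , s∈S , c , c≉0 , s∈) = project
    where
    module S = IsSubspace sub-S
    module B = IsSubspace (InSpan-isSubspace (tail b))
    open ≈-Reasoning
    S′ : Pred Carrierᴹ 0ℓ
    S′ v = v ∈ S × v ∈ InSpan (tail b)
    proj′ : Projectable S′
    proj′ = projectable (tail b) S′ (record
      { resp  = λ x≈y (p , q) → S.resp x≈y p , B.resp x≈y q
      ; zero∈ = S.zero∈ , B.zero∈
      ; add   = λ (p , q) (p′ , q′) → S.add p p′ , B.add q q′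
      ; scale = λ k (p , q) → S.scale k p , B.scale k q }) (λ _ → proj₂)
    c⁻¹ = proj₁ (*-inverse c c≉0)
    cc⁻¹≈1 = proj₂ (*-inverse c c≉0)
    decompose : ∀ t → t ∈ S → ∃[ κ ] (t -ᴹ κ *ₗ s) ∈ S′
    decompose t t∈S with S⊆ t t∈S
    ... | d , t∈ = d * c⁻¹ , S.sub t∈S (S.scale _ s∈S) ,
      B.resp (⟨⟩-injective λ z → begin
        ⟨ (t -ᴹ d *ₗ head b) -ᴹ (d * c⁻¹) *ₗ (s -ᴹ c *ₗ head b) , z ⟩
          ≈⟨ trans (⟨⟩--* _ _ _ _) (+-cong (⟨⟩--* _ _ _ _) (-‿cong (*-congˡ (⟨⟩--* _ _ _ _)))) ⟩
        (⟨ t , z ⟩ - d * ⟨ head b , z ⟩) - d * c⁻¹ * (⟨ s , z ⟩ - c * ⟨ head b , z ⟩)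
          ≈⟨ solve 6 (λ t d h i s c → (t :- d :* h) :- d :* i :* (s :- c :* h)
               := t :- d :* i :* s :+ (c :* i :- con (+ 1)) :* (d :* h)) refl
               ⟨ t , z ⟩ d ⟨ head b , z ⟩ c⁻¹ ⟨ s , z ⟩ c ⟩
        ⟨ t , z ⟩ - d * c⁻¹ * ⟨ s , z ⟩ + (c * c⁻¹ - (1# + 0#)) * (d * ⟨ head b , z ⟩)
          ≈⟨ +-congˡ (trans (*-congʳ (x≈y⇒x-y≈0 (trans cc⁻¹≈1 (sym (+-identityʳ 1#))))) (zeroˡ _)) ⟩
        ⟨ t , z ⟩ - d * c⁻¹ * ⟨ s , z ⟩ + 0#
          ≈⟨ trans (+-identityʳ _) (sym (⟨⟩--* _ _ _ _)) ⟩
        ⟨ t -ᴹ (d * c⁻¹) *ₗ s , z ⟩ ∎) (B.sub t∈ (B.scale _ s∈))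
    w₀ = proj₁ (proj′ s)
    w₀∈S′ = proj₁ (proj₂ (proj′ s))
    g = s -ᴹ w₀
    g⊥S′ : g ∈ OrthogonalComplement S′
    g⊥S′ = proj₂ (proj₂ (proj′ s))
    extend : ∀ {x} → x ∈ OrthogonalComplement S′ → ⟨ x , g ⟩ ≈ 0# → x ∈ OrthogonalComplement S
    extend {x} x⊥S′ x⊥g t t∈S = let κ , t′∈ = decompose t t∈S in begin
      ⟨ x , t ⟩
        ≈⟨ solve 4 (λ t κ s w → t := (t :- κ :* s) :+ κ :* ((s :- w) :+ w)) refl
             ⟨ x , t ⟩ κ ⟨ x , s ⟩ ⟨ x , w₀ ⟩ ⟩
      (⟨ x , t ⟩ - κ * ⟨ x , s ⟩) + κ * ((⟨ x , s ⟩ - ⟨ x , w₀ ⟩) + ⟨ x , w₀ ⟩)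
        ≈⟨ +-cong (trans (sym (trans (⟨⟩--ʳ t (κ *ₗ s) x) (+-congˡ (-‿cong (⟨⟩-*ʳ κ s x))))) (x⊥S′ (t -ᴹ κ *ₗ s) t′∈))
             (*-congˡ (+-cong (trans (sym (⟨⟩--ʳ s w₀ x)) x⊥g) (x⊥S′ w₀ w₀∈S′))) ⟩
      0# + κ * (0# + 0#)
        ≈⟨ solve 1 (λ κ → con (+ 0) :+ κ :* (con (+ 0) :+ con (+ 0)) := con (+ 0)) refl κ ⟩
      0# ∎
    project : Projectable S
    -- The list `b` may be dependent, so g may vanish; the projection onto S′ then already serves
    -- for S.
    project v with em {⟨ g , g ⟩ ≈ 0#}
    ... | yes gg≈0 = w , proj₁ w∈S′ , extend v⊥
          (trans (⟨,⟩-cong ≈ᴹ-refl (⟨,⟩-definite g gg≈0)) (⟨,0⟩ (v -ᴹ w)))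
      where
      w = proj₁ (proj′ v)
      w∈S′ = proj₁ (proj₂ (proj′ v))
      v⊥ = proj₂ (proj₂ (proj′ v))
    ... | no gg≉0 = w , S.add (proj₁ w′∈S′) (S.scale k (S.sub s∈S (proj₁ w₀∈S′))) ,
          extend (λ z z∈ → trans (expand z)
            (trans (+-cong (v⊥ z z∈) (-‿cong (trans (*-congˡ (g⊥S′ z z∈)) (zeroʳ k)))) (-‿inverseʳ 0#)))
            ⊥g
      where
      w′ = proj₁ (proj′ v)
      w′∈S′ = proj₁ (proj₂ (proj′ v))
      v⊥ = proj₂ (proj₂ (proj′ v))
      i = proj₁ (*-inverse ⟨ g , g ⟩ gg≉0)
      k = ⟨ v -ᴹ w′ , g ⟩ * i
      w = w′ +ᴹ k *ₗ g
      expand : ∀ z → ⟨ v -ᴹ w , z ⟩ ≈ ⟨ v -ᴹ w′ , z ⟩ - k * ⟨ g , z ⟩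
      expand z = begin
        ⟨ v -ᴹ w , z ⟩
          ≈⟨ trans (⟨⟩-- _ _ _) (+-congˡ (-‿cong (trans (⟨,⟩-+ _ _ _) (+-congˡ (⟨,⟩-* _ _ _))))) ⟩
        ⟨ v , z ⟩ - (⟨ w′ , z ⟩ + k * ⟨ g , z ⟩)
          ≈⟨ solve 3 (λ a b c → a :- (b :+ c) := a :- b :- c) refl ⟨ v , z ⟩ ⟨ w′ , z ⟩ (k * ⟨ g , z ⟩) ⟩
        ⟨ v , z ⟩ - ⟨ w′ , z ⟩ - k * ⟨ g , z ⟩  ≈⟨ +-congʳ (⟨⟩-- _ _ _) ⟨
        ⟨ v -ᴹ w′ , z ⟩ - k * ⟨ g , z ⟩ ∎
      ⊥g : ⟨ v -ᴹ w , g ⟩ ≈ 0#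
      ⊥g = begin
        ⟨ v -ᴹ w , g ⟩   ≈⟨ expand g ⟩
        ⟨ v -ᴹ w′ , g ⟩ - ⟨ v -ᴹ w′ , g ⟩ * i * ⟨ g , g ⟩
          ≈⟨ solve 3 (λ a i n → a :- a :* i :* n := a :- a :* (n :* i)) refl ⟨ v -ᴹ w′ , g ⟩ i ⟨ g , g ⟩ ⟩
        ⟨ v -ᴹ w′ , g ⟩ - ⟨ v -ᴹ w′ , g ⟩ * (⟨ g , g ⟩ * i)
          ≈⟨ +-congˡ (-‿cong (trans (*-congˡ (proj₂ (*-inverse ⟨ g , g ⟩ gg≉0))) (*-identityʳ _))) ⟩
        ⟨ v -ᴹ w′ , g ⟩ - ⟨ v -ᴹ w′ , g ⟩  ≈⟨ -‿inverseʳ _ ⟩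
        0# ∎

  -- An orthonormal basis of a space of dimension 1 or 2, padded with e₂ = 0 in
  -- dimension 1; hence the weakened normalisation of e₂.
  record Frame (E : Pred Carrierᴹ 0ℓ) : Set where
    field
      e₁ e₂  : Carrierᴹ
      e₁∈E⊥⊥   : ∀ {x} → (∀ y → y ∈ E → ⟨ y , x ⟩ ≈ 0#) → ⟨ e₁ , x ⟩ ≈ 0#
      e₂∈E⊥⊥   : ∀ {x} → (∀ y → y ∈ E → ⟨ y , x ⟩ ≈ 0#) → ⟨ e₂ , x ⟩ ≈ 0#
      e₁-unit : ⟨ e₁ , e₁ ⟩ ≈ 1#
      e₁⊥e₂  : ⟨ e₁ , e₂ ⟩ ≈ 0#
      e₂-unit : ∀ v → ⟨ v , e₂ ⟩ * ⟨ e₂ , e₂ ⟩ ≈ ⟨ v , e₂ ⟩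
      spans  : ∀ v → v ∈ E → ∃[ a ] ∃[ b ] v ≈ᴹ a *ₗ e₁ +ᴹ b *ₗ e₂

  normalise : ∀ g → ¬ (g ≈ᴹ 0ᴹ) → ∃[ k ] ∃[ l ] k * l ≈ 1# × k * k * ⟨ g , g ⟩ ≈ 1#
  normalise g g≉0 with *-inverse ‖ g ‖ (λ ‖g‖≈0 → g≉0 (⟨,⟩-definite g
    (trans (sym (‖‖-square g)) (trans (*-congʳ ‖g‖≈0) (zeroˡ _)))))
  ... | k , ‖g‖k≈1 = k , ‖ g ‖ , trans (*-comm _ _) ‖g‖k≈1 , (begin
    k * k * ⟨ g , g ⟩              ≈⟨ *-congˡ (‖‖-square g) ⟨
    k * k * (‖ g ‖ * ‖ g ‖)        ≈⟨ solve 2 (λ k n → k :* k :* (n :* n) := (n :* k) :* (n :* k)) refl k ‖ g ‖ ⟩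
    (‖ g ‖ * k) * (‖ g ‖ * k)      ≈⟨ *-cong ‖g‖k≈1 ‖g‖k≈1 ⟩
    1# * 1#                        ≈⟨ *-identityʳ 1# ⟩
    1#                             ∎)
    where open ≈-Reasoning

  frame₁ : ∀ {E} → HasDimension E 1 → Frame E
  frame₁ {E} (b , basis) = record
    { e₁ = e ; e₂ = 0ᴹ
    ; e₁∈E⊥⊥ = λ ⊥x → trans (⟨,⟩-* _ _ _) (trans (*-congˡ (⊥x g (members zero))) (zeroʳ k))
    ; e₂∈E⊥⊥ = λ _ → ⟨0,⟩ _
    ; e₁-unit = trans (⟨,⟩-* _ _ _) (trans (*-congˡ (⟨⟩-*ʳ _ _ _)) (trans (sym (*-assoc _ _ _)) kkgg≈1))
    ; e₁⊥e₂ = ⟨,0⟩ _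
    ; e₂-unit = λ v → trans (*-congʳ (⟨,0⟩ v)) (trans (zeroˡ _) (sym (⟨,0⟩ v)))
    ; spans = λ v v∈E → let c , v≈ = spanning v v∈E in
        head c * l , 0# , ≈ᴹ-trans v≈ (⟨⟩-injective λ z → begin
          ⟨ head c *ₗ g +ᴹ 0ᴹ , z ⟩
            ≈⟨ trans (⟨,⟩-+ _ _ _) (+-cong (⟨,⟩-* _ _ _) (⟨0,⟩ z)) ⟩
          head c * ⟨ g , z ⟩ + 0#
            ≈⟨ +-cong (trans (*-congˡ (sym (trans (*-congʳ kl≈1) (*-identityˡ _))))
                 (solve 4 (λ c k l g → c :* (k :* l :* g) := c :* l :* (k :* g)) refl (head c) k l ⟨ g , z ⟩))
                 (sym (zeroˡ _)) ⟩
          head c * l * (k * ⟨ g , z ⟩) + 0# * ⟨ 0ᴹ , z ⟩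
            ≈⟨ trans (⟨,⟩-+ _ _ _) (+-cong (trans (⟨,⟩-* _ _ _) (*-congˡ (⟨,⟩-* _ _ _))) (⟨,⟩-* _ _ _)) ⟨
          ⟨ (head c * l) *ₗ e +ᴹ 0# *ₗ 0ᴹ , z ⟩ ∎)
    }
    where
    open ≈-Reasoning
    open IsBasisOf basis
    g = b zero
    g≉0 : ¬ (g ≈ᴹ 0ᴹ)
    g≉0 g≈0 = 0≉1 (sym (independent (λ _ → 1#)
      (≈ᴹ-trans (+ᴹ-identityʳ _) (≈ᴹ-trans (*ₗ-identityˡ g) g≈0)) zero))
    normalised = normalise g g≉0
    k = proj₁ normalised
    l = proj₁ (proj₂ normalised)
    kl≈1 = proj₁ (proj₂ (proj₂ normalised))
    kkgg≈1 = proj₂ (proj₂ (proj₂ normalised))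
    e = k *ₗ g

  frame₂ : ∀ {E} → HasDimension E 2 → Frame E
  frame₂ {E} (b , basis) = record
    { e₁ = e ; e₂ = f
    ; e₁∈E⊥⊥ = λ ⊥x → e⊥ ⊥x
    ; e₂∈E⊥⊥ = λ ⊥x → trans (⟨,⟩-* _ _ _) (trans (*-congˡ (trans (⟨⟩--* _ _ _ _)
        (trans (+-cong (⊥x g₁ (members (suc zero))) (-‿cong (trans (*-congˡ (e⊥ ⊥x)) (zeroʳ _)))) (-‿inverseʳ 0#))))
        (zeroʳ k₂))
    ; e₁-unit = ee≈1
    ; e₁⊥e₂ = trans (⟨⟩-*ʳ _ _ _) (trans (*-congˡ eh≈0) (zeroʳ k₂))
    ; e₂-unit = λ v → trans (*-congˡ ff≈1) (*-identityʳ _)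
    ; spans = λ v v∈E → let c , v≈ = spanning v v∈E ; c₀ = c zero ; c₁ = c (suc zero) in
        c₀ * l + c₁ * ⟨ g₁ , e ⟩ , c₁ * l₂ , ≈ᴹ-trans v≈ (⟨⟩-injective λ z → begin
          ⟨ c₀ *ₗ g +ᴹ (c₁ *ₗ g₁ +ᴹ 0ᴹ) , z ⟩
            ≈⟨ trans (⟨,⟩-+ _ _ _) (+-cong (⟨,⟩-* _ _ _) (trans (⟨,⟩-+ _ _ _) (+-cong (⟨,⟩-* _ _ _) (⟨0,⟩ z)))) ⟩
          c₀ * ⟨ g , z ⟩ + (c₁ * ⟨ g₁ , z ⟩ + 0#)
            ≈⟨ solve 5 (λ a x c y t → a :* x :+ (c :* y :+ con (+ 0))
                 := a :* x :+ c :* t :+ c :* (y :- t)) refl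
                 c₀ ⟨ g , z ⟩ c₁ ⟨ g₁ , z ⟩ (⟨ g₁ , e ⟩ * ⟨ e , z ⟩) ⟩
          c₀ * ⟨ g , z ⟩ + c₁ * (⟨ g₁ , e ⟩ * ⟨ e , z ⟩) + c₁ * (⟨ g₁ , z ⟩ - ⟨ g₁ , e ⟩ * ⟨ e , z ⟩)
            ≈⟨ +-cong (+-congʳ (*-congˡ g≈)) (*-congˡ (trans (sym (⟨⟩--* g₁ ⟨ g₁ , e ⟩ e z)) h≈)) ⟩
          c₀ * (l * ⟨ e , z ⟩) + c₁ * (⟨ g₁ , e ⟩ * ⟨ e , z ⟩) + c₁ * (l₂ * ⟨ f , z ⟩)
            ≈⟨ solve 7 (λ a l e c q m f → a :* (l :* e) :+ c :* (q :* e) :+ c :* (m :* f)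
                 := (a :* l :+ c :* q) :* e :+ c :* m :* f) refl
                 c₀ l ⟨ e , z ⟩ c₁ ⟨ g₁ , e ⟩ l₂ ⟨ f , z ⟩ ⟩
          (c₀ * l + c₁ * ⟨ g₁ , e ⟩) * ⟨ e , z ⟩ + c₁ * l₂ * ⟨ f , z ⟩
            ≈⟨ trans (⟨,⟩-+ _ _ _) (+-cong (⟨,⟩-* _ _ _) (⟨,⟩-* _ _ _)) ⟨
          ⟨ (c₀ * l + c₁ * ⟨ g₁ , e ⟩) *ₗ e +ᴹ (c₁ * l₂) *ₗ f , z ⟩ ∎)
    }
    where
    open ≈-Reasoning
    open IsBasisOf basis
    g = b zero
    g₁ = b (suc zero)
    g≉0 : ¬ (g ≈ᴹ 0ᴹ)
    g≉0 g≈0 = 0≉1 (sym (independent (λ { zero → 1# ; (suc _) → 0# })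
      (≈ᴹ-trans (+ᴹ-cong (≈ᴹ-trans (*ₗ-identityˡ g) g≈0)
        (≈ᴹ-trans (+ᴹ-identityʳ _) (*ₗ-zeroˡ g₁))) (+ᴹ-identityʳ _)) zero))
    normalised = normalise g g≉0
    k = proj₁ normalised
    l = proj₁ (proj₂ normalised)
    kl≈1 = proj₁ (proj₂ (proj₂ normalised))
    e = k *ₗ g
    e⊥ : ∀ {x} → (∀ y → y ∈ E → ⟨ y , x ⟩ ≈ 0#) → ⟨ e , x ⟩ ≈ 0#
    e⊥ ⊥x = trans (⟨,⟩-* _ _ _) (trans (*-congˡ (⊥x g (members zero))) (zeroʳ k))
    rescale : ∀ {k l} g z → k * l ≈ 1# → ⟨ g , z ⟩ ≈ l * ⟨ k *ₗ g , z ⟩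
    rescale {k} {l} g z kl≈1 = sym (trans (*-congˡ (⟨,⟩-* _ _ _)) (trans (sym (*-assoc _ _ _))
      (trans (*-congʳ (trans (*-comm l k) kl≈1)) (*-identityˡ _))))
    g≈ : ∀ {z} → ⟨ g , z ⟩ ≈ l * ⟨ e , z ⟩
    g≈ {z} = rescale g z kl≈1
    ee≈1 : ⟨ e , e ⟩ ≈ 1#
    ee≈1 = trans (⟨,⟩-* _ _ _) (trans (*-congˡ (⟨⟩-*ʳ _ _ _))
      (trans (sym (*-assoc _ _ _)) (proj₂ (proj₂ (proj₂ normalised)))))
    h = g₁ -ᴹ ⟨ g₁ , e ⟩ *ₗ e
    eh≈0 : ⟨ e , h ⟩ ≈ 0#
    eh≈0 = trans (⟨,⟩-sym _ _) (trans (⟨⟩--* _ _ _ _)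
      (trans (+-congˡ (-‿cong (trans (*-congˡ ee≈1) (*-identityʳ _)))) (-‿inverseʳ _)))
    h≉0 : ¬ (h ≈ᴹ 0ᴹ)
    -- In terms of the basis, h = g₁ - (⟨g₁, e⟩ k) g, a combination with coefficient 1 at g₁.
    h≉0 h≈0 = 0≉1 (sym (independent (λ { zero → - (⟨ g₁ , e ⟩ * k) ; (suc _) → 1# })
      (≈ᴹ-trans (⟨⟩-injective λ z → begin
        ⟨ (- (⟨ g₁ , e ⟩ * k)) *ₗ g +ᴹ (1# *ₗ g₁ +ᴹ 0ᴹ) , z ⟩
          ≈⟨ trans (⟨,⟩-+ _ _ _) (+-cong (⟨,⟩-* _ _ _) (trans (⟨,⟩-+ _ _ _)
               (+-cong (trans (⟨,⟩-* _ _ _) (*-identityˡ _)) (⟨0,⟩ z)))) ⟩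
        (- (⟨ g₁ , e ⟩ * k)) * ⟨ g , z ⟩ + (⟨ g₁ , z ⟩ + 0#)
          ≈⟨ solve 4 (λ q k x y → (:- (q :* k)) :* x :+ (y :+ con (+ 0)) := y :- q :* (k :* x)) refl
               ⟨ g₁ , e ⟩ k ⟨ g , z ⟩ ⟨ g₁ , z ⟩ ⟩
        ⟨ g₁ , z ⟩ - ⟨ g₁ , e ⟩ * (k * ⟨ g , z ⟩)
          ≈⟨ trans (⟨⟩--* _ _ _ _) (+-congˡ (-‿cong (*-congˡ (⟨,⟩-* _ _ _)))) ⟨
        ⟨ h , z ⟩ ∎) h≈0) (suc zero)))
    normalised₂ = normalise h h≉0
    k₂ = proj₁ normalised₂
    l₂ = proj₁ (proj₂ normalised₂)
    f = k₂ *ₗ h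
    h≈ : ∀ {z} → ⟨ h , z ⟩ ≈ l₂ * ⟨ f , z ⟩
    h≈ {z} = rescale h z (proj₁ (proj₂ (proj₂ normalised₂)))
    ff≈1 : ⟨ f , f ⟩ ≈ 1#
    ff≈1 = trans (⟨,⟩-* _ _ _) (trans (*-congˡ (⟨⟩-*ʳ _ _ _))
      (trans (sym (*-assoc _ _ _)) (proj₂ (proj₂ (proj₂ normalised₂)))))

-- Heights of returns

module Multiples (X : AbelianGroup 0ℓ 0ℓ) where

  open AbelianGroup X
  open Algebra.Properties.AbelianGroup X
    using (⁻¹-∙-comm; ⁻¹-anti-homo‿-; ε⁻¹≈ε)
  open Algebra.Properties.CommutativeSemigroup commutativeSemigroup using (interchange)
  open Algebra.Properties.Monoid.Mult monoid public using (×-homo-+) renaming (_×_ to infixr 8 _·_)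
  open Relation.Binary.Reasoning.Setoid setoid

  -ε : ∀ a → a - ε ≈ a
  -ε a = trans (∙-congˡ ε⁻¹≈ε) (identityʳ a)

  -∙- : ∀ a b c d → (a - b) ∙ (c - d) ≈ (a ∙ c) - (b ∙ d)
  -∙- a b c d = trans (interchange a (b ⁻¹) c (d ⁻¹)) (∙-congˡ (⁻¹-∙-comm b d))

  multiple-∙ : ∀ α g h a b c d → g ≈ a · α - b · α → h ≈ c · α - d · α →
               g ∙ h ≈ (a ℕ.+ c) · α - (b ℕ.+ d) · α
  multiple-∙ α g h a b c d p q = trans (∙-cong p q) (trans (-∙- _ _ _ _)
    (∙-cong (sym (×-homo-+ α a c)) (⁻¹-cong (sym (×-homo-+ α b d)))))

  multiple-⁻¹ : ∀ α g a b → g ≈ a · α - b · α → g ⁻¹ ≈ b · α - a · α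
  multiple-⁻¹ α g a b p = trans (⁻¹-cong p) (⁻¹-anti-homo‿- _ _)

  multiple-cancel : ∀ α g k b → g ≈ (k ℕ.+ b) · α - b · α → g ≈ k · α
  multiple-cancel α g k b p = begin
    g                                 ≈⟨ p ⟩
    (k ℕ.+ b) · α - b · α             ≈⟨ ∙-congʳ (×-homo-+ α k b) ⟩
    (k · α ∙ b · α) - b · α           ≈⟨ assoc _ _ _ ⟩
    k · α ∙ (b · α - b · α)           ≈⟨ ∙-congˡ (inverseʳ _) ⟩
    k · α ∙ ε                         ≈⟨ identityʳ _ ⟩
    k · α                             ∎

  multiple-0 : ∀ α g a → g ≈ a · α → g ≈ a · α - 0 · α
  multiple-0 α g a p = trans p (sym (-ε _))

  -ε-- : ∀ a l → l ≈ ε → (a - ε) - l ≈ a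
  -ε-- a l l≈ε = trans (∙-cong (-ε a) (⁻¹-cong l≈ε)) (-ε a)

  -ε-≈ε : ∀ a b → b ≈ a → (a - ε) - b ≈ ε
  -ε-≈ε a b b≈a = trans (∙-cong (-ε a) (⁻¹-cong b≈a)) (inverseʳ a)

  -ε-cancel : ∀ a b → (a - ε) - ((a - ε) - b) ≈ b
  -ε-cancel a b = trans (∙-congˡ (⁻¹-anti-homo‿- _ _))
    (trans (∙-congˡ (comm _ _)) (trans (sym (assoc _ _ _))
    (trans (∙-congʳ (inverseʳ _)) (identityˡ b))))

-- M a b x says that x is the relevant real part of a representative of
-- (a - b) α; as heights are natural numbers, differences are kept as pairs.
module Heights (em : ExcludedMiddle 0ℓ) (ℝ : CompleteOrderedField)
  (T : CompleteOrderedField.Carrier ℝ) where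

  open OrderedField em ℝ
  open Plane em ℝ
  open Radius T

  module _ (M : ℕ → ℕ → ℝ² → Set)
    (M-⊕ : ∀ {a b c d x y} → M a b x → M c d y → M (a ℕ.+ c) (b ℕ.+ d) (x ⊕ y))
    (M-⊖ : ∀ {a b c d x y} → M a b x → M c d y → M (a ℕ.+ d) (b ℕ.+ c) (x ⊖ y))
    (p : ℕ)
    (gap : ∀ {a b x} → M a b x → a ≢ b → a ℕ.< b ℕ.+ p → b ℕ.< a ℕ.+ p → T ≤ N x)
    {k : ℕ} (h : Fin k → ℕ) (v : Fin k → ℝ²) (M-v : ∀ i → M (h i) 0 (v i))
    (short : ∀ i → Short (v i))
    (h-injective : ∀ {i j} → i ≢ j → h i ≢ h j)
    (p≤h : ∀ i → p ℕ.≤ h i) (h<2p : ∀ i → h i ℕ.< p ℕ.+ p) where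

    private
      near : ∀ i j → h i ℕ.< h j ℕ.+ p
      near i j = ℕₚ.<-≤-trans (h<2p i) (ℕₚ.+-monoˡ-≤ p (p≤h j))

    far : ∀ {i j} → i ≢ j → Far (v i) (v j)
    far {i} {j} i≢j = gap (M-⊖ (M-v i) (M-v j))
      (λ e → h-injective i≢j (≡.trans (≡.sym (ℕₚ.+-identityʳ _)) e))
      (≡.subst (ℕ._< h j ℕ.+ p) (≡.sym (ℕₚ.+-identityʳ _)) (near i j))
      (≡.subst (λ z → h j ℕ.< z ℕ.+ p) (≡.sym (ℕₚ.+-identityʳ (h i))) (near j i))

    open Pentagon v short far

    -- The corner z at the highest vertex t has height h w + h q - h t, which is
    -- below 2p; z and its differences with the two far vertices are short.
    no-pentagon : ∀ {t i j l m} → Unique (t ∷ i ∷ j ∷ l ∷ m ∷ []) →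
      (∀ i → i ≢ t → h i ℕ.< h t) → ⊥
    no-pentagon {t} u top with cyclic-order u
    ... | q , r , s , w ,
          ((t≢q ∷ t≢r ∷ t≢s ∷ t≢w ∷ []) ∷ (q≢r ∷ q≢s ∷ q≢w ∷ []) ∷ (r≢s ∷ r≢w ∷ []) ∷ (s≢w ∷ []) ∷ [] ∷ []) ,
          cyc = h-injective r≢s (ℕₚ.+-cancelˡ-≡ _ _ _ (≡.trans (≡.sym (same (far-from r) (alternating-short center)))
            (same (far-from s) (alternating-short′ center))))
      where
      center = rotate (rotate (rotate (rotate cyc)))
      z = (v w ⊕ v q) ⊖ v t
      Mz : M ((h w ℕ.+ h q) ℕ.+ 0) ((0 ℕ.+ 0) ℕ.+ h t) z
      Mz = M-⊖ (M-⊕ (M-v w) (M-v q)) (M-v t)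
      H = h w ℕ.+ h q ℕ.+ 0
      H≡ : H ≡ h w ℕ.+ h q
      H≡ = ℕₚ.+-identityʳ _
      h-t<H : h t ℕ.< H
      h-t<H = ≡.subst (h t ℕ.<_) (≡.sym H≡) (ℕₚ.<-≤-trans (h<2p t) (ℕₚ.+-mono-≤ (p≤h w) (p≤h q)))
      -- A height of z strictly between 0 and p would make z long.
      high : h t ℕ.+ p ℕ.≤ H
      high = ℕₚ.≮⇒≥ λ low → ≤⇒≯ (gap Mz (≢-sym (ℕₚ.<⇒≢ h-t<H)) low
        (ℕₚ.<-≤-trans h-t<H (ℕₚ.m≤m+n H p))) (corner-short center)
      far-from : ∀ j → M (H ℕ.+ 0) (h t ℕ.+ h j) (z ⊖ v j)
      far-from j = M-⊖ Mz (M-v j)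
      -- The heights of z and of vertex j differ by less than p. From above, h w < h t because t is
      -- the highest, and h q < h j + p; from below, h t + h j < h t + 2p ≤ H + p. As the difference
      -- of the vectors is short, the heights must coincide.
      same : ∀ {j} → M (H ℕ.+ 0) (h t ℕ.+ h j) (z ⊖ v j) → Short (z ⊖ v j) → H ℕ.+ 0 ≡ h t ℕ.+ h j
      same {j} Mzj sh with (H ℕ.+ 0) ℕₚ.≟ (h t ℕ.+ h j)
      ... | yes e = e
      ... | no  e = ⊥-elim (≤⇒≯ (gap Mzj e
        (≡.subst₂ ℕ._<_ (≡.sym (≡.trans (ℕₚ.+-identityʳ H) H≡)) (≡.sym (ℕₚ.+-assoc (h t) (h j) p))
          (ℕₚ.+-mono-< (top w (≢-sym t≢w)) (near q j)))
        (≡.subst (λ y → h t ℕ.+ h j ℕ.< y ℕ.+ p) (≡.sym (ℕₚ.+-identityʳ H))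
          (ℕₚ.<-≤-trans (ℕₚ.+-monoʳ-< (h t) (h<2p j))
            (≡.subst (ℕ._≤ H ℕ.+ p) (ℕₚ.+-assoc (h t) p p) (ℕₚ.+-monoˡ-≤ p high)))))
        sh)

    no-parallel : ∀ {i j l} → i ≢ j → i ≢ l → j ≢ l → (∀ i j → v i ⨯ v j ≈ 0#) → ⊥
    no-parallel i≢j i≢l j≢l ∥ = no-three-parallel (short _) (short _) (short _)
      (far i≢j) (far i≢l) (far j≢l) (∥ _ _) (∥ _ _) (∥ _ _)

-- Best returns in the quotient

module BestReturns (em : ExcludedMiddle 0ℓ) {ℝ : CompleteOrderedField}
  {V : InnerProductSpace ℝ} {U : UltrametricGroup ℝ} (Λ : ClosedSubgroup V U)
  (α : AbelianGroup.Carrier (Quotient Λ)) where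

  open OrderedField em ℝ

  returns-positive : ∀ {n q} → BestReturn Λ α n q → 1 ℕ.≤ n × 1 ℕ.≤ q
  returns-positive first = ℕₚ.≤-refl , ℕₚ.≤-refl
  returns-positive (next b ((q<q′ , _) , _)) = ℕ.s≤s ℕ.z≤n , ℕₚ.≤-trans (ℕ.s≤s ℕ.z≤n) q<q′

  returns-unique : ∀ {n q q′} → BestReturn Λ α n q → BestReturn Λ α n q′ → q ≡ q′
  returns-unique first first = ≡.refl
  returns-unique first (next b _) with () ← proj₁ (returns-positive b)
  returns-unique (next b _) first with () ← proj₁ (returns-positive b)
  returns-unique (next b (p , least)) (next b′ (p′ , least′)) with ≡.refl ← returns-unique b b′ =
    ℕₚ.≤-antisym (least _ p′) (least′ _ p)

  returns-below : ∀ {n q k} → BestReturn Λ α n q → 1 ℕ.≤ k → k ℕ.≤ n → ∃[ q′ ] BestReturn Λ α k q′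
  returns-below b 1≤k k≤n with ℕₚ.m≤n⇒m<n∨m≡n k≤n
  returns-below b 1≤k k≤n | inj₂ ≡.refl = _ , b
  returns-below first (ℕ.s≤s _) _ | inj₁ (ℕ.s≤s ())
  returns-below (next b _) 1≤k _ | inj₁ (ℕ.s≤s k≤n) = returns-below b 1≤k k≤n

  returns-increasing : ∀ {m n q q′} → BestReturn Λ α m q → BestReturn Λ α n q′ → m ℕ.< n →
                       q ℕ.< q′ × ρ Λ α q′ < ρ Λ α q
  returns-increasing b first (ℕ.s≤s ℕ.z≤n) with () ← proj₁ (returns-positive b)
  returns-increasing b (next b′ ((q<q′ , ρ<) , _)) (ℕ.s≤s m≤n) with ℕₚ.m≤n⇒m<n∨m≡n m≤n
  ... | inj₂ ≡.refl with ≡.refl ← returns-unique b b′ = q<q′ , ρ<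
  ... | inj₁ m<n with returns-increasing b b′ m<n
  ...   | q<q₁ , ρ<₁ = ℕₚ.<-trans q<q₁ q<q′ , <-trans ρ< ρ<₁

  returns-monotone : ∀ {m n q q′} → BestReturn Λ α m q → BestReturn Λ α n q′ → m ℕ.≤ n → q ℕ.≤ q′
  returns-monotone b b′ m≤n with ℕₚ.m≤n⇒m<n∨m≡n m≤n
  ... | inj₁ m<n    = ℕₚ.<⇒≤ (proj₁ (returns-increasing b b′ m<n))
  ... | inj₂ ≡.refl = ℕₚ.≤-reflexive (returns-unique b b′)

  -- Proved together with `best-next`: that bound for the previous term, followed by the strict
  -- drop, yields `best`, while `best-next` uses `best` below q and the minimality of the next term
  -- beyond q.
  best : ∀ {n q} → BestReturn Λ α n q → ∀ r → 1 ℕ.≤ r → r ℕ.< q → ρ Λ α q < ρ Λ α r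
  best-next : ∀ {n q q′} → BestReturn Λ α n q → BestReturn Λ α (suc n) q′ →
              ∀ r → 1 ℕ.≤ r → r ℕ.< q′ → ρ Λ α q ≤ ρ Λ α r

  best first r 1≤r r<1 = ⊥-elim (ℕₚ.<⇒≱ r<1 1≤r)
  best b@(next b′ ((_ , ρ<) , _)) r 1≤r r<q = <-≤-trans ρ< (best-next b′ b r 1≤r r<q)

  best-next b first r 1≤r r<1 = ⊥-elim (ℕₚ.<⇒≱ r<1 1≤r)
  best-next b (next b′ (_ , least)) r 1≤r r<q′ with ≡.refl ← returns-unique b b′ with ℕₚ.<-cmp r _
  ... | tri< r<q _ _ = <⇒≤ (best b r 1≤r r<q)
  ... | tri≈ _ ≡.refl _ = ≤-refl
  ... | tri> _ _ q<r = ≮⇒≥ λ ρ< → ℕₚ.<⇒≱ r<q′ (least r (q<r , ρ<))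

module Ultrametric (em : ExcludedMiddle 0ℓ) {ℝ : CompleteOrderedField} (U : UltrametricGroup ℝ) where

  open OrderedField em ℝ using (_<_; ≤-<-trans; <-respˡ; ⊔-lub-<)
  private module ℝ = OrderedField em ℝ
  open UltrametricGroup U
  open IsGeneralMetric isUltrametric using (triangle)
    renaming (cong to dist-cong; sym to dist-sym)

  ∣∣-cong : ∀ {x y} → x ≈ y → ∣ x ∣ ℝ.≈ ∣ y ∣
  ∣∣-cong p = dist-cong p refl

  ∣∣-∙-< : ∀ {x y r} → ∣ x ∣ < r → ∣ y ∣ < r → ∣ x ∙ y ∣ < r
  ∣∣-∙-< {x} {y} ∣x∣<r ∣y∣<r = ≤-<-trans (triangle (x ∙ y) y ε)
    (⊔-lub-< (<-respˡ (ℝ.trans (ℝ.sym translationInvariant) (dist-cong refl (identityˡ y))) ∣x∣<r) ∣y∣<r)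

  ∣∣-⁻¹ : ∀ x → ∣ x ⁻¹ ∣ ℝ.≈ ∣ x ∣
  ∣∣-⁻¹ x = ℝ.trans (ℝ.sym translationInvariant)
    (ℝ.trans (dist-cong (inverseˡ x) (identityˡ x)) (dist-sym ε x))

module QuotientNorm (em : ExcludedMiddle 0ℓ) {ℝ : CompleteOrderedField}
  {V : InnerProductSpace ℝ} {U : UltrametricGroup ℝ} (Λ : ClosedSubgroup V U)
  (α : AbelianGroup.Carrier (Quotient Λ)) where

  open OrderedField em ℝ
  open Ultrametric em U
  private
    module V = Space em V
    module G = AbelianGroup (productGroup V U)
    module X = AbelianGroup (Quotient Λ)
    module MX = Multiples (Quotient Λ)
    module MG = Multiples (productGroup V U)
    module Λ = ClosedSubgroup Λ

  _·α : ℕ → X.Carrier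
  k ·α = multiple X.rawMonoid k α

  ‖‖-cong : ∀ {v w} → v V.≈ᴹ w → V.‖ v ‖ ≈ V.‖ w ‖
  ‖‖-cong {v} {w} v≈w = ²-injective (V.‖‖-nonNeg v) (V.‖‖-nonNeg w)
    (trans (V.‖‖-square v) (trans (V.⟨,⟩-cong v≈w v≈w) (sym (V.‖‖-square w))))

  productNorm-cong : ∀ {a b} → a G.≈ b → productNorm V U a ≈ productNorm V U b
  productNorm-cong (v≈ , u≈) = ⊔-cong (‖‖-cong v≈) (∣∣-cong u≈)

  ρ-isInfimum : ∀ k → IsInfimum (DistancesToΛ Λ ((k ·α) X.- X.ε)) (ρ Λ α k)
  ρ-isInfimum k = proj₂ (complete _ _ _)

  ∈Λ⇒≈ε : ∀ l → l ∈ Λ.Member → l X.≈ X.ε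
  ∈Λ⇒≈ε l = Λ.respects (G.sym (MG.-ε l))

  ≈ε⇒∈Λ : ∀ l → l X.≈ X.ε → l ∈ Λ.Member
  ≈ε⇒∈Λ l = Λ.respects (MG.-ε l)

  ρ≤ : ∀ k a → a X.≈ (k ·α) → ρ Λ α k ≤ productNorm V U a
  ρ≤ k a a≈kα = proj₁ (ρ-isInfimum k) _
    ( (k ·α G.- G.ε) G.- a
    , ≈ε⇒∈Λ ((k ·α G.- G.ε) G.- a) (MX.-ε-≈ε (k ·α) a a≈kα)
    , sym (productNorm-cong {(k ·α G.- G.ε) G.- ((k ·α G.- G.ε) G.- a)} {a} (MG.-ε-cancel (k ·α) a)))

  0≤ρ : ∀ k → 0# ≤ ρ Λ α k
  0≤ρ k = proj₂ (ρ-isInfimum k) 0# λ x (l , _ , x≈) →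
    ≤-respʳ (sym x≈) (productNorm-nonNeg V U (((k ·α) X.- X.ε) G.- l))

  ρ<⇒representative : ∀ k {r} → ρ Λ α k < r → ∃[ a ] a X.≈ (k ·α) × productNorm V U a < r
  ρ<⇒representative k {r} ρ<r with em {∃[ a ] a X.≈ (k ·α) × productNorm V U a < r}
  ... | yes p = p
  ... | no none = ⊥-elim (≤⇒≯ (proj₂ (ρ-isInfimum k) r (λ x (l , l∈Λ , x≈) →
    ≤-respʳ (sym x≈) (≮⇒≥ λ short → none
      ((k ·α G.- G.ε) G.- l , MX.-ε-- (k ·α) l (∈Λ⇒≈ε l l∈Λ) , short)))) ρ<r)

-- Splitting representatives along the line space and the effective space

module Decomposition (em : ExcludedMiddle 0ℓ) {ℝ : CompleteOrderedField}
  {V : InnerProductSpace ℝ} {U : UltrametricGroup ℝ} (Λ : ClosedSubgroup V U)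
  {d : ℕ} (dimension : DimensionOf V d) (α : AbelianGroup.Carrier (Quotient Λ))
  (frame : Space.Frame em V (EffectiveSpace Λ)) where

  open OrderedField em ℝ
  open Plane em ℝ using (ℝ²; N)
  open Space em V
  open Frame frame
  open QuotientNorm em Λ α using (_·α)
  private
    module U = UltrametricGroup U
    module X = AbelianGroup (Quotient Λ)
    module Λ = ClosedSubgroup Λ
  open ≈-Reasoning

  W : Pred Carrierᴹ 0ℓ
  W = LineSpace Λ

  W-isSubspace : IsSubspace W
  W-isSubspace = record
    { resp  = λ x≈y x∈W t → Λ.respects (*ₗ-congˡ x≈y , U.refl) (x∈W t)
    ; zero∈ = λ t → Λ.respects (≈ᴹ-sym (*ₗ-zeroʳ t) , U.refl) Λ.ε-closed
    ; add   = λ {x} {y} x∈W y∈W t → Λ.respects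
        (≈ᴹ-sym (*ₗ-distribˡ t x y) , U.identityˡ U.ε) (Λ.∙-closed (x∈W t) (y∈W t))
    ; scale = λ c {x} x∈W t → Λ.respects (*ₗ-assoc t c x , U.refl) (x∈W (t * c))
    }

  projectable-W : Projectable W
  projectable-W = projectable (proj₁ dimension) W W-isSubspace λ v _ →
    let c , v≈ = IsBasisOf.spanning (proj₂ dimension) v _ in
    IsSubspace.resp (InSpan-isSubspace (proj₁ dimension)) (≈ᴹ-sym v≈)
      (linearCombination∈InSpan c (proj₁ dimension))

  E⊥W : ∀ {w} → w ∈ W → ∀ y → y ∈ EffectiveSpace Λ → ⟨ y , w ⟩ ≈ 0#
  E⊥W {w} w∈W y (n , c , b , b∈ , y≈) = trans (⟨,⟩-cong y≈ ≈ᴹ-refl)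
    (combination c b λ i → proj₁ (proj₂ (proj₂ (proj₂ (b∈ i)))) w w∈W)
    where
    combination : ∀ {n} (c : Vector Carrier n) b → (∀ i → ⟨ b i , w ⟩ ≈ 0#) →
                  ⟨ linearCombination c b , w ⟩ ≈ 0#
    combination {zero}  c b ⊥w = ⟨0,⟩ w
    combination {suc n} c b ⊥w = trans (⟨,⟩-+ _ _ _) (trans
      (+-cong (trans (⟨,⟩-* _ _ _) (trans (*-congˡ (⊥w zero)) (zeroʳ _))) (combination (c ∘ suc) (b ∘ suc) (⊥w ∘ suc)))
      (+-identityˡ 0#))

  coordinates : Carrierᴹ → ℝ²
  coordinates v = ⟨ v , e₁ ⟩ , ⟨ v , e₂ ⟩

  private
    -- `f` is the component of `αᵥ` orthogonal to both the line space and the effective space. Real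
    -- parts of elements of Λ lie in the sum of these two spaces, so every representative of kα has
    -- the same component k f.
    αᵥ wα α′ f : Carrierᴹ
    αᵥ = proj₁ α
    wα = proj₁ (projectable-W αᵥ)
    α′ = αᵥ -ᴹ wα
    A = ⟨ α′ , e₁ ⟩
    B = ⟨ α′ , e₂ ⟩
    f = (α′ -ᴹ A *ₗ e₁) -ᴹ B *ₗ e₂

    ⟨f,⟩ : ∀ z → ⟨ f , z ⟩ ≈ ⟨ α′ , z ⟩ - A * ⟨ e₁ , z ⟩ - B * ⟨ e₂ , z ⟩
    ⟨f,⟩ z = trans (⟨⟩--* _ _ _ _) (+-congʳ (⟨⟩--* _ _ _ _))

    e₂⊥e₁ : ⟨ e₂ , e₁ ⟩ ≈ 0#
    e₂⊥e₁ = trans (⟨,⟩-sym _ _) e₁⊥e₂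

    f⊥e₁ : ⟨ f , e₁ ⟩ ≈ 0#
    f⊥e₁ = begin
      ⟨ f , e₁ ⟩                                 ≈⟨ ⟨f,⟩ e₁ ⟩
      A - A * ⟨ e₁ , e₁ ⟩ - B * ⟨ e₂ , e₁ ⟩      ≈⟨ +-cong (+-congˡ (-‿cong (trans (*-congˡ e₁-unit) (*-identityʳ A))))
                                                     (-‿cong (trans (*-congˡ e₂⊥e₁) (zeroʳ B))) ⟩
      A - A - 0#                                 ≈⟨ solve 1 (λ A → A :- A :- con (+ 0) := con (+ 0)) refl A ⟩
      0#                                         ∎

    f⊥e₂ : ⟨ f , e₂ ⟩ ≈ 0#
    f⊥e₂ = begin
      ⟨ f , e₂ ⟩                                 ≈⟨ ⟨f,⟩ e₂ ⟩
      B - A * ⟨ e₁ , e₂ ⟩ - B * ⟨ e₂ , e₂ ⟩      ≈⟨ +-cong (+-congˡ (-‿cong (trans (*-congˡ e₁⊥e₂) (zeroʳ A))))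
                                                     (-‿cong (e₂-unit α′)) ⟩
      B - 0# - B                                 ≈⟨ solve 1 (λ B → B :- con (+ 0) :- B := con (+ 0)) refl B ⟩
      0#                                         ∎

    ⊥W : ∀ {w} → w ∈ W → ⟨ e₁ , w ⟩ ≈ 0# × ⟨ e₂ , w ⟩ ≈ 0# × ⟨ f , w ⟩ ≈ 0#
    ⊥W {w} w∈W = e₁w , e₂w , (begin
      ⟨ f , w ⟩                                      ≈⟨ ⟨f,⟩ w ⟩
      ⟨ α′ , w ⟩ - A * ⟨ e₁ , w ⟩ - B * ⟨ e₂ , w ⟩
        ≈⟨ +-cong (+-cong (proj₂ (proj₂ (projectable-W αᵥ)) w w∈W) (-‿cong (*-congˡ e₁w))) (-‿cong (*-congˡ e₂w)) ⟩
      0# - A * 0# - B * 0#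
        ≈⟨ solve 2 (λ A B → con (+ 0) :- A :* con (+ 0) :- B :* con (+ 0) := con (+ 0)) refl A B ⟩
      0# ∎)
      where
      e₁w = e₁∈E⊥⊥ (E⊥W w∈W)
      e₂w = e₂∈E⊥⊥ (E⊥W w∈W)

    ⟨·α,⟩ : ∀ k z → ⟨ proj₁ (k ·α) , z ⟩ ≈ k · 1# * ⟨ αᵥ , z ⟩
    ⟨·α,⟩ zero    z = trans (⟨0,⟩ z) (sym (zeroˡ _))
    ⟨·α,⟩ (suc k) z = trans (⟨,⟩-+ _ _ _) (trans (+-congˡ (⟨·α,⟩ k z))
      (trans (solve 2 (λ k a → a :+ k :* a := (con (+ 1) :+ k) :* a) refl (k · 1#) ⟨ αᵥ , z ⟩)
        (*-congʳ (+-congʳ (+-identityʳ 1#)))))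

  residue : Carrier
  residue = ⟨ f , f ⟩

  0≤residue : 0# ≤ residue
  0≤residue = ⟨,⟩-nonNeg f

  -- v is the orthogonal sum of w, of a part in the effective space, and of k f.
  decomposition : ∀ k v u → (v , u) X.≈ (k ·α) →
    ∃[ w ] w ∈ W × ⟨ v -ᴹ w , v -ᴹ w ⟩ ≈ N (coordinates v) + k · 1# * (k · 1#) * residue
                 × N (coordinates v) + k · 1# * (k · 1#) * residue ≤ ⟨ v , v ⟩
  decomposition k v u v∈ = w , w∈W , rr≈ ,
    ≤-respʳ (sym vv≈) (≤-respˡ (+-identityʳ _) (≤-respˡ (+-congʳ rr≈) (+-monoʳ-≤ ⟨ r , r ⟩ (⟨,⟩-nonNeg w))))
    where
    K = k · 1#
    l = v -ᴹ proj₁ (k ·α)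
    wl = proj₁ (projectable-W l)
    wl∈W = proj₁ (proj₂ (projectable-W l))
    p = l -ᴹ wl
    p∈E : p ∈ EffectiveSpace Λ
    p∈E = 1 , (λ _ → 1#) , (λ _ → p) ,
      (λ _ → l , _ , v∈ , proj₂ (proj₂ (projectable-W l)) ,
        IsSubspace.resp W-isSubspace (⟨⟩-injective λ z → sym (begin
          ⟨ l -ᴹ p , z ⟩                  ≈⟨ trans (⟨⟩-- _ _ _) (+-congˡ (-‿cong (⟨⟩-- _ _ _))) ⟩
          ⟨ l , z ⟩ - (⟨ l , z ⟩ - ⟨ wl , z ⟩)
            ≈⟨ solve 2 (λ l w → l :- (l :- w) := w) refl ⟨ l , z ⟩ ⟨ wl , z ⟩ ⟩
          ⟨ wl , z ⟩                      ∎)) wl∈W) ,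
      ≈ᴹ-sym (≈ᴹ-trans (+ᴹ-identityʳ _) (*ₗ-identityˡ p))
    a = proj₁ (spans p p∈E)
    b = proj₁ (proj₂ (spans p p∈E))
    p≈ = proj₂ (proj₂ (spans p p∈E))
    -- v is the real part of kα plus that of an element l of Λ; w collects the line components of
    -- both.
    w = wl +ᴹ K *ₗ wα
    w∈W : w ∈ W
    w∈W = IsSubspace.add W-isSubspace wl∈W
      (IsSubspace.scale W-isSubspace K (proj₁ (proj₂ (projectable-W αᵥ))))
    r = v -ᴹ w
    a′ = a + K * A
    b′ = b + K * B
    ⟨r,⟩ : ∀ z → ⟨ r , z ⟩ ≈ a′ * ⟨ e₁ , z ⟩ + b′ * ⟨ e₂ , z ⟩ + K * ⟨ f , z ⟩
    ⟨r,⟩ z = begin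
      ⟨ r , z ⟩
        ≈⟨ trans (⟨⟩-- _ _ _) (+-congˡ (-‿cong (trans (⟨,⟩-+ _ _ _) (+-congˡ (⟨,⟩-* _ _ _))))) ⟩
      ⟨ v , z ⟩ - (⟨ wl , z ⟩ + K * ⟨ wα , z ⟩)
        ≈⟨ solve 5 (λ v w K x m → v :- (w :+ K :* x) := (v :- m :- w) :+ (m :- K :* x)) refl
             ⟨ v , z ⟩ ⟨ wl , z ⟩ K ⟨ wα , z ⟩ (K * ⟨ αᵥ , z ⟩) ⟩
      (⟨ v , z ⟩ - K * ⟨ αᵥ , z ⟩ - ⟨ wl , z ⟩) + (K * ⟨ αᵥ , z ⟩ - K * ⟨ wα , z ⟩)
        ≈⟨ +-congʳ (trans (sym ⟨p,z⟩) (trans (⟨,⟩-cong p≈ ≈ᴹ-refl)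
             (trans (⟨,⟩-+ _ _ _) (+-cong (⟨,⟩-* _ _ _) (⟨,⟩-* _ _ _))))) ⟩
      (a * ⟨ e₁ , z ⟩ + b * ⟨ e₂ , z ⟩) + (K * ⟨ αᵥ , z ⟩ - K * ⟨ wα , z ⟩)
        ≈⟨ solve 9 (λ a x b y K m w A B →
             (a :* x :+ b :* y) :+ (K :* m :- K :* w)
             := (a :+ K :* A) :* x :+ (b :+ K :* B) :* y :+ K :* (m :- w :- A :* x :- B :* y)) refl
             a ⟨ e₁ , z ⟩ b ⟨ e₂ , z ⟩ K ⟨ αᵥ , z ⟩ ⟨ wα , z ⟩ A B ⟩
      a′ * ⟨ e₁ , z ⟩ + b′ * ⟨ e₂ , z ⟩
        + K * (⟨ αᵥ , z ⟩ - ⟨ wα , z ⟩ - A * ⟨ e₁ , z ⟩ - B * ⟨ e₂ , z ⟩)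
        ≈⟨ +-congˡ (*-congˡ (trans (⟨f,⟩ z) (+-congʳ (+-congʳ (⟨⟩-- _ _ _))))) ⟨
      a′ * ⟨ e₁ , z ⟩ + b′ * ⟨ e₂ , z ⟩ + K * ⟨ f , z ⟩ ∎
      where
      ⟨p,z⟩ : ⟨ p , z ⟩ ≈ ⟨ v , z ⟩ - K * ⟨ αᵥ , z ⟩ - ⟨ wl , z ⟩
      ⟨p,z⟩ = trans (⟨⟩-- _ _ _) (+-congʳ (trans (⟨⟩-- _ _ _) (+-congˡ (-‿cong (⟨·α,⟩ k z)))))
    r⊥W : ∀ {w} → w ∈ W → ⟨ r , w ⟩ ≈ 0#
    r⊥W {w} w∈ with ⊥W w∈
    ... | e₁w , e₂w , fw = trans (⟨r,⟩ w) (trans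
      (+-cong (+-cong (*-congˡ e₁w) (*-congˡ e₂w)) (*-congˡ fw))
      (solve 3 (λ a b K → a :* con (+ 0) :+ b :* con (+ 0) :+ K :* con (+ 0) := con (+ 0)) refl a′ b′ K))
    v≈ : ∀ z → ⟨ v , z ⟩ ≈ ⟨ r , z ⟩ + ⟨ w , z ⟩
    v≈ z = trans (solve 2 (λ v w → v := (v :- w) :+ w) refl ⟨ v , z ⟩ ⟨ w , z ⟩) (+-congʳ (sym (⟨⟩-- _ _ _)))
    re₁ : ⟨ r , e₁ ⟩ ≈ a′
    re₁ = trans (⟨r,⟩ e₁) (trans (+-cong (+-cong (*-congˡ e₁-unit) (*-congˡ e₂⊥e₁)) (*-congˡ f⊥e₁))
      (trans (+-congʳ (+-congʳ (*-identityʳ a′)))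
      (solve 3 (λ a b K → a :+ b :* con (+ 0) :+ K :* con (+ 0) := a) refl a′ b′ K)))
    re₂ : ⟨ r , e₂ ⟩ ≈ b′ * ⟨ e₂ , e₂ ⟩
    re₂ = trans (⟨r,⟩ e₂) (trans (+-cong (+-congʳ (*-congˡ e₁⊥e₂)) (*-congˡ f⊥e₂))
      (solve 3 (λ a b K → a :* con (+ 0) :+ b :+ K :* con (+ 0) := b) refl a′ (b′ * ⟨ e₂ , e₂ ⟩) K))
    rf : ⟨ r , f ⟩ ≈ K * residue
    rf = trans (⟨r,⟩ f) (trans (+-congʳ (+-cong (*-congˡ (trans (⟨,⟩-sym _ _) f⊥e₁)) (*-congˡ (trans (⟨,⟩-sym _ _) f⊥e₂))))
      (solve 3 (λ a b F → a :* con (+ 0) :+ b :* con (+ 0) :+ F := F) refl a′ b′ (K * residue)))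
    coord : ∀ e → (∀ {w} → w ∈ W → ⟨ e , w ⟩ ≈ 0#) → ⟨ v , e ⟩ ≈ ⟨ r , e ⟩
    coord e e⊥W = trans (v≈ e) (trans (+-congˡ (trans (⟨,⟩-sym _ _) (e⊥W w∈W))) (+-identityʳ _))
    ve₁ = coord e₁ (λ w∈ → proj₁ (⊥W w∈))
    ve₂ = coord e₂ (λ w∈ → proj₁ (proj₂ (⊥W w∈)))
    rr≈ : ⟨ r , r ⟩ ≈ N (coordinates v) + K * K * residue
    rr≈ = begin
      ⟨ r , r ⟩
        ≈⟨ ⟨r,⟩ r ⟩
      a′ * ⟨ e₁ , r ⟩ + b′ * ⟨ e₂ , r ⟩ + K * ⟨ f , r ⟩
        ≈⟨ +-cong (+-cong (*-cong (sym (trans ve₁ re₁)) (trans (⟨,⟩-sym _ _) (sym ve₁))) y²)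
             (*-congˡ (trans (⟨,⟩-sym _ _) rf)) ⟩
      N (coordinates v) + K * (K * residue)
        ≈⟨ +-congˡ (*-assoc _ _ _) ⟨
      N (coordinates v) + K * K * residue ∎
      where
      ε = ⟨ e₂ , e₂ ⟩
      -- ⟨e₂, e₂⟩ is only known to be idempotent, because e₂ may be the padding 0; so b′ enters only
      -- through its product with it.
      y² : b′ * ⟨ e₂ , r ⟩ ≈ ⟨ v , e₂ ⟩ * ⟨ v , e₂ ⟩
      y² = begin
        b′ * ⟨ e₂ , r ⟩               ≈⟨ *-congˡ (trans (⟨,⟩-sym _ _) re₂) ⟩
        b′ * (b′ * ε)                 ≈⟨ *-congˡ (*-congˡ (e₂-unit e₂)) ⟨
        b′ * (b′ * (ε * ε))           ≈⟨ solve 2 (λ b e → b :* (b :* (e :* e)) := (b :* e) :* (b :* e)) refl b′ ε ⟩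
        (b′ * ε) * (b′ * ε)           ≈⟨ *-cong (trans ve₂ re₂) (trans ve₂ re₂) ⟨
        ⟨ v , e₂ ⟩ * ⟨ v , e₂ ⟩       ∎
    vv≈ : ⟨ v , v ⟩ ≈ ⟨ r , r ⟩ + ⟨ w , w ⟩
    vv≈ = begin
      ⟨ v , v ⟩
        ≈⟨ trans (v≈ v) (+-cong (trans (⟨,⟩-sym _ _) (v≈ r)) (trans (⟨,⟩-sym _ _) (v≈ w))) ⟩
      (⟨ r , r ⟩ + ⟨ w , r ⟩) + (⟨ r , w ⟩ + ⟨ w , w ⟩)
        ≈⟨ +-cong (trans (+-congˡ (trans (⟨,⟩-sym _ _) (r⊥W w∈W))) (+-identityʳ _))
             (trans (+-congʳ (r⊥W w∈W)) (+-identityˡ _)) ⟩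
      ⟨ r , r ⟩ + ⟨ w , w ⟩ ∎

-- The upper bound, with k + 1 returns from p = q′ to q″

module UpperBound (em : ExcludedMiddle 0ℓ) {ℝ : CompleteOrderedField}
  {V : InnerProductSpace ℝ} {U : UltrametricGroup ℝ} (Λ : ClosedSubgroup V U)
  {d : ℕ} (dimension : DimensionOf V d) (α : AbelianGroup.Carrier (Quotient Λ))
  (frame : Space.Frame em V (EffectiveSpace Λ))
  {n q p : ℕ} (b-q : BestReturn Λ α n q) (b-p : BestReturn Λ α (suc n) p)
  {k q″ : ℕ} (b-q″ : BestReturn Λ α (suc n ℕ.+ k) q″) (q″≤q+p : q″ ℕ.≤ q ℕ.+ p) where

  open OrderedField em ℝ
  open Plane em ℝ
  open Space em V
  open Frame frame
  open BestReturns em Λ α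
  open QuotientNorm em Λ α
  open Ultrametric em U
  open Decomposition em Λ dimension α frame
  private
    module U = UltrametricGroup U
    module X = AbelianGroup (Quotient Λ)
    module MX = Multiples (Quotient Λ)
    module Λ = ClosedSubgroup Λ

  private
    R P T : Carrier
    R = ρ Λ α q
    P = p · 1#
    T = R * R - P * P * residue

  open Radius T

  private
    remove-W : ∀ v w u → w ∈ W → (v -ᴹ w , u) X.≈ (v , u)
    remove-W v w u w∈W = Λ.respects
      (⟨⟩-injective (λ z → begin
        ⟨ (- 1#) *ₗ w , z ⟩                     ≈⟨ ⟨,⟩-* _ _ _ ⟩
        (- 1#) * ⟨ w , z ⟩                      ≈⟨ trans (sym (-‿distribˡ-* _ _)) (-‿cong (*-identityˡ _)) ⟩
        - ⟨ w , z ⟩                             ≈⟨ solve 2 (λ v w → :- w := v :- w :- v) refl ⟨ v , z ⟩ ⟨ w , z ⟩ ⟩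
        ⟨ v , z ⟩ - ⟨ w , z ⟩ - ⟨ v , z ⟩       ≈⟨ trans (⟨⟩-- _ _ _) (+-congʳ (⟨⟩-- _ _ _)) ⟨
        ⟨ (v -ᴹ w) -ᴹ v , z ⟩                   ∎) , U.sym (U.inverseʳ u))
      (w∈W (- 1#))
      where open ≈-Reasoning

    -- For c = a - b, which lies strictly between 0 and p, cutting off the line component leaves a
    -- representative of cα of norm at least ρ(c) ≥ R. Its ultrametric part is below R, so the bound
    -- falls on the real part, whose square is N + c² `residue`; finally c < p.
    gap-> : ∀ a b v u → (v , u) X.≈ (a ·α X.- b ·α) → U.∣ u ∣ < R →
            b ℕ.< a → a ℕ.< b ℕ.+ p → T ≤ N (coordinates v)
    gap-> a b v u vu≈ ∣u∣<R b<a a<b+p = 0≤⇒≤ (≤-respʳ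
      (solve 5 (λ n r P K F → (n :+ K :* K :* F :- r) :+ (P :* P :- K :* K) :* F
        := n :- (r :- P :* P :* F)) refl (N (coordinates v)) (R * R) P K residue)
      (≤⇒0≤ (≤-respʳ ‖r‖²≈ R²≤‖r‖²) +≤ (≤⇒0≤ (²-mono-≤ (0≤n·1 c) (·1-mono-≤ (ℕₚ.<⇒≤ c<p))) *≤ 0≤residue)))
      where
      c = a ℕ.∸ b
      K = c · 1#
      c+b≡a : c ℕ.+ b ≡ a
      c+b≡a = ℕₚ.m∸n+n≡m (ℕₚ.<⇒≤ b<a)
      c<p : c ℕ.< p
      c<p = ℕₚ.+-cancelʳ-< b c p (≡.subst₂ ℕ._<_ (≡.sym c+b≡a) (ℕₚ.+-comm b p) a<b+p)
      vu≈cα : (v , u) X.≈ (c ·α)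
      vu≈cα = MX.multiple-cancel α (v , u) c b
        (≡.subst (λ a → (v , u) X.≈ (a ·α X.- b ·α)) (≡.sym c+b≡a) vu≈)
      split = decomposition c v u vu≈cα
      w = proj₁ split
      ‖r‖²≈ = proj₁ (proj₂ (proj₂ split))
      R≤‖r‖ : R ≤ ‖ v -ᴹ w ‖
      R≤‖r‖ = ≤-⊔-< (≤-trans (best-next b-q b-p c (ℕₚ.m<n⇒0<n∸m b<a) c<p)
        (ρ≤ c (v -ᴹ w , u) (X.trans {v -ᴹ w , u} {v , u} {c ·α}
          (remove-W v w u (proj₁ (proj₂ split))) vu≈cα))) ∣u∣<R
      R²≤‖r‖² : R * R ≤ ⟨ v -ᴹ w , v -ᴹ w ⟩
      R²≤‖r‖² = ≤-respʳ (‖‖-square _) (²-mono-≤ (0≤ρ q) R≤‖r‖)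

    -- Only the ultrametric part is bounded: by the strong triangle inequality that bound survives
    -- sums and differences, whereas a bound on the real part would not.
    M : ℕ → ℕ → ℝ² → Set
    M a b x = ∃[ v ] ∃[ u ] (v , u) X.≈ (a ·α X.- b ·α) × U.∣ u ∣ < R ×
              proj₁ x ≈ ⟨ v , e₁ ⟩ × proj₂ x ≈ ⟨ v , e₂ ⟩

    N-cong : ∀ {x v} → proj₁ x ≈ ⟨ v , e₁ ⟩ → proj₂ x ≈ ⟨ v , e₂ ⟩ → N x ≈ N (coordinates v)
    N-cong p q = +-cong (*-cong p p) (*-cong q q)

    M-⊕ : ∀ {a b c d x y} → M a b x → M c d y → M (a ℕ.+ c) (b ℕ.+ d) (x ⊕ y)
    M-⊕ {a} {b} {c} {d} (v , u , vu≈ , ∣u∣<R , x₁ , x₂) (v′ , u′ , vu′≈ , ∣u′∣<R , y₁ , y₂) =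
      v +ᴹ v′ , u U.∙ u′ , MX.multiple-∙ α (v , u) (v′ , u′) a b c d vu≈ vu′≈ , ∣∣-∙-< ∣u∣<R ∣u′∣<R ,
      trans (+-cong x₁ y₁) (sym (⟨,⟩-+ _ _ _)) , trans (+-cong x₂ y₂) (sym (⟨,⟩-+ _ _ _))

    ∣⁻¹∣<R : ∀ {u} → U.∣ u ∣ < R → U.∣ u U.⁻¹ ∣ < R
    ∣⁻¹∣<R {u} = <-respˡ (sym (∣∣-⁻¹ u))

    M-⊖ : ∀ {a b c d x y} → M a b x → M c d y → M (a ℕ.+ d) (b ℕ.+ c) (x ⊖ y)
    M-⊖ {a} {b} {c} {d} {x} {y} Mx (v′ , u′ , vu′≈ , ∣u′∣<R , y₁ , y₂) =
      M-⊕ {a} {b} {d} {c} {x} {(- proj₁ y) , (- proj₂ y)} Mx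
        (-ᴹ v′ , u′ U.⁻¹ , MX.multiple-⁻¹ α (v′ , u′) c d vu′≈ , ∣⁻¹∣<R ∣u′∣<R ,
         trans (-‿cong y₁) (sym (⟨-,⟩ _ _)) , trans (-‿cong y₂) (sym (⟨-,⟩ _ _)))

    gap : ∀ {a b x} → M a b x → a ≢ b → a ℕ.< b ℕ.+ p → b ℕ.< a ℕ.+ p → T ≤ N x
    gap {a} {b} (v , u , vu≈ , ∣u∣<R , x₁ , x₂) a≢b a<b+p b<a+p with ℕₚ.<-cmp a b
    ... | tri≈ _ a≡b _ = ⊥-elim (a≢b a≡b)
    ... | tri> _ _ b<a = ≤-respʳ (sym (N-cong {v = v} x₁ x₂)) (gap-> a b v u vu≈ ∣u∣<R b<a a<b+p)
    ... | tri< a<b _ _ = ≤-respʳ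
      (trans (+-cong (neg² e₁) (neg² e₂)) (sym (N-cong {v = v} x₁ x₂)))
      (gap-> b a (-ᴹ v) (u U.⁻¹) (MX.multiple-⁻¹ α (v , u) a b vu≈) (∣⁻¹∣<R ∣u∣<R) a<b b<a+p)
      where
      neg² : ∀ e → ⟨ -ᴹ v , e ⟩ * ⟨ -ᴹ v , e ⟩ ≈ ⟨ v , e ⟩ * ⟨ v , e ⟩
      neg² e = trans (*-cong (⟨-,⟩ v e) (⟨-,⟩ v e)) (solve 1 (λ x → :- x :* :- x := x :* x) refl ⟨ v , e ⟩)

    index : Fin (suc k) → ℕ
    index i = suc n ℕ.+ toℕ i

    index≤ : ∀ i → index i ℕ.≤ suc n ℕ.+ k
    index≤ i = ℕₚ.+-monoʳ-≤ (suc n) (ℕ.s≤s⁻¹ (toℕ<n i))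

    return : ∀ i → ∃[ r ] BestReturn Λ α (index i) r
    return i = returns-below b-q″ (ℕ.s≤s ℕ.z≤n) (index≤ i)

    h : Fin (suc k) → ℕ
    h i = proj₁ (return i)

    h-increasing : ∀ {i j} → toℕ i ℕ.< toℕ j → h i ℕ.< h j
    h-increasing {i} {j} i<j = proj₁ (returns-increasing (proj₂ (return i)) (proj₂ (return j))
      (ℕₚ.+-monoʳ-< (suc n) i<j))

    p≤h : ∀ i → p ℕ.≤ h i
    p≤h i = returns-monotone b-p (proj₂ (return i)) (ℕₚ.m≤m+n (suc n) (toℕ i))

    h<2p : ∀ i → h i ℕ.< p ℕ.+ p
    -- Here the assumption on q″ enters: h i ≤ q″ ≤ q + p < 2p.
    h<2p i = ℕₚ.≤-<-trans (ℕₚ.≤-trans (returns-monotone (proj₂ (return i)) b-q″ (index≤ i)) q″≤q+p)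
      (ℕₚ.+-monoˡ-< p (proj₁ (returns-increasing b-q b-p ℕₚ.≤-refl)))

    h-injective : ∀ {i j} → i ≢ j → h i ≢ h j
    h-injective {i} {j} i≢j h≡ with ℕₚ.<-cmp (toℕ i) (toℕ j)
    ... | tri< i<j _ _ = ℕₚ.<⇒≢ (h-increasing i<j) h≡
    ... | tri≈ _ i≡j _ = i≢j (toℕ-injective i≡j)
    ... | tri> _ _ j<i = ℕₚ.<⇒≢ (h-increasing j<i) (≡.sym h≡)

    representative : ∀ i → ∃[ a ] a X.≈ (h i ·α) × productNorm V U a < R
    representative i = ρ<⇒representative (h i)
      (proj₂ (returns-increasing b-q (proj₂ (return i)) (ℕ.s≤s (ℕₚ.m≤m+n n (toℕ i)))))

    rᵥ : Fin (suc k) → Carrierᴹ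
    rᵥ i = proj₁ (proj₁ (representative i))

    rᵤ : Fin (suc k) → U.Carrier
    rᵤ i = proj₂ (proj₁ (representative i))

    x : Fin (suc k) → ℝ²
    x i = coordinates (rᵥ i)

    M-x : ∀ i → M (h i) 0 (x i)
    M-x i = rᵥ i , rᵤ i , MX.multiple-0 α (rᵥ i , rᵤ i) (h i) (proj₁ (proj₂ (representative i))) ,
      ≤-<-trans (x≤y⊔x ‖ rᵥ i ‖ U.∣ rᵤ i ∣) (proj₂ (proj₂ (representative i))) , refl , refl

    -- N + (h i)² `residue` ≤ |v|² < R², and h i ≥ p lets p replace h i.
    short : ∀ i → Short (x i)
    short i = 0<⇒< (<-respʳ
      (solve 6 (λ n r P K F v → (v :- (n :+ K :* K :* F)) :+ (K :* K :- P :* P) :* F :+ (r :- v)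
        := r :- P :* P :* F :- n) refl (N (x i)) (R * R) P K residue ⟨ v , v ⟩)
      ((≤⇒0≤ (proj₂ (proj₂ (proj₂ split)))
         +≤ (≤⇒0≤ (²-mono-≤ (0≤n·1 p) (·1-mono-≤ (p≤h i))) *≤ 0≤residue))
       +≤< <⇒0< (<-respˡ (‖‖-square v) (²-mono-< (‖‖-nonNeg v)
         (≤-<-trans (x≤x⊔y ‖ v ‖ U.∣ rᵤ i ∣) (proj₂ (proj₂ (representative i))))))))
      where
      v = rᵥ i
      K = h i · 1#
      split = decomposition (h i) v (rᵤ i) (proj₁ (proj₂ (representative i)))

  module Conclusion = Heights em ℝ T

  -- With k = 2 there are three returns; the padding e₂ = 0 makes every second coordinate vanish, so
  -- all their vectors are parallel.
  no-return-1 : k ≡ 2 → (∀ v → ⟨ v , e₂ ⟩ ≈ 0#) → ⊥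
  no-return-1 ≡.refl flat = Conclusion.no-parallel M (λ {a} {b} {c} {d} → M-⊕ {a} {b} {c} {d})
    (λ {a} {b} {c} {d} {x} → M-⊖ {a} {b} {c} {d} {x}) p gap
    h x M-x short h-injective p≤h h<2p {0F} {1F} {2F} (λ ()) (λ ()) (λ ())
    λ i j → trans (+-cong (*-congˡ (flat _)) (-‿cong (*-congʳ (flat _))))
      (solve 2 (λ a b → a :* con (+ 0) :- con (+ 0) :* b := con (+ 0)) refl (proj₁ (x i)) (proj₁ (x j)))

  no-return-2 : k ≡ 4 → ⊥
  no-return-2 ≡.refl = Conclusion.no-pentagon M (λ {a} {b} {c} {d} → M-⊕ {a} {b} {c} {d})
    (λ {a} {b} {c} {d} {x} → M-⊖ {a} {b} {c} {d} {x}) p gap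
    h x M-x short h-injective p≤h h<2p {4F} {0F} {1F} {2F} {3F}
    (((λ ()) ∷ (λ ()) ∷ (λ ()) ∷ (λ ()) ∷ []) ∷ ((λ ()) ∷ (λ ()) ∷ (λ ()) ∷ []) ∷
     ((λ ()) ∷ (λ ()) ∷ []) ∷ ((λ ()) ∷ []) ∷ [] ∷ [])
    top
    where
    top : ∀ i → i ≢ 4F → h i ℕ.< h 4F
    top 0F _ = h-increasing {0F} {4F} (ℕ.s≤s ℕ.z≤n)
    top 1F _ = h-increasing {1F} {4F} (ℕ.s≤s (ℕ.s≤s ℕ.z≤n))
    top 2F _ = h-increasing {2F} {4F} (ℕ.s≤s (ℕ.s≤s (ℕ.s≤s ℕ.z≤n)))
    top 3F _ = h-increasing {3F} {4F} (ℕ.s≤s (ℕ.s≤s (ℕ.s≤s (ℕ.s≤s ℕ.z≤n))))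
    top 4F ne = ⊥-elim (ne ≡.refl)

upper-bound : (em : ExcludedMiddle 0ℓ) {ℝ : CompleteOrderedField}
  {V : InnerProductSpace ℝ} {d : ℕ} → DimensionOf V d →
  {U : UltrametricGroup ℝ} (Λ : ClosedSubgroup V U) →
  ∀ m → m ≡ 1 ⊎ m ≡ 2 → EffectiveDimension Λ m → ∀ α n q q′ q″ →
  BestReturn Λ α n q → BestReturn Λ α (n ℕ.+ 1) q′ → BestReturn Λ α (n ℕ.+ 2 ℕ.^ m ℕ.+ 1) q″ →
  q ℕ.+ q′ ℕ.< q″
upper-bound em {ℝ} {V} dimension Λ m (inj₁ ≡.refl) effective α n q q′ q″ b b′ b″ = ℕₚ.≰⇒> λ q″≤ →
  UpperBound.no-return-1 em Λ dimension α (Space.frame₁ em V effective) b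
    (≡.subst (λ n → BestReturn Λ α n q′) (ℕₚ.+-comm n 1) b′)
    (≡.subst (λ n → BestReturn Λ α n q″) (ℕₚ.+-comm (n ℕ.+ 2) 1) b″) q″≤ ≡.refl (Space.⟨,0⟩ em V)
upper-bound em {ℝ} {V} dimension Λ m (inj₂ ≡.refl) effective α n q q′ q″ b b′ b″ = ℕₚ.≰⇒> λ q″≤ →
  UpperBound.no-return-2 em Λ dimension α (Space.frame₂ em V effective) b
    (≡.subst (λ n → BestReturn Λ α n q′) (ℕₚ.+-comm n 1) b′)
    (≡.subst (λ n → BestReturn Λ α n q″) (ℕₚ.+-comm (n ℕ.+ 4) 1) b″) q″≤ ≡.refl

-- Sharpness

-- For n = 0 the only multiple is 0. This case describes a coordinate direction without lattice
-- points other than 0, as in effective dimension 1.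
distanceToMultiples : ℕ → ℕ → ℕ
distanceToMultiples zero      a = a
distanceToMultiples n@(suc _) a = a ℕ.% n ℕ.⊓ (n ℕ.∸ a ℕ.% n)

private
  module Division (n a : ℕ) .{{_ : NonZero n}} where
    r = a ℕ.% n
    q = a ℕ./ n

    +a≡ : + a ≡ + r ℤ.+ + n ℤ.* + q
    +a≡ = ≡.trans (≡.cong +_ (≡.trans (ℕ.m≡m%n+[m/n]*n a n) (≡.cong (r ℕ.+_) (ℕₚ.*-comm q n))))
      (≡.cong (λ z → + r ℤ.+ z) (ℤₚ.pos-* n q))

    a-ni≡ : ∀ i → + a ℤ.- + n ℤ.* i ≡ + r ℤ.+ + n ℤ.* (+ q ℤ.- i)
    a-ni≡ i = ≡.trans (≡.cong (ℤ._- + n ℤ.* i) +a≡) (lemma (+ r) (+ n) (+ q) i)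
      where
      lemma : ∀ r n q i → (r ℤ.+ n ℤ.* q) ℤ.- n ℤ.* i ≡ r ℤ.+ n ℤ.* (q ℤ.- i)
      lemma = ℤ-Solver.solve-∀

    -- For t ≥ 0 the value is at least r; for t ≤ -1 it is at most r - n, so its absolute value is
    -- at least n - r.
    lower : ∀ t → r ℕ.⊓ (n ℕ.∸ r) ℕ.≤ ℤ.∣ + r ℤ.+ + n ℤ.* t ∣
    lower (+ t) rewrite ≡.sym (ℤₚ.pos-* n t) = ℕₚ.≤-trans (ℕₚ.m⊓n≤m r _) (ℕₚ.m≤m+n r _)
    lower -[1+ t ] = ≡.subst (λ z → r ℕ.⊓ (n ℕ.∸ r) ℕ.≤ ℤ.∣ z ∣) (≡.sym eq)
      (≡.subst (r ℕ.⊓ (n ℕ.∸ r) ℕ.≤_) (≡.sym (ℤₚ.∣⊖∣-≤ r≤))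
        (ℕₚ.≤-trans (ℕₚ.m⊓n≤n r _) (ℕₚ.∸-monoˡ-≤ r (ℕₚ.m≤m*n n (suc t)))))
      where
      r≤ : r ℕ.≤ n ℕ.* suc t
      r≤ = ℕₚ.≤-trans (ℕ.m%n≤n a n) (ℕₚ.m≤m*n n (suc t))
      eq : + r ℤ.+ + n ℤ.* -[1+ t ] ≡ r ℤ.⊖ (n ℕ.* suc t)
      eq = ≡.trans (≡.cong (λ z → + r ℤ.+ z) (≡.trans (≡.sym (ℤₚ.neg-distribʳ-* (+ n) (+ suc t)))
        (≡.cong ℤ.-_ (≡.sym (ℤₚ.pos-* n (suc t)))))) (ℤₚ.m-n≡m⊖n r (n ℕ.* suc t))

distanceToMultiples-≤ : ∀ n a i → distanceToMultiples n a ℕ.≤ ℤ.∣ + a ℤ.- + n ℤ.* i ∣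
distanceToMultiples-≤ zero a i = ℕₚ.m≤m+n a 0
distanceToMultiples-≤ n@(suc _) a i = ≡.subst (λ z → distanceToMultiples n a ℕ.≤ ℤ.∣ z ∣)
  (≡.sym (a-ni≡ i)) (lower (+ q ℤ.- i))
  where open Division n a

distanceToMultiples-attained : ∀ n a → ∃[ i ] ℤ.∣ + a ℤ.- + n ℤ.* i ∣ ≡ distanceToMultiples n a
distanceToMultiples-attained zero a = + 0 , ≡.cong ℤ.∣_∣ (ℤₚ.+-identityʳ (+ a))
distanceToMultiples-attained n@(suc _) a with ℕₚ.≤-total r (n ℕ.∸ r)
  where open Division n a
... | inj₁ r≤ = + q , ≡.trans (≡.cong ℤ.∣_∣ (≡.trans (a-ni≡ (+ q)) (lemma (+ r) (+ n) (+ q))))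
                        (≡.sym (ℕₚ.m≤n⇒m⊓n≡m r≤))
  where
  open Division n a
  lemma : ∀ r n q → r ℤ.+ n ℤ.* (q ℤ.- q) ≡ r
  lemma = ℤ-Solver.solve-∀
... | inj₂ ≤r = + suc q , ≡.trans (≡.cong ℤ.∣_∣ (≡.trans (a-ni≡ (+ suc q)) (≡.trans (lemma (+ r) (+ n) (+ q)) (ℤₚ.m-n≡m⊖n r n))))
                        (≡.trans (ℤₚ.∣⊖∣-≤ (ℕ.m%n≤n a n)) (≡.sym (ℕₚ.m≥n⇒m⊓n≡n ≤r)))
  where
  open Division n a
  lemma : ∀ r n q → r ℤ.+ n ℤ.* (q ℤ.- (+ 1 ℤ.+ q)) ≡ r ℤ.- n
  lemma = ℤ-Solver.solve-∀

module EuclideanPlane (em : ExcludedMiddle 0ℓ) (ℝ : CompleteOrderedField) where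

  open OrderedField em ℝ
  open Plane em ℝ

  plane : InnerProductSpace ℝ
  plane = record
    { vectorSpace  = ModuleProduct.⟨module⟩ TensorUnit.⟨module⟩ TensorUnit.⟨module⟩
    ; ⟨_,_⟩        = _∙_
    ; ⟨,⟩-cong     = λ (p₁ , p₂) (q₁ , q₂) → +-cong (*-cong p₁ q₁) (*-cong p₂ q₂)
    ; ⟨,⟩-sym      = λ v w → +-cong (*-comm _ _) (*-comm _ _)
    ; ⟨,⟩-+        = λ (v₁ , v₂) (w₁ , w₂) (x₁ , x₂) → solve 6 (λ v₁ v₂ w₁ w₂ x₁ x₂ →
        (v₁ :+ w₁) :* x₁ :+ (v₂ :+ w₂) :* x₂ := (v₁ :* x₁ :+ v₂ :* x₂) :+ (w₁ :* x₁ :+ w₂ :* x₂))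
        refl v₁ v₂ w₁ w₂ x₁ x₂
    ; ⟨,⟩-*        = λ t (v₁ , v₂) (w₁ , w₂) → solve 5 (λ t v₁ v₂ w₁ w₂ →
        t :* v₁ :* w₁ :+ t :* v₂ :* w₂ := t :* (v₁ :* w₁ :+ v₂ :* w₂)) refl t v₁ v₂ w₁ w₂
    ; ⟨,⟩-nonNeg   = 0≤N
    ; ⟨,⟩-definite = λ (v₁ , v₂) N≈0 →
        x²≤0⇒x≈0 (≤-respʳ N≈0 (0≤⇒≤ (≤-respʳ
          (solve 2 (λ a b → b := (a :+ b) :- a) refl (v₁ * v₁) (v₂ * v₂)) (0≤x² v₂)))) ,
        x²≤0⇒x≈0 (≤-respʳ N≈0 (0≤⇒≤ (≤-respʳ
          (solve 2 (λ a b → a := (a :+ b) :- b) refl (v₁ * v₁) (v₂ * v₂)) (0≤x² v₁))))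
    ; ‖_‖          = λ v → √ (N v) (0≤N v)
    ; ‖‖-nonNeg    = λ v → 0≤√ (0≤N v)
    ; ‖‖-square    = λ v → √-square (0≤N v)
    }

  open InnerProductSpace plane public using (IsBasisOf; HasDimension)

  standardBasis : Fin 2 → ℝ²
  standardBasis zero    = 1# , 0#
  standardBasis (suc _) = 0# , 1#

  standardBasis-isBasis : ∀ S → (∀ i → standardBasis i ∈ S) → IsBasisOf S standardBasis
  standardBasis-isBasis S members = record
    { members     = members
    ; independent = λ where
        c (p , q) zero       → trans (sym (first-coordinate (c zero) (c (suc zero)))) p
        c (p , q) (suc zero) → trans (sym (second-coordinate (c zero) (c (suc zero)))) q
    ; spanning    = λ (x , y) _ → (λ { zero → x ; (suc _) → y }) ,
        sym (first-coordinate x y) , sym (second-coordinate x y)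
    }
    where
    first-coordinate : ∀ x y → x * 1# + (y * 0# + 0#) ≈ x
    first-coordinate x y = trans (+-cong (*-identityʳ x) (trans (+-identityʳ _) (zeroʳ y))) (+-identityʳ x)
    second-coordinate : ∀ x y → x * 0# + (y * 1# + 0#) ≈ y
    second-coordinate x y = trans (+-cong (zeroʳ x) (trans (+-identityʳ _) (*-identityʳ y))) (+-identityˡ y)

module ParityGroup (em : ExcludedMiddle 0ℓ) (ℝ : CompleteOrderedField)
  (r : CompleteOrderedField.Carrier ℝ)
  (0<r : CompleteOrderedField._<_ ℝ (CompleteOrderedField.0# ℝ) r) where

  open OrderedField em ℝ

  size : Parity → Carrier
  size 0ℙ = 0#
  size 1ℙ = r

  0≤size : ∀ p → 0# ≤ size p
  0≤size 0ℙ = ≤-refl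
  0≤size 1ℙ = <⇒≤ 0<r

  parityGroup : UltrametricGroup ℝ
  parityGroup = record
    { abelianGroup         = ℙₚ.+-0-abelianGroup
    ; dist                 = λ p q → size (p ℙ.+ q)
    ; isUltrametric        = record
      { isSemiMetric = record
        { isQuasiSemiMetric = record
          { isPreMetric = record
            { isProtoMetric = record
              { isPartialOrder  = isPartialOrder
              ; ≈-isEquivalence = ≡.isEquivalence
              ; cong            = λ { ≡.refl ≡.refl → refl }
              ; nonNegative     = λ {p} {q} → 0≤size (p ℙ.+ q)
              }
            ; ≈⇒0 = λ { {p} ≡.refl → reflexive (≡.cong size (ℙₚ.p+p≡0ℙ p)) }
            }
          ; 0⇒≈ = λ {p} {q} → indiscernible p q
          }
        ; sym = λ p q → reflexive (≡.cong size (ℙₚ.+-comm p q))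
        }
      ; triangle = triangle
      }
    ; translationInvariant = λ {p} {q} {s} → reflexive (≡.cong size (translation p q s))
    }
    where
    indiscernible : ∀ p q → size (p ℙ.+ q) ≈ 0# → p ≡ q
    indiscernible 0ℙ 0ℙ _   = ≡.refl
    indiscernible 1ℙ 1ℙ _   = ≡.refl
    indiscernible 0ℙ 1ℙ r≈0 = ⊥-elim (proj₂ 0<r (sym r≈0))
    indiscernible 1ℙ 0ℙ r≈0 = ⊥-elim (proj₂ 0<r (sym r≈0))
    triangle : ∀ p q s → size (p ℙ.+ s) ≤ size (p ℙ.+ q) ⊔ size (q ℙ.+ s)
    triangle 0ℙ q  0ℙ = ≤-trans (0≤size q) (x≤x⊔y _ _)
    triangle 0ℙ 0ℙ 1ℙ = x≤y⊔x _ _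
    triangle 0ℙ 1ℙ 1ℙ = x≤x⊔y _ _
    triangle 1ℙ 0ℙ 0ℙ = x≤x⊔y _ _
    triangle 1ℙ 1ℙ 0ℙ = x≤y⊔x _ _
    triangle 1ℙ q  1ℙ = ≤-trans (0≤size (1ℙ ℙ.+ q)) (x≤x⊔y _ _)
    translation : ∀ p q s → (p ℙ.+ s) ℙ.+ (q ℙ.+ s) ≡ p ℙ.+ q
    translation 0ℙ 0ℙ 0ℙ = ≡.refl
    translation 0ℙ 0ℙ 1ℙ = ≡.refl
    translation 0ℙ 1ℙ 0ℙ = ≡.refl
    translation 0ℙ 1ℙ 1ℙ = ≡.refl
    translation 1ℙ 0ℙ 0ℙ = ≡.refl
    translation 1ℙ 0ℙ 1ℙ = ≡.refl
    translation 1ℙ 1ℙ 0ℙ = ≡.refl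
    translation 1ℙ 1ℙ 1ℙ = ≡.refl

-- Here Λ = n₁ℤ × n₂ℤ × 0, α = (a₁, a₂) with odd parity, and the odd element of ℤ/2 has norm the
-- square root of c + 1. With integer data all squared returns are natural numbers, so best returns
-- can be verified by computation.
module Lattice (em : ExcludedMiddle 0ℓ) (ℝ : CompleteOrderedField) (n₁ n₂ a₁ a₂ c : ℕ) where

  open OrderedField em ℝ
  open Plane em ℝ
  open EuclideanPlane em ℝ

  0<r² : 0# < suc c · 1#
  0<r² = <-≤-trans 0<1 (·1-nonZero c)

  r : Carrier
  r = √ (suc c · 1#) (<⇒≤ 0<r²)

  0<r : 0# < r
  0<r = ²-cancel-< ≤-refl (0≤√ _) (<-respˡ (sym (zeroˡ 0#)) (<-respʳ (sym (√-square _)) 0<r²))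

  open ParityGroup em ℝ r 0<r

  private
    module G = AbelianGroup (productGroup plane parityGroup)

    half : ∃[ h ] 0# < h × (1# + 1#) * h ≈ 1#
    half = inverse-pos (0<1 +< <⇒≤ 0<1)

    h = proj₁ half

    -- Take a multiple within 1/2 of x. If it is not x, approximating x more closely than this gives
    -- a second multiple, also within 1/2; but two multiples less than 1 apart are equal.
    closed : ∀ n x → (∀ δ → 0# < δ → ∃[ i ] (x - ι (+ n ℤ.* i)) * (x - ι (+ n ℤ.* i)) < δ * δ) →
             ∃[ i ] x ≈ ι (+ n ℤ.* i)
    closed n x approximable = i , x≈
      where
      i = proj₁ (approximable h (proj₁ (proj₂ half)))
      e = x - ι (+ n ℤ.* i)
      e²<h² : e * e < h * h
      e²<h² = proj₂ (approximable h (proj₁ (proj₂ half)))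
      distant : ¬ (0# < e * e × ∃[ j ] (x - ι (+ n ℤ.* j)) * (x - ι (+ n ℤ.* j)) < e * e)
      distant (_ , j , e′²<e²) = <-irrefl (<-respˡ (reflexive (≡.cong (λ k → (x - ι k) * (x - ι k)) (≡.sym ni≡nj))) e′²<e²)
        where
        e′ = x - ι (+ n ℤ.* j)
        difference : ι (+ n ℤ.* i ℤ.- + n ℤ.* j) ≈ e′ - e
        difference = trans (ι-+ (+ n ℤ.* i) (ℤ.- (+ n ℤ.* j))) (trans (+-congˡ (ι-neg (+ n ℤ.* j)))
          (solve 3 (λ x u v → u :- v := (x :- v) :- (x :- u)) refl x (ι (+ n ℤ.* i)) (ι (+ n ℤ.* j))))
        small : ι (+ n ℤ.* i ℤ.- + n ℤ.* j) * ι (+ n ℤ.* i ℤ.- + n ℤ.* j) < 1#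
        small = <-respˡ (sym (*-cong difference difference)) (<-respʳ
          (trans (solve 2 (λ o h → con (+ 4) :* (h :* h) := (con (+ 2) :* h) :* (con (+ 2) :* h)) refl 1# h)
            (trans (*-cong 2h≈1 2h≈1) (*-identityʳ 1#)))
          -- By the parallelogram law (e′ - e)² ≤ 2e² + 2e′² < 4h² = 1, where h is one half.
          (0<⇒< (<-respʳ
            (solve 3 (λ e f H → (H :- e :* e) :+ (H :- e :* e) :+ ((H :- f :* f) :+ (H :- f :* f)) :+ (e :+ f) :* (e :+ f)
               := con (+ 4) :* H :- (f :- e) :* (f :- e)) refl e e′ (h * h))
            (<⇒0< e²<h² +< <⇒≤ (<⇒0< e²<h²)
              +< (<⇒≤ e′²<h² +≤ <⇒≤ e′²<h²) +< 0≤x² (e + e′)))))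
          where
          2h≈1 : (1# + (1# + 0#)) * h ≈ 1#
          2h≈1 = trans (*-congʳ (+-congˡ (+-identityʳ 1#))) (proj₂ (proj₂ half))
          e′²<h² : 0# < h * h - e′ * e′
          e′²<h² = <⇒0< (<-trans e′²<e² e²<h²)
        ni≡nj : + n ℤ.* i ≡ + n ℤ.* j
        ni≡nj = ℤₚ.i-j≡0⇒i≡j (+ n ℤ.* i) (+ n ℤ.* j) (ι²<1⇒≡0 _ small)
      x≈ : x ≈ ι (+ n ℤ.* i)
      x≈ with em {x ≈ ι (+ n ℤ.* i)}
      ... | yes p = p
      ... | no x≉ with ≤-total 0# e
      ...   | inj₁ 0≤e = ⊥-elim (distant (0<e *< 0<e , approximable e 0<e))
        where
        0<e : 0# < e
        0<e = 0≤e , λ 0≈e → x≉ (trans (solve 2 (λ x u → x := (x :- u) :+ u) refl x _)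
          (trans (+-congʳ (sym 0≈e)) (+-identityˡ _)))
      ...   | inj₂ e≤0 = ⊥-elim (distant (<-respʳ neg² (0<-e *< 0<-e) ,
                let j , lt = approximable (- e) 0<-e in j , <-respʳ neg² lt))
        where
        neg² : - e * - e ≈ e * e
        neg² = solve 1 (λ e → :- e :* :- e := e :* e) refl e
        0<-e : 0# < - e
        0<-e = 0≤-neg e≤0 , λ 0≈-e → x≉ (trans (solve 2 (λ x u → x := u :- (:- (x :- u))) refl x _)
          (trans (+-congˡ (trans (-‿cong (sym 0≈-e)) -0#≈0#)) (+-identityʳ _)))

  IsMember : G.Carrier → Set
  IsMember ((x , y) , p) = ∃[ i ] ∃[ j ] x ≈ ι (+ n₁ ℤ.* i) × y ≈ ι (+ n₂ ℤ.* j) × p ≡ 0ℙ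

  lattice : ClosedSubgroup plane parityGroup
  lattice = record
    { Member    = IsMember
    ; respects  = λ ((x≈ , y≈) , p≡) (i , j , x , y , p) →
        i , j , trans (sym x≈) x , trans (sym y≈) y , ≡.trans (≡.sym p≡) p
    ; ε-closed  = + 0 , + 0 , reflexive (≡.cong ι (≡.sym (ℤₚ.*-zeroʳ (+ n₁)))) ,
        reflexive (≡.cong ι (≡.sym (ℤₚ.*-zeroʳ (+ n₂)))) , ≡.refl
    ; ∙-closed  = λ { (i , j , x , y , ≡.refl) (i′ , j′ , x′ , y′ , ≡.refl) →
        i ℤ.+ i′ , j ℤ.+ j′ , sum n₁ i i′ x x′ , sum n₂ j j′ y y′ , ≡.refl }
    ; ⁻¹-closed = λ { (i , j , x , y , ≡.refl) → ℤ.- i , ℤ.- j , negate n₁ i x , negate n₂ j y , ≡.refl }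
    ; topologicallyClosed = λ ((x , y) , p) approximable →
        let i , x≈ = closed n₁ x (λ δ 0<δ → let ((x′ , y′) , p′) , (i , j , x′≈ , _) , lt = approximable δ 0<δ in
              i , <-respˡ (square (+-congˡ (-‿cong x′≈))) (≤-<-trans (first≤N (x - x′ , y - y′)) (norm< (x - x′ , y - y′) (p ℙ.+ p′) 0<δ lt)))
            j , y≈ = closed n₂ y (λ δ 0<δ → let ((x′ , y′) , p′) , (i , j , _ , y′≈ , _) , lt = approximable δ 0<δ in
              j , <-respˡ (square (+-congˡ (-‿cong y′≈))) (≤-<-trans (second≤N (x - x′ , y - y′)) (norm< (x - x′ , y - y′) (p ℙ.+ p′) 0<δ lt)))
        in i , j , x≈ , y≈ , even (x , y) p (approximable r 0<r)
    }
    where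
    square : ∀ {x y} → x ≈ y → x * x ≈ y * y
    square p = *-cong p p
    sum : ∀ n i i′ {x x′} → x ≈ ι (+ n ℤ.* i) → x′ ≈ ι (+ n ℤ.* i′) → x + x′ ≈ ι (+ n ℤ.* (i ℤ.+ i′))
    sum n i i′ p q = trans (+-cong p q) (trans (sym (ι-+ (+ n ℤ.* i) (+ n ℤ.* i′))) (reflexive (≡.cong ι (≡.sym (ℤₚ.*-distribˡ-+ (+ n) i i′)))))
    negate : ∀ n i {x} → x ≈ ι (+ n ℤ.* i) → - x ≈ ι (+ n ℤ.* (ℤ.- i))
    negate n i p = trans (-‿cong p) (trans (sym (ι-neg (+ n ℤ.* i))) (reflexive (≡.cong ι (ℤₚ.neg-distribʳ-* (+ n) i))))
    first≤N : ∀ v → proj₁ v * proj₁ v ≤ N v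
    first≤N (x , y) = 0≤⇒≤ (≤-respʳ (solve 2 (λ a b → b := (a :+ b) :- a) refl (x * x) (y * y)) (0≤x² y))
    second≤N : ∀ v → proj₂ v * proj₂ v ≤ N v
    second≤N (x , y) = 0≤⇒≤ (≤-respʳ (solve 2 (λ a b → a := (a :+ b) :- b) refl (x * x) (y * y)) (0≤x² x))
    norm< : ∀ {δ} v p → 0# < δ → productNorm plane parityGroup (v , p) < δ → N v < δ * δ
    norm< v p 0<δ lt = <-respˡ (√-square (0≤N v)) (²-mono-< (0≤√ (0≤N v)) (≤-<-trans (x≤x⊔y _ _) lt))
    even : ∀ v p → ∃[ l ] IsMember l × productNorm plane parityGroup ((v , p) G.- l) < r → p ≡ 0ℙ
    even v 0ℙ _ = ≡.refl
    even v 1ℙ ((l , .0ℙ) , (_ , _ , _ , _ , ≡.refl) , lt) = ⊥-elim (≤⇒≯ (x≤y⊔x _ _) lt)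

  α : G.Carrier
  α = (ι (+ a₁) , ι (+ a₂)) , 1ℙ

  open QuotientNorm em lattice α

  parity : ℕ → Parity
  parity zero    = 0ℙ
  parity (suc k) = 1ℙ ℙ.+ parity k

  ·α≈ : ∀ k → (k ·α) G.≈ ((ι (+ (k ℕ.* a₁)) , ι (+ (k ℕ.* a₂))) , parity k)
  ·α≈ zero    = (refl , refl) , ≡.refl
  ·α≈ (suc k) with ·α≈ k
  ... | (x≈ , y≈) , p≡ = (trans (+-congˡ x≈) (sym (·-homo-+ 1# a₁ (k ℕ.* a₁))) ,
                          trans (+-congˡ y≈) (sym (·-homo-+ 1# a₂ (k ℕ.* a₂)))) ,
                         ≡.cong (1ℙ ℙ.+_) p≡

  level : Parity → ℕ
  level 0ℙ = 0
  level 1ℙ = suc c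

  -- The square of the product norm at an integer point: squaring nonnegative numbers commutes with
  -- taking the maximum.
  measure : ℕ → ℕ → Parity → ℕ
  measure x y p = (x ℕ.* x ℕ.+ y ℕ.* y) ℕ.⊔ level p

  root : ℕ → Carrier
  root m = √ (m · 1#) (0≤n·1 m)

  root-mono-≤ : ∀ {m n} → m ℕ.≤ n → root m ≤ root n
  root-mono-≤ m≤n = √-mono-≤ _ _ (·1-mono-≤ m≤n)

  size-square : ∀ p → size p * size p ≈ level p · 1#
  size-square 0ℙ = zeroˡ 0#
  size-square 1ℙ = √-square _

  productNorm≈ : ∀ i j p {a} → a G.≈ ((ι i , ι j) , p) →
                 productNorm plane parityGroup a ≈ root (measure ℤ.∣ i ∣ ℤ.∣ j ∣ p)
  productNorm≈ i j p {(x , y) , p′} ((x≈ , y≈) , ≡.refl) = go (ℕₚ.≤-total A (level p))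
    where
    A = ℤ.∣ i ∣ ℕ.* ℤ.∣ i ∣ ℕ.+ ℤ.∣ j ∣ ℕ.* ℤ.∣ j ∣
    s = √ (N (x , y)) (0≤N (x , y))
    t = size (p ℙ.+ 0ℙ)
    s² : s * s ≈ A · 1#
    s² = trans (√-square (0≤N (x , y))) (trans (+-cong (*-cong x≈ x≈) (*-cong y≈ y≈))
      (trans (+-cong (ι-square i) (ι-square j)) (sym (·-homo-+ 1# (ℤ.∣ i ∣ ℕ.* ℤ.∣ i ∣) (ℤ.∣ j ∣ ℕ.* ℤ.∣ j ∣)))))
    t² : t * t ≈ level p · 1#
    t² = trans (reflexive (≡.cong (λ p → size p * size p) (ℙₚ.+-identityʳ p))) (size-square p)
    0≤s = 0≤√ (0≤N (x , y))
    0≤t = 0≤size (p ℙ.+ 0ℙ)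
    is-root : ∀ {s m} → 0# ≤ s → s * s ≈ m · 1# → s ≈ root m
    is-root 0≤s s² = ²-injective 0≤s (0≤√ _) (trans s² (sym (√-square _)))
    go : A ℕ.≤ level p ⊎ level p ℕ.≤ A → s ⊔ t ≈ root (A ℕ.⊔ level p)
    go (inj₁ A≤) = trans (x≤y⇒x⊔y≈y (²-cancel-≤ 0≤t (≤-respˡ (sym s²) (≤-respʳ (sym t²) (·1-mono-≤ A≤)))))
      (trans (is-root {m = level p} 0≤t t²) (reflexive (≡.cong root (≡.sym (ℕₚ.m≤n⇒m⊔n≡n A≤)))))
    go (inj₂ ≤A) = trans (x≤y⇒y⊔x≈y (²-cancel-≤ 0≤s (≤-respˡ (sym t²) (≤-respʳ (sym s²) (·1-mono-≤ ≤A)))))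
      (trans (is-root {m = A} 0≤s s²) (reflexive (≡.cong root (≡.sym (ℕₚ.m≥n⇒m⊔n≡m ≤A)))))

  measure-mono : ∀ {x x′ y y′} p → x ℕ.≤ x′ → y ℕ.≤ y′ → measure x y p ℕ.≤ measure x′ y′ p
  measure-mono p x≤ y≤ = ℕₚ.⊔-monoˡ-≤ (level p) (ℕₚ.+-mono-≤ (ℕₚ.*-mono-≤ x≤ x≤) (ℕₚ.*-mono-≤ y≤ y≤))

  squaredReturn : ℕ → ℕ
  squaredReturn k = measure (distanceToMultiples n₁ (k ℕ.* a₁)) (distanceToMultiples n₂ (k ℕ.* a₂)) (parity k)

  -- `measure` is monotone in each coordinate, so choosing the nearest multiple in both coordinates
  -- independently attains the infimum.
  ρ≈ : ∀ k → ρ lattice α k ≈ root (squaredReturn k)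
  ρ≈ k = ≤-antisym upper lower
    where
    i = proj₁ (distanceToMultiples-attained n₁ (k ℕ.* a₁))
    j = proj₁ (distanceToMultiples-attained n₂ (k ℕ.* a₂))
    i≡ = proj₂ (distanceToMultiples-attained n₁ (k ℕ.* a₁))
    j≡ = proj₂ (distanceToMultiples-attained n₂ (k ℕ.* a₂))
    X = + (k ℕ.* a₁) ℤ.- + n₁ ℤ.* i
    Y = + (k ℕ.* a₂) ℤ.- + n₂ ℤ.* j
    coordinate : ∀ n m i {x} → x ≈ ι (+ m) → ι (+ m ℤ.- + n ℤ.* i) - x ≈ ι (+ n ℤ.* (ℤ.- i))
    coordinate n m i {x} x≈ = trans (+-cong (ι-+ (+ m) (ℤ.- (+ n ℤ.* i))) (-‿cong x≈))
      (trans (solve 2 (λ m z → (m :+ z) :- m := z) refl (ι (+ m)) (ι (ℤ.- (+ n ℤ.* i))))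
        (reflexive (≡.cong ι (ℤₚ.neg-distribʳ-* (+ n) i))))
    upper : ρ lattice α k ≤ root (squaredReturn k)
    upper = ≤-respʳ (trans (productNorm≈ X Y (parity k) ((refl , refl) , ≡.refl))
        (reflexive (≡.cong root (≡.cong₂ (λ x y → measure x y (parity k)) i≡ j≡))))
      (ρ≤ k ((ι X , ι Y) , parity k)
        ( ℤ.- i , ℤ.- j , coordinate n₁ (k ℕ.* a₁) i (proj₁ (proj₁ (·α≈ k)))
        , coordinate n₂ (k ℕ.* a₂) j (proj₂ (proj₁ (·α≈ k)))
        , ≡.trans (≡.cong (parity k ℙ.+_) (proj₂ (·α≈ k))) (ℙₚ.p+p≡0ℙ (parity k))))
    difference : ∀ n m i {x l} → x ≈ ι (+ m) → l ≈ ι (+ n ℤ.* i) → (x - 0#) - l ≈ ι (+ m ℤ.- + n ℤ.* i)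
    difference n m i {x} {l} x≈ l≈ = trans (solve 2 (λ x l → (x :- con (+ 0)) :- l := x :- l) refl x l)
      (trans (+-cong x≈ (-‿cong l≈)) (sym (trans (ι-+ (+ m) (ℤ.- (+ n ℤ.* i))) (+-congˡ (ι-neg (+ n ℤ.* i))))))
    lower : root (squaredReturn k) ≤ ρ lattice α k
    lower = proj₂ (ρ-isInfimum k) _ λ { x (l , (i , j , x′≈ , y′≈ , ≡.refl) , x≈) →
      ≤-respʳ (sym (trans x≈ (productNorm≈ (+ (k ℕ.* a₁) ℤ.- + n₁ ℤ.* i) (+ (k ℕ.* a₂) ℤ.- + n₂ ℤ.* j) (parity k)
        ((difference n₁ (k ℕ.* a₁) i (proj₁ (proj₁ (·α≈ k))) x′≈ ,
          difference n₂ (k ℕ.* a₂) j (proj₂ (proj₁ (·α≈ k))) y′≈) ,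
         ≡.trans (ℙₚ.+-identityʳ _) (≡.trans (ℙₚ.+-identityʳ _) (proj₂ (·α≈ k)))))))
      (root-mono-≤ (measure-mono (parity k) (distanceToMultiples-≤ n₁ (k ℕ.* a₁) i)
        (distanceToMultiples-≤ n₂ (k ℕ.* a₂) j))) }

  -- The condition for the next best return, transferred to squared natural numbers and bounded by
  -- q′, hence decidable.
  IsNextRecord : ℕ → ℕ → Set
  IsNextRecord q q′ = q ℕ.< q′ × squaredReturn q′ ℕ.< squaredReturn q ×
    (∀ {r} → r ℕ.< q′ → q ℕ.< r → squaredReturn q ℕ.≤ squaredReturn r)

  isNextRecord? : ∀ q q′ → Dec (IsNextRecord q q′)
  isNextRecord? q q′ = q ℕₚ.<? q′ ×-dec (squaredReturn q′ ℕₚ.<? squaredReturn q ×-dec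
    ℕₚ.allUpTo? (λ r → q ℕₚ.<? r →-dec squaredReturn q ℕₚ.≤? squaredReturn r) q′)

  next-record : ∀ {n q q′} → BestReturn lattice α n q → IsNextRecord q q′ → BestReturn lattice α (suc n) q′
  next-record {q = q} {q′} b (q<q′ , m< , least) = next b ((q<q′ , ρ<) , λ r (q<r , ρr<ρq) →
    ℕₚ.≮⇒≥ λ r<q′ → ≤⇒≯ (≤-respˡ (sym (ρ≈ q)) (≤-respʳ (sym (ρ≈ r)) (root-mono-≤ (least r<q′ q<r)))) ρr<ρq)
    where
    ρ< : ρ lattice α q′ < ρ lattice α q
    ρ< = <-respˡ (sym (ρ≈ q′)) (<-respʳ (sym (ρ≈ q)) (√-mono-< _ _ (·1-mono-< m<)))

  private
    module V = Space em plane

  -- If a coordinate x were nonzero, scaling by 1/(2x) would make 1/2 an integer.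
  LineSpace-trivial : ∀ v → v ∈ LineSpace lattice → v V.≈ᴹ V.0ᴹ
  LineSpace-trivial (x , y) line =
    zero-if n₁ x (λ t → let i , _ , x≈ , _ = line t in i , x≈) ,
    zero-if n₂ y (λ t → let _ , j , _ , y≈ , _ = line t in j , y≈)
    where
    odd : ∀ k → ¬ (+ 2 ℤ.* k ≡ + 1)
    odd k e with ℤ.∣ k ∣ | ≡.trans (≡.sym (ℤₚ.abs-* (+ 2) k)) (≡.cong ℤ.∣_∣ e)
    ... | zero  | ()
    ... | suc m | e′ with () ← ≡.trans (≡.sym (ℕₚ.+-suc m (m ℕ.+ 0))) (ℕₚ.suc-injective e′)
    zero-if : ∀ n x → (∀ t → ∃[ i ] t * x ≈ ι (+ n ℤ.* i)) → x ≈ 0#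
    zero-if n x multiples with em {x ≈ 0#}
    ... | yes p = p
    ... | no x≉0 = ⊥-elim (odd (+ n ℤ.* i) (ι-injective (begin
        ι (+ 2 ℤ.* (+ n ℤ.* i))         ≈⟨ ι-* (+ 2) (+ n ℤ.* i) ⟩
        ι (+ 2) * ι (+ n ℤ.* i)         ≈⟨ *-congˡ tx≈ ⟨
        ι (+ 2) * (h * x⁻¹ * x)         ≈⟨ solve 4 (λ o h i x → o :* (h :* i :* x) := (o :* h) :* (x :* i)) refl (ι (+ 2)) h x⁻¹ x ⟩
        (ι (+ 2) * h) * (x * x⁻¹)       ≈⟨ *-cong (trans (*-congʳ (+-congˡ (+-identityʳ 1#))) (proj₂ (proj₂ half))) xx⁻¹≈1 ⟩
        1# * 1#                         ≈⟨ trans (*-identityʳ 1#) (sym (+-identityʳ 1#)) ⟩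
        ι (+ 1)                         ∎)))
      where
      open ≈-Reasoning
      x⁻¹ = proj₁ (*-inverse x x≉0)
      xx⁻¹≈1 = proj₂ (*-inverse x x≉0)
      i = proj₁ (multiples (h * x⁻¹))
      tx≈ = proj₂ (multiples (h * x⁻¹))

  projection-trivial : ∀ v → V.IsProjectionOntoComplement (LineSpace lattice) v v
  projection-trivial v = (λ w w∈ → trans (V.⟨,⟩-cong {v} {v} V.≈ᴹ-refl (LineSpace-trivial w w∈)) (V.⟨,0⟩ v)) ,
    λ t → ClosedSubgroup.respects lattice
      ((sym (zero-part (proj₁ v) t) , sym (zero-part (proj₂ v) t)) , ≡.refl) (ClosedSubgroup.ε-closed lattice)
    where
    zero-part : ∀ x t → t * (x - x) ≈ 0#
    zero-part x t = trans (*-congˡ (-‿inverseʳ x)) (zeroʳ t)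

  scaled∈EffectiveSpace : ∀ {v c w} → w V.≈ᴹ c V.*ₗ v → ∃[ u ] IsMember (v , u) →
                          w ∈ EffectiveSpace lattice
  scaled∈EffectiveSpace {v} {c} w≈ (u , member) = 1 , (λ _ → c) , (λ _ → v) ,
    (λ _ → v , u , member , projection-trivial v) , V.≈ᴹ-trans w≈ (V.≈ᴹ-sym (V.+ᴹ-identityʳ (c V.*ₗ v)))

  private
    reciprocal : ∀ n → .{{NonZero n}} → ∃[ c ] c * ι (+ n ℤ.* + 1) ≈ 1#
    reciprocal (suc n) with inverse-pos (<-≤-trans 0<1 (·1-nonZero n))
    ... | c , _ , nc≈1 = c , trans (*-congˡ (reflexive (≡.cong ι (ℤₚ.*-identityʳ (+ suc n)))))
      (trans (*-comm _ _) nc≈1)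

    origin : ∀ n → 0# ≈ ι (+ n ℤ.* + 0)
    origin n = reflexive (≡.cong ι (≡.sym (ℤₚ.*-zeroʳ (+ n))))

  first∈EffectiveSpace : .{{NonZero n₁}} → (1# , 0#) ∈ EffectiveSpace lattice
  first∈EffectiveSpace = scaled∈EffectiveSpace {ι (+ n₁ ℤ.* + 1) , 0#} {proj₁ (reciprocal n₁)}
    (sym (proj₂ (reciprocal n₁)) , sym (zeroʳ _)) (0ℙ , + 1 , + 0 , refl , origin n₂ , ≡.refl)

  second∈EffectiveSpace : .{{NonZero n₂}} → (0# , 1#) ∈ EffectiveSpace lattice
  second∈EffectiveSpace = scaled∈EffectiveSpace {0# , ι (+ n₂ ℤ.* + 1)} {proj₁ (reciprocal n₂)}
    (sym (zeroʳ _) , sym (proj₂ (reciprocal n₂))) (0ℙ , + 0 , + 1 , origin n₁ , refl , ≡.refl)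

  effectiveDimension-2 : .{{NonZero n₁}} → .{{NonZero n₂}} → EffectiveDimension lattice 2
  effectiveDimension-2 = standardBasis , standardBasis-isBasis (EffectiveSpace lattice)
    λ { zero → first∈EffectiveSpace ; (suc _) → second∈EffectiveSpace }

  EffectiveSpace-flat : n₁ ≡ 0 → ∀ v → v ∈ EffectiveSpace lattice → proj₁ v ≈ 0#
  EffectiveSpace-flat ≡.refl v (n , c , b , b∈ , v≈) = trans (proj₁ v≈) (combination c b λ i →
    let w , u , (_ , _ , w₁≈ , _) , (_ , w-b∈) = b∈ i in
    trans (solve 2 (λ w b → b := w :- (w :- b)) refl (proj₁ w) (proj₁ (b i)))
      (trans (+-cong w₁≈ (-‿cong (proj₁ (LineSpace-trivial _ w-b∈)))) (-‿inverseʳ 0#)))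
    where
    combination : ∀ {n} (c : Fin n → Carrier) b → (∀ i → proj₁ (b i) ≈ 0#) →
                  proj₁ (V.linearCombination c b) ≈ 0#
    combination {zero}  c b flat = refl
    combination {suc n} c b flat = trans (+-cong (trans (*-congˡ (flat zero)) (zeroʳ _))
      (combination (λ i → c (suc i)) (λ i → b (suc i)) (λ i → flat (suc i)))) (+-identityˡ 0#)

  effectiveDimension-1 : n₁ ≡ 0 → .{{NonZero n₂}} → EffectiveDimension lattice 1
  effectiveDimension-1 n₁≡0 = (λ _ → 0# , 1#) , record
    { members     = λ _ → second∈EffectiveSpace
    ; independent = λ { c (_ , c₀≈0) zero →
        trans (sym (trans (+-identityʳ _) (*-identityʳ (c zero)))) c₀≈0 }
    ; spanning    = λ v v∈E → (λ _ → proj₂ v) ,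
        trans (EffectiveSpace-flat n₁≡0 v v∈E) (sym (trans (+-identityʳ _) (zeroʳ (proj₂ v)))) ,
        sym (trans (+-identityʳ _) (*-identityʳ (proj₂ v)))
    }

  dimension : DimensionOf plane 2
  dimension = standardBasis , standardBasis-isBasis Everything (λ _ → _)

-- Explicit examples

Sharp : CompleteOrderedField → ℕ → Set₁
Sharp ℝ m =
  Σ[ V ∈ InnerProductSpace ℝ ]
  Σ[ d ∈ ℕ ] 1 ℕ.≤ d × DimensionOf V d ×
  Σ[ U ∈ UltrametricGroup ℝ ]
  Σ[ Λ ∈ ClosedSubgroup V U ] EffectiveDimension Λ m ×
  Σ[ α ∈ AbelianGroup.Carrier (Quotient Λ) ]
  ∃[ n ] ∃[ q ] ∃[ q′ ] ∃[ q″ ]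
    1 ℕ.≤ n ×
    BestReturn Λ α n q ×
    BestReturn Λ α (n ℕ.+ 1) q′ ×
    BestReturn Λ α (n ℕ.+ 2 ℕ.^ m) q″ ×
    q″ ℕ.< q ℕ.+ q′

-- At 1, 3, 4, 6 the multiples of 18 are at distances 8, 2, 6, 4 from 26ℤ. Odd multiples cost at
-- least 7, since c + 1 = 49, so the squared returns are 64, 49, 36, 16. Without the parity, 3 would
-- return to within 2 and neither 4 nor 6 would be a record.
sharp-1 : ExcludedMiddle 0ℓ → (ℝ : CompleteOrderedField) → Sharp ℝ 1
sharp-1 em ℝ = plane , 2 , ℕ.s≤s ℕ.z≤n , dimension , _ , lattice , effectiveDimension-1 ≡.refl , α ,
  2 , 3 , 4 , 6 , ℕ.s≤s ℕ.z≤n , b₂ , b₃ , b₄ , ℕₚ.≤-refl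
  where
  open EuclideanPlane em ℝ using (plane)
  open Lattice em ℝ 0 26 0 18 48
  b₂ = next-record first (from-yes (isNextRecord? 1 3))
  b₃ = next-record b₂ (from-yes (isNextRecord? 3 4))
  b₄ = next-record b₃ (from-yes (isNextRecord? 4 6))

-- The squared returns at 1, 2, 3, 7, 10, 12, 14, 16 are 274, 106, 104, 102, 101, 89, 36, 34. The
-- real part at 7 has square only 9; the parity norm, with c + 1 = 102, lifts it just above the 101
-- at 10 and keeps all later odd multiples from being records.
sharp-2 : ExcludedMiddle 0ℓ → (ℝ : CompleteOrderedField) → Sharp ℝ 2
sharp-2 em ℝ = plane , 2 , ℕ.s≤s ℕ.z≤n , dimension , _ , lattice , effectiveDimension-2 , α ,
  4 , 7 , 10 , 16 , ℕ.s≤s ℕ.z≤n , b₄ , b₅ , b₈ , ℕₚ.≤-refl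
  where
  open EuclideanPlane em ℝ using (plane)
  open Lattice em ℝ 23 35 16 20 101
  b₄ = next-record (next-record (next-record first (from-yes (isNextRecord? 1 2)))
    (from-yes (isNextRecord? 2 3))) (from-yes (isNextRecord? 3 7))
  b₅ = next-record b₄ (from-yes (isNextRecord? 7 10))
  b₈ = next-record (next-record (next-record b₅ (from-yes (isNextRecord? 10 12)))
    (from-yes (isNextRecord? 12 14))) (from-yes (isNextRecord? 14 16))

open import Data.Nat.Base using (_+_; _^_; _≤_; _<_)

theorem3 :
  ExcludedMiddle 0ℓ →
  (ℝ : CompleteOrderedField) →
  ( (V : InnerProductSpace ℝ) (d : ℕ) → 1 ≤ d → DimensionOf V d →
    (U : UltrametricGroup ℝ) (Λ : ClosedSubgroup V U) →
    (m : ℕ) → m ≡ 1 ⊎ m ≡ 2 → EffectiveDimension Λ m →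
    (α : AbelianGroup.Carrier (Quotient Λ)) →
    (n q q′ q″ : ℕ) → 1 ≤ n →
    BestReturn Λ α n q →
    BestReturn Λ α (n + 1) q′ →
    BestReturn Λ α (n + 2 ^ m + 1) q″ →
    q + q′ < q″ )
  ×
  ( (m : ℕ) → m ≡ 1 ⊎ m ≡ 2 →
    Σ[ V ∈ InnerProductSpace ℝ ]
    Σ[ d ∈ ℕ ] 1 ≤ d × DimensionOf V d ×
    Σ[ U ∈ UltrametricGroup ℝ ]
    Σ[ Λ ∈ ClosedSubgroup V U ] EffectiveDimension Λ m ×
    Σ[ α ∈ AbelianGroup.Carrier (Quotient Λ) ]
    ∃[ n ] ∃[ q ] ∃[ q′ ] ∃[ q″ ]
      1 ≤ n ×
      BestReturn Λ α n q ×
      BestReturn Λ α (n + 1) q′ ×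
      BestReturn Λ α (n + 2 ^ m) q″ ×
      q″ < q + q′ )
theorem3 em ℝ =
  (λ V d _ dimension U Λ m m≡ effective α n q q′ q″ _ b b′ b″ →
    upper-bound em dimension Λ m m≡ effective α n q q′ q″ b b′ b″) ,
  λ where
    _ (inj₁ ≡.refl) → sharp-1 em ℝ
    _ (inj₂ ≡.refl) → sharp-2 em ℝ
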